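{- (i) A query $q\in\mathcal Q_p[\bigcirc,\Diamond_r](\mathcal{ELI})$ is uniquely characterisable within $\mathcal Q_p[\bigcirc,\Diamond_r](\mathcal{ELI})$ if and only if $q$ is safe. (ii) Those queries that are uniquely characterisable within $\mathcal Q_p[\bigcirc,\Diamond_r](\mathcal{ELI})$ are actually polynomially characterisable within $\mathcal Q_p[\bigcirc,\Diamond_r](\mathcal{ELI})$: there is a polynomial $f$ such that each such $q$ is uniquely characterised within $\mathcal Q_p[\bigcirc,\Diamond_r](\mathcal{ELI})$ by some example set $E$ with $|E|\le f(|q|)$. (iii) The class $\mathcal Q_p[\bigcirc,\Diamond_r](\mathcal{ELI})$ is polynomially characterisable for bounded query size. (iv) The class $\mathcal Q_p[\bigcirc,\Diamond](\mathcal{ELI})$ is polynomially characterisable (within itself).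
   Context: **Data.** A data instance $\mathcal A$ is a finite set of facts $A(a)$, $P(a,b)$ with unary predicate symbols $A$, binary predicate symbols $P$ and individual names $a,b$; we write $P^-(a,b)\in\mathcal A$ iff $P(b,a)\in\mathcal A$. $\mathrm{ind}(\mathcal A)$ is the set of individual names in $\mathcal A$. A temporal data instance is a finite sequence $\mathcal D=\mathcal A_0,\dots,\mathcal A_n$, with $\mathcal A_\ell=\emptyset$ for $\ell>n$; $\mathrm{ind}(\mathcal D)=\bigcup_i\mathrm{ind}(\mathcal A_i)$, $|\mathcal D|=\sum_i|\mathcal A_i|$. **Queries.** $\mathcal{ELI}$-queries are built from $\top$ and unary symbols $A$ using $\wedge$ and $\exists S.r$, where $S$ is $P$ or $P^-$ for a binary symbol $P$. For $\Phi\subseteq\{\bigcirc,\Diamond,\Diamond_r\}$, $\mathcal Q_p[\Phi](\mathcal{ELI})$ is the class of queries $r_0\wedge o_1(r_1\wedge o_2(r_2\wedge\dots\wedge o_nr_n))$ with $n\ge 0$, $o_i\in\Phi$ and $\mathcal{ELI}$-queries $r_i$. Truth: $\mathcal D,a,\ell\models A$ iff $A(a)\in\mathcal A_\ell$; $\mathcal D,a,\ell\models\exists S.r$ iff there is $b\in\mathrm{ind}(\mathcal A_\ell)$ with $S(a,b)\in\mathcal A_\ell$ and $\mathcal D,b,\ell\models r$; $\bigcirc q$ is true at $(a,\ell)$ iff $q$ is true at $(a,\ell+1)$; $\Diamond q$ iff $q$ is true at $(a,m)$ for some $m>\ell$; $\Diamond_rq$ iff $q$ is true at $(a,m)$ for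 some $m\ge\ell$; $\top,\wedge$ as usual. $q\models q'$ means truth of $q$ at any $(\mathcal D,a,\ell)$ implies truth of $q'$ there; $\equiv$ is mutual entailment. Since $\Diamond q\equiv\bigcirc\Diamond_rq$, $\Diamond$ may also be used in representing queries in $\mathcal Q_p[\bigcirc,\Diamond_r](\mathcal{ELI})$. $|q|$ is the number of symbols in $q$. **Characterisability.** An example set is a pair $E=(E^+,E^-)$ of finite sets of pointed temporal data instances $(\mathcal D,a)$, $a\in\mathrm{ind}(\mathcal D)$; $|E|$ is the sum of the $|\mathcal D|$. $q$ fits $E$ if $\mathcal D,a,0\models q$ for $(\mathcal D,a)\in E^+$ and $\mathcal D,a,0\not\models q$ for $(\mathcal D,a)\in E^-$. $E$ uniquely characterises $q$ within $\mathcal Q$ if $q$ fits $E$ and $q\equiv q'$ for all $q'\in\mathcal Q$ fitting $E$; $q$ is uniquely characterisable within $\mathcal Q$ if such an $E$ exists. $\mathcal Q$ is polynomially characterisable (within itself) if there is a polynomial $f$ such that each $q\in\mathcal Q$ is uniquely characterised within $\mathcal Q$ by some $E$ with $|E|\le f(|q|)$. $\mathcal Q$ is polynomially characterisable for bounded query size if there is a polynomial $f$ such that for all $n$ every $q\in\mathcal Q^n$ is uniquely characterised within $\mathcal Q^n$ by some $E$ with $|E|\le f(n)$, where $\mathcal Q^n=\{q\in\mathcal Q: |q|\le n\}$. **Normal form and safety.** A query in $\mathcal Q_p[\bigcirc,\Diamond,\Diamond_r](\mathcal{ELI})$ is represented as a sequence $r_0(t_0),R_1(t_0,t_1),r_1(t_1),\dots,R_n(t_{n-1},t_n),r_n(t_n)$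 with $R_i\in\{\mathit{suc},<,\le\}$ according to $o_i=\bigcirc,\Diamond,\Diamond_r$. Divide it as $q_0\mathcal R_1q_1\dots\mathcal R_nq_n$, where each block $q_i$ is a maximal $\mathit{suc}$-chain $r^i_0,\dots,r^i_{k_i}$ ($k_i\ge0$) and each $\mathcal R_i$ is a nonempty sequence of relations from $\{<,\le\}$ from the last point of $q_{i-1}$ to the first point of $q_i$ with intermediate points labelled by $\top$. A block is primitive if $k_i=0$. A lone conjunct is a primitive block $q_i=r^i_0$ with $i>0$ such that $r^i_0$ is equivalent to some $p_1\wedge p_2$ with $\mathcal{ELI}$-queries $p_1,p_2$ such that $p_1\not\models r^i_0$ and $p_2\not\models r^i_0$. The query is in normal form if: (n1) $r^i_0\not\equiv\top$ if $i>0$, and $r^i_{k_i}\not\equiv\top$ if $i>0$ or $k_i>0$; (n2) each $\mathcal R_i$ is a single $\le$ or a sequence of $<$; (n3) $r^i_{k_i}\not\models r^{i+1}_0$ if $q_{i+1}$ is primitive and $\mathcal R_{i+1}$ is $\le$; (n4) $r^{i+1}_0\not\models r^i_{k_i}$ if $i>0$, $q_i$ is primitive and $\mathcal R_{i+1}$ is $\le$. A query is safe if it is equivalent to a query in normal form without lone conjuncts. -}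

module Defs where

open import Data.Fin.Base using (Fin; toℕ; inject₁)
open import Data.List.Base using (List; []; _∷_; concatMap; deduplicate; drop; foldr; head; length; map)
open import Data.List.Membership.Propositional using (_∈_)
open import Data.List.NonEmpty as List⁺ using (List⁺; _∷_; toList)
open import Data.List.Relation.Unary.All using (All)
open import Data.Maybe.Base using (fromMaybe)
open import Data.Nat.Base using (ℕ; zero; suc; _+_; _*_; _≤_; _<_)
open import Data.Nat.ListAction using (sum)
open import Data.Nat.Properties using () renaming (_≟_ to _≟ℕ_)
open import Data.Product.Base using (∃; ∃-syntax; _×_; _,_)
open import Data.Sum.Base using (_⊎_)
open import Data.Unit.Base using (⊤)
open import Data.Vec.Base using (Vec; []; _∷_; lookup)
open import Level using (0ℓ)
open import Relation.Binary.Definitions using (DecidableEquality)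
open import Relation.Binary.PropositionalEquality using (_≡_; refl)
open import Relation.Nullary.Decidable using (no; map′; _×-dec_)
open import Relation.Nullary.Negation using (¬_)
open import Relation.Unary using (Pred)

-- There is a countably infinite supply of symbols and names of each kind.
-- An unlimited supply matters: if the only predicate symbol were a unary A,
-- then ◇ᵣ A would be true at time 0 in every pointed instance, and ⊤ would
-- not be uniquely characterisable.

UnarySymbol BinarySymbol Individual : Set
UnarySymbol  = ℕ
BinarySymbol = ℕ
Individual   = ℕ

data Fact : Set where
  unary  : UnarySymbol → Individual → Fact
  binary : BinarySymbol → Individual → Individual → Fact

_≟ᶠ_ : DecidableEquality Fact
unary A a    ≟ᶠ unary B b    =
  map′ (λ { (refl , refl) → refl }) (λ { refl → refl , refl })
       (A ≟ℕ B ×-dec a ≟ℕ b)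
unary _ _    ≟ᶠ binary _ _ _ = no λ ()
binary _ _ _ ≟ᶠ unary _ _    = no λ ()
binary P a b ≟ᶠ binary Q c d =
  map′ (λ { (refl , refl , refl) → refl }) (λ { refl → refl , refl , refl })
       (P ≟ℕ Q ×-dec a ≟ℕ c ×-dec b ≟ℕ d)

-- Finite sets of facts are lists up to order and repetition; the size
-- below is the cardinality of the set.

DataInstance : Set
DataInstance = List Fact

factInd : Fact → List Individual
factInd (unary _ a)    = a ∷ []
factInd (binary _ a b) = a ∷ b ∷ []

ind : DataInstance → List Individual
ind = concatMap factInd

∣_∣ᴬ : DataInstance → ℕ
∣ 𝒜 ∣ᴬ = length (deduplicate _≟ᶠ_ 𝒜)

TemporalInstance : Set
TemporalInstance = List⁺ DataInstance

_at_ : TemporalInstance → ℕ → DataInstance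
𝒟 at ℓ = fromMaybe [] (head (drop ℓ (toList 𝒟)))

indᵀ : TemporalInstance → List Individual
indᵀ 𝒟 = concatMap ind (toList 𝒟)

∣_∣ᵀ : TemporalInstance → ℕ
∣ 𝒟 ∣ᵀ = sum (map ∣_∣ᴬ (toList 𝒟))

data Role : Set where
  fwd inv : BinarySymbol → Role

role : Role → Individual → Individual → Fact
role (fwd P) a b = binary P a b
role (inv P) a b = binary P b a

infixr 6 _∧ᵉ_

data ELI : Set where
  ⊤ᵉ   : ELI
  atom : UnarySymbol → ELI
  _∧ᵉ_ : ELI → ELI → ELI
  ∃ᵉ   : Role → ELI → ELI

data Op : Set where
  ○ ◇ ◇ᵣ : Op

infixr 5 _∧[_]_

-- r ∧[ o ] q is r ∧ o q.

data Query : Set where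
  ⌊_⌋     : ELI → Query
  _∧[_]_ : ELI → Op → Query → Query

Class : Set₁
Class = Pred Query 0ℓ

𝒬ₚ[_] : Pred Op 0ℓ → Class
𝒬ₚ[ Φ ] ⌊ r ⌋        = ⊤
𝒬ₚ[ Φ ] (r ∧[ o ] q) = Φ o × 𝒬ₚ[ Φ ] q

infix 4 _,_⊨ᵉ_ _,_,_⊨_

_,_⊨ᵉ_ : DataInstance → Individual → ELI → Set
𝒜 , a ⊨ᵉ ⊤ᵉ       = ⊤
𝒜 , a ⊨ᵉ atom A   = unary A a ∈ 𝒜
𝒜 , a ⊨ᵉ r ∧ᵉ r′  = 𝒜 , a ⊨ᵉ r × 𝒜 , a ⊨ᵉ r′
𝒜 , a ⊨ᵉ ∃ᵉ S r   = ∃[ b ] b ∈ ind 𝒜 × role S a b ∈ 𝒜 × 𝒜 , b ⊨ᵉ r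

_,_,_⊨_ : TemporalInstance → Individual → ℕ → Query → Set
𝒟 , a , ℓ ⊨ ⌊ r ⌋         = 𝒟 at ℓ , a ⊨ᵉ r
𝒟 , a , ℓ ⊨ (r ∧[ ○  ] q) = 𝒟 at ℓ , a ⊨ᵉ r × 𝒟 , a , suc ℓ ⊨ q
𝒟 , a , ℓ ⊨ (r ∧[ ◇  ] q) = 𝒟 at ℓ , a ⊨ᵉ r × ∃[ m ] ℓ < m × 𝒟 , a , m ⊨ q
𝒟 , a , ℓ ⊨ (r ∧[ ◇ᵣ ] q) = 𝒟 at ℓ , a ⊨ᵉ r × ∃[ m ] ℓ ≤ m × 𝒟 , a , m ⊨ q

infix 4 _⊨_ _≣_ _⊨ᴱ_ _≣ᴱ_

_⊨_ : Query → Query → Set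
q ⊨ q′ = ∀ 𝒟 a ℓ → 𝒟 , a , ℓ ⊨ q → 𝒟 , a , ℓ ⊨ q′

_≣_ : Query → Query → Set
q ≣ q′ = q ⊨ q′ × q′ ⊨ q

_⊨ᴱ_ : ELI → ELI → Set
r ⊨ᴱ r′ = ⌊ r ⌋ ⊨ ⌊ r′ ⌋

_≣ᴱ_ : ELI → ELI → Set
r ≣ᴱ r′ = ⌊ r ⌋ ≣ ⌊ r′ ⌋

-- Parentheses are not counted, and a role P or P⁻ counts as one symbol.

∣_∣ᴱ : ELI → ℕ
∣ ⊤ᵉ ∣ᴱ      = 1
∣ atom _ ∣ᴱ  = 1
∣ r ∧ᵉ r′ ∣ᴱ = ∣ r ∣ᴱ + 1 + ∣ r′ ∣ᴱ
∣ ∃ᵉ _ r ∣ᴱ  = 2 + ∣ r ∣ᴱ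

∣_∣ : Query → ℕ
∣ ⌊ r ⌋ ∣      = ∣ r ∣ᴱ
∣ r ∧[ _ ] q ∣ = ∣ r ∣ᴱ + 2 + ∣ q ∣

record PointedInstance : Set where
  constructor pointed
  field
    instᵀ     : TemporalInstance
    point     : Individual
    point∈ind : point ∈ indᵀ instᵀ

open PointedInstance public

infix 4 _⊩_

_⊩_ : PointedInstance → Query → Set
e ⊩ q = instᵀ e , point e , 0 ⊨ q

-- Repetitions in the two lists do not affect fitting and can only increase
-- ∣_∣ˢ, which is only ever bounded from above under an existential.

record ExampleSet : Set where
  constructor examples
  field
    pos neg : List PointedInstance

open ExampleSet public

∣_∣ᴾ : PointedInstance → ℕ
∣ e ∣ᴾ = ∣ instᵀ e ∣ᵀ

∣_∣ˢ : ExampleSet → ℕ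
∣ E ∣ˢ = sum (map ∣_∣ᴾ (pos E)) + sum (map ∣_∣ᴾ (neg E))

Fits : Query → ExampleSet → Set
Fits q E = All (_⊩ q) (pos E) × All (λ e → ¬ (e ⊩ q)) (neg E)

UniquelyCharacterises : ExampleSet → Query → Class → Set
UniquelyCharacterises E q 𝒬 =
  Fits q E × (∀ q′ → 𝒬 q′ → Fits q′ E → q ≣ q′)

UniquelyCharacterisable : Query → Class → Set
UniquelyCharacterisable q 𝒬 = ∃[ E ] UniquelyCharacterises E q 𝒬

-- Coefficients, constant term first. Natural coefficients suffice because
-- polynomials only serve as upper bounds on natural numbers.

Polynomial : Set
Polynomial = List ℕ

eval : Polynomial → ℕ → ℕ
eval f x = foldr (λ c v → c + x * v) 0 f

CharacterisableWithin : Query → Class → ℕ → Set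
CharacterisableWithin q 𝒬 b =
  ∃[ E ] UniquelyCharacterises E q 𝒬 × ∣ E ∣ˢ ≤ b

PolynomiallyCharacterisable : Class → Set
PolynomiallyCharacterisable 𝒬 =
  ∃[ f ] ∀ q → 𝒬 q → CharacterisableWithin q 𝒬 (eval f ∣ q ∣)

_^≤_ : Class → ℕ → Class
(𝒬 ^≤ n) q = 𝒬 q × ∣ q ∣ ≤ n

PolynomiallyCharacterisableForBoundedSize : Class → Set
PolynomiallyCharacterisableForBoundedSize 𝒬 =
  ∃[ f ] ∀ n q → (𝒬 ^≤ n) q → CharacterisableWithin q (𝒬 ^≤ n) (eval f n)

data Gap : Set where
  lt le : Gap

gapOp : Gap → Op
gapOp lt = ◇
gapOp le = ◇ᵣ

Block Gaps : Set
Block = List⁺ ELI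
Gaps  = List⁺ Gap

first final : Block → ELI
first = List⁺.head
final = List⁺.last

-- The index k of the last point of a block r₀ , … , rₖ.
lastIndex : Block → ℕ
lastIndex b = length (List⁺.tail b)

Primitive : Block → Set
Primitive b = lastIndex b ≡ 0

-- A division q₀ ℛ₁ q₁ … ℛₙ qₙ; lookup gaps i is ℛ_{i+1}. Blocks are maximal
-- suc-chains because ℛᵢ contains no suc.

record Division : Set where
  constructor division
  field
    {len}  : ℕ
    blocks : Vec Block (suc len)
    gaps   : Vec Gaps len

  block : Fin (suc len) → Block
  block = lookup blocks

  gap : Fin len → Gaps
  gap = lookup gaps

-- The continuation receives the label of the last point of the chain.
chain : ELI → List ELI → (ELI → Query) → Query
chain r []        k = k r
chain r (r′ ∷ rs) k = r ∧[ ○ ] chain r′ rs k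

-- Points between consecutive relations of ℛᵢ are labelled by ⊤.
jump : ELI → Gap → List Gap → Query → Query
jump r g []        q = r ∧[ gapOp g ] q
jump r g (g′ ∷ gs) q = r ∧[ gapOp g ] jump ⊤ᵉ g′ gs q

blocksToQuery : ∀ {n} → Vec Block (suc n) → Vec Gaps n → Query
blocksToQuery ((r ∷ rs) ∷ [])  []              = chain r rs ⌊_⌋
blocksToQuery ((r ∷ rs) ∷ bs) ((g ∷ gs) ∷ gss) =
  chain r rs (λ r′ → jump r′ g gs (blocksToQuery bs gss))

⟦_⟧ : Division → Query
⟦ d ⟧ = blocksToQuery (Division.blocks d) (Division.gaps d)

IsLe : Gaps → Set
IsLe g = g ≡ le ∷ []

record NormalForm (d : Division) : Set where
  open Division d
  field
    n1-first : ∀ i → 0 < toℕ i → ¬ (first (block i) ≣ᴱ ⊤ᵉ)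
    n1-final : ∀ i → 0 < toℕ i ⊎ 0 < lastIndex (block i) →
               ¬ (final (block i) ≣ᴱ ⊤ᵉ)
    n2 : ∀ i → IsLe (gap i) ⊎ All (_≡ lt) (toList (gap i))
    n3 : ∀ (i : Fin len) → Primitive (block (Fin.suc i)) → IsLe (gap i) →
         ¬ (final (block (inject₁ i)) ⊨ᴱ first (block (Fin.suc i)))
    n4 : ∀ (i : Fin len) → 0 < toℕ i → Primitive (block (inject₁ i)) →
         IsLe (gap i) →
         ¬ (first (block (Fin.suc i)) ⊨ᴱ final (block (inject₁ i)))

LoneConjunct : (d : Division) → Fin (suc (Division.len d)) → Set
LoneConjunct d i =
  0 < toℕ i × Primitive (block i) ×
  ∃[ p₁ ] ∃[ p₂ ] r ≣ᴱ p₁ ∧ᵉ p₂ × ¬ (p₁ ⊨ᴱ r) × ¬ (p₂ ⊨ᴱ r)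
  where
  open Division d
  r = first (block i)

-- The witness may use ◇ even for q without ◇; the two are linked by ≣ only.
Safe : Query → Set
Safe q = ∃[ d ] NormalForm d × (∀ i → ¬ LoneConjunct d i) × q ≣ ⟦ d ⟧

{-# OPTIONS --safe #-}

-- Proof idea. An irredundant ELI-query r has a polynomial frontier: data instances
-- that refute r such that every query properly entailed by r holds in one of them,
-- indexed by the top-level conjuncts of r. It is a copy of the tree of r in which
-- each variable may lack one conjunct, provided that a neighbour along the missing
-- conjunct lacks some conjunct too. In particular, r is not a conjunction of properly
-- weaker queries iff its frontier has at most one element.
--
-- Let q have the normal form q₀ ℛ₁ q₁ … ℛₙ qₙ. The positive examples are the word
-- q₀ ∅ᴺ q₁ ∅ᴺ … qₙ, its variants with one gap as short as ℛᵢ permits, and one with short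
-- gaps, whose length bounds the temporal depth of every query true in it and serves as N.
-- By (n3) and (n4) the blocks of q fit into these words in one way only, so q fails
-- when a block is replaced by pieces not containing it: a label weakened to a frontier
-- element, or the block cut at a point that is doubled, one copy being weakened at the
-- ends of the block. A query q′ true in the words and false in all of these has the same
-- blocks as q up to equivalence, unless it splits a primitive block into a sequence of
-- properly weaker labels related by ≤. All labels in such a sequence hold in the single
-- element of the frontier if the block is not a lone conjunct, and otherwise in
-- sufficiently many copies of the frontier if the size of q′ is bounded; without ≤ the
-- sequence has length 1. Gaps are then compared using the words with one short gap,
-- made negative by shortening it by 1.
--
-- Conversely, a lone conjunct p₁ ∧ p₂ may be replaced by a sequence p₁ ≤ p₂ ≤ p₁ ≤ p₂ ≤ …
-- longer than all negative examples.

module Submission where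

open import Defs
open import Data.Empty using (⊥; ⊥-elim)
open import Data.Fin.Base as Fin using (Fin; toℕ; inject₁)
open import Data.List.Base using (List; []; _∷_; _++_; cartesianProduct; concat; concatMap; drop; filter; foldr; head; length; map; replicate)
open import Data.List.Membership.Propositional using (_∈_; find; lose)
open import Data.List.Membership.Propositional.Properties using (∈-++⁺ˡ; ∈-++⁺ʳ; ∈-++⁻; ∈-cartesianProduct⁺; ∈-cartesianProduct⁻; ∈-concatMap⁺; ∈-concatMap⁻; ∈-filter⁺; ∈-filter⁻; ∈-map⁺; ∈-map⁻)
open import Data.List.NonEmpty as List⁺ using (List⁺; _∷_; toList)
open import Data.List.Properties using (++-assoc; filter-notAll; length-++; length-deduplicate; length-filter; length-map; length-replicate; map-++)
import Data.List.Properties as List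
import Data.List.Base as List
open import Data.List.Relation.Unary.All as All using (All; []; _∷_)
import Data.List.Relation.Unary.All.Properties as All
open import Data.List.Relation.Binary.Pointwise as Pointwise using (Pointwise; []; _∷_)
open import Data.List.Relation.Unary.Any as Any using (Any; here; there)
open import Data.Maybe.Base using (Maybe; just; nothing; fromMaybe)
import Data.Maybe.Properties as Maybe
open import Data.Nat.Base using (ℕ; zero; suc; pred; _+_; _*_; _∸_; _⊔_; _≤_; _<_; z≤n; s≤s; s≤s⁻¹)
open import Data.Nat.ListAction using (sum)
open import Data.Nat.ListAction.Properties using (sum-++)
open import Data.Nat.Tactic.RingSolver using (solve-∀)
open import Data.Nat.Properties
open import Data.Product.Base using (Σ; ∃-syntax; _×_; _,_; proj₁; proj₂)
import Data.Product.Properties as Product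
open import Data.Sum.Base using (_⊎_; inj₁; inj₂)
open import Data.Unit.Base using (⊤; tt)
open import Data.Vec.Base as Vec using (Vec; []; _∷_)
open import Function.Base using (_∘_; id; case_of_)
open import Function.Bundles using (_⇔_; mk⇔)
open import Relation.Binary.Definitions using (DecidableEquality)
open import Relation.Binary.PropositionalEquality using (_≡_; _≢_; refl; sym; trans; cong; cong₂; subst; subst₂)
open import Relation.Nullary.Decidable using (Dec; yes; no; map′; _×-dec_; _→-dec_; ¬?)
open import Relation.Nullary.Negation using (¬_; contradiction)
open import Relation.Unary using (｛_｝; _∪_)

-- Frontiers need irredundancy: in a redundant tree a homomorphism could bypass the missing conjunct
-- by folding its branch onto another neighbour of the parent, possibly back along an inverse role.
-- Such a fold is shown to make the whole branch deletable, so it is enough to exclude deletions,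
-- and each deletion is decided by evaluating the query in a finite instance. The first block is
-- tied to time 0 and may begin with ⊤, whereas later blocks can slide. A word that refutes a first
-- block need not refute a later one: r ∅ᴺ r v refutes r v at time 0 but contains it further on.
-- Hence there are two kinds of cuts. One parameter `M`, the number of frontier copies put in place
-- of a later primitive block, serves all positive results: it is 1 if the frontiers of these blocks
-- have at most one element or if no ≤ occurs, and n for queries of size at most n. A pointed
-- instance must mention its point, which costs one extra fact. Positive examples occur twice, with
-- different symbols in this fact, so that no query can be true in all of them only because of it.

flip : Role → Role
flip (fwd P) = inv P
flip (inv P) = fwd P

flip-flip : ∀ S → flip (flip S) ≡ S
flip-flip (fwd P) = refl
flip-flip (inv P) = refl

-- Satisfaction in arbitrary structures and homomorphisms

record Structure : Set₁ where
  field
    X     : Set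
    U     : UnarySymbol → X → Set
    R     : Role → X → X → Set
    R-sym : ∀ {S x y} → R S x y → R (flip S) y x

open Structure

Sat : (G : Structure) → X G → ELI → Set
Sat G x ⊤ᵉ       = ⊤
Sat G x (atom A) = U G A x
Sat G x (r ∧ᵉ s) = Sat G x r × Sat G x s
Sat G x (∃ᵉ S r) = ∃[ y ] R G S x y × Sat G y r

record Morphism (G H : Structure) : Set where
  field
    fun   : X G → X H
    U-map : ∀ {A x} → U G A x → U H A (fun x)
    R-map : ∀ {S x y} → R G S x y → R H S (fun x) (fun y)

open Morphism

Sat-map : ∀ {G H} (φ : Morphism G H) r {x} → Sat G x r → Sat H (fun φ x) r
Sat-map φ ⊤ᵉ       _           = tt
Sat-map φ (atom A) u           = U-map φ u
Sat-map φ (r ∧ᵉ s) (p , q)     = Sat-map φ r p , Sat-map φ s q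
Sat-map φ (∃ᵉ S r) (y , e , p) = fun φ y , R-map φ e , Sat-map φ r p

idᴹ : ∀ {G} → Morphism G G
idᴹ = record { fun = id ; U-map = id ; R-map = id }

_∘ᴹ_ : ∀ {G H I} → Morphism H I → Morphism G H → Morphism G I
ψ ∘ᴹ φ = record { fun = fun ψ ∘ fun φ ; U-map = U-map ψ ∘ U-map φ ; R-map = R-map ψ ∘ R-map φ }

⟪_⟫ : DataInstance → Structure
⟪ 𝒜 ⟫ = record
  { X     = Individual
  ; U     = λ A a → unary A a ∈ 𝒜
  ; R     = λ S a b → role S a b ∈ 𝒜
  ; R-sym = λ { {fwd P} e → e ; {inv P} e → e }
  }

role-ind : ∀ {𝒜} S {a b} → role S a b ∈ 𝒜 → b ∈ ind 𝒜
role-ind (fwd P) e = ∈-concatMap⁺ factInd (lose e (there (here refl)))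
role-ind (inv P) e = ∈-concatMap⁺ factInd (lose e (here refl))

⊨ᵉ⇒Sat : ∀ {𝒜 a} r → 𝒜 , a ⊨ᵉ r → Sat ⟪ 𝒜 ⟫ a r
⊨ᵉ⇒Sat ⊤ᵉ       _               = tt
⊨ᵉ⇒Sat (atom A) u               = u
⊨ᵉ⇒Sat (r ∧ᵉ s) (p , q)         = ⊨ᵉ⇒Sat r p , ⊨ᵉ⇒Sat s q
⊨ᵉ⇒Sat (∃ᵉ S r) (b , _ , e , p) = b , e , ⊨ᵉ⇒Sat r p

Sat⇒⊨ᵉ : ∀ {𝒜 a} r → Sat ⟪ 𝒜 ⟫ a r → 𝒜 , a ⊨ᵉ r
Sat⇒⊨ᵉ ⊤ᵉ       _           = tt
Sat⇒⊨ᵉ (atom A) u           = u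
Sat⇒⊨ᵉ (r ∧ᵉ s) (p , q)     = Sat⇒⊨ᵉ r p , Sat⇒⊨ᵉ s q
Sat⇒⊨ᵉ (∃ᵉ S r) (b , e , p) = b , role-ind S e , e , Sat⇒⊨ᵉ r p

_∈?_ : ∀ f 𝒜 → Dec (f ∈ 𝒜)
f ∈? 𝒜 = Any.any? (f ≟ᶠ_) 𝒜

infix 4 _,_⊨ᵉ?_

_,_⊨ᵉ?_ : ∀ 𝒜 a r → Dec (𝒜 , a ⊨ᵉ r)
𝒜 , a ⊨ᵉ? ⊤ᵉ       = yes tt
𝒜 , a ⊨ᵉ? atom A   = unary A a ∈? 𝒜
𝒜 , a ⊨ᵉ? (r ∧ᵉ s) = (𝒜 , a ⊨ᵉ? r) ×-dec (𝒜 , a ⊨ᵉ? s)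
𝒜 , a ⊨ᵉ? ∃ᵉ S r   =
  map′ (λ w → let b , b∈ , p = find w in b , b∈ , p) (λ (b , b∈ , p) → lose b∈ p)
       (Any.any? (λ b → (role S a b ∈? 𝒜) ×-dec (𝒜 , b ⊨ᵉ? r)) (ind 𝒜))

-- A path lists the indices of the conjuncts passed, the last one first. It
-- stands both for a conjunct and for the existential variable below it, if any;
-- [] is the root variable.

Path : Set
Path = List ℕ

data Kind : Set where
  nil : Kind
  atm : UnarySymbol → Kind
  edg : Role → Kind

-- `hom` is total on paths, but it is constrained only at the variables that occur in `K`; its other
-- values are arbitrary.
record Hom (K : Path → Kind) (G : Structure) (x : X G) : Set where
  field
    hom  : Path → X G
    root : hom [] ≡ x
    atmᴴ : ∀ {i p A} → K (i ∷ p) ≡ atm A → U G A (hom p)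
    edgᴴ : ∀ {i p S} → K (i ∷ p) ≡ edg S → R G S (hom p) (hom (i ∷ p))

open Hom

Tree : (Path → Kind) → Structure
Tree K = record
  { X     = Path
  ; U     = λ A p → ∃[ i ] K (i ∷ p) ≡ atm A
  ; R     = λ S p q → (∃[ i ] q ≡ i ∷ p × K q ≡ edg S) ⊎ (∃[ i ] p ≡ i ∷ q × K p ≡ edg (flip S))
  ; R-sym = λ { {S} (inj₁ (i , e , k)) → inj₂ (i , e , trans k (cong edg (sym (flip-flip S))))
              ; (inj₂ (i , e , k)) → inj₁ (i , e , k) }
  }

morphism : ∀ {K G x} → Hom K G x → Morphism (Tree K) G
morphism {K} {G} h = record
  { fun   = hom h
  ; U-map = λ (i , k) → atmᴴ h k
  ; R-map = λ { (inj₁ (i , refl , k)) → edgᴴ h k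
              ; {S} (inj₂ (i , refl , k)) →
                  subst (λ S → R G S _ _) (flip-flip S) (R-sym G (edgᴴ h k)) }
  }

Hom-map : ∀ {K G H x} (φ : Morphism G H) → Hom K G x → Hom K H (fun φ x)
Hom-map φ h = record
  { hom  = fun φ ∘ hom h
  ; root = cong (fun φ) (root h)
  ; atmᴴ = U-map φ ∘ atmᴴ h
  ; edgᴴ = R-map φ ∘ edgᴴ h
  }

idᴴ : ∀ {K} → Hom K (Tree K) []
idᴴ = record { hom = id ; root = refl ; atmᴴ = λ k → _ , k ; edgᴴ = λ k → inj₁ (_ , refl , k) }

-- The pattern of an ELI-query

conjuncts : ELI → List ELI
conjuncts ⊤ᵉ       = []
conjuncts (atom A) = atom A ∷ []
conjuncts (r ∧ᵉ s) = conjuncts r ++ conjuncts s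
conjuncts (∃ᵉ S r) = ∃ᵉ S r ∷ []

nth : List ELI → ℕ → ELI
nth []       _       = ⊤ᵉ
nth (r ∷ rs) zero    = r
nth (r ∷ rs) (suc i) = nth rs i

body : ELI → ELI
body (∃ᵉ S r) = r
body _        = ⊤ᵉ

kindᵉ : ELI → Kind
kindᵉ (atom A) = atm A
kindᵉ (∃ᵉ S r) = edg S
kindᵉ _        = nil

below : ELI → Path → ELI
below r []      = r
below r (i ∷ p) = body (nth (conjuncts (below r p)) i)

pattern-of : ELI → Path → Kind
pattern-of r []      = nil
pattern-of r (i ∷ p) = kindᵉ (nth (conjuncts (below r p)) i)

conjuncts-sat : ∀ {G x} r → Sat G x r → All (Sat G x) (conjuncts r)
conjuncts-sat ⊤ᵉ       _       = []
conjuncts-sat (atom A) u       = u ∷ []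
conjuncts-sat (r ∧ᵉ s) (p , q) = All.++⁺ (conjuncts-sat r p) (conjuncts-sat s q)
conjuncts-sat (∃ᵉ S r) p       = p ∷ []

nth-sat : ∀ {G x rs} → All (Sat G x) rs → ∀ i → Sat G x (nth rs i)
nth-sat []       i       = tt
nth-sat (p ∷ ps) zero    = p
nth-sat (p ∷ ps) (suc i) = nth-sat ps i

module _ {G : Structure} where

  descend : ∀ r x → Sat G x r → Σ (X G) λ y → Sat G y (body r)
  descend ⊤ᵉ       x _           = x , tt
  descend (atom A) x _           = x , tt
  descend (r ∧ᵉ s) x _           = x , tt
  descend (∃ᵉ S r) x (y , _ , p) = y , p

  descend-R : ∀ r x (p : Sat G x r) {S} → kindᵉ r ≡ edg S → R G S x (proj₁ (descend r x p))
  descend-R (∃ᵉ S r) x (y , e , p) refl = e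

  atom-U : ∀ r x → Sat G x r → ∀ {A} → kindᵉ r ≡ atm A → U G A x
  atom-U (atom A) x u refl = u

  module _ (r : ELI) (x : X G) (p : Sat G x r) where

    assign : ∀ π → Σ (X G) λ y → Sat G y (below r π)
    conjunct : ∀ i π → Sat G (proj₁ (assign π)) (nth (conjuncts (below r π)) i)

    assign []      = x , p
    assign (i ∷ π) = descend (nth (conjuncts (below r π)) i) (proj₁ (assign π)) (conjunct i π)

    conjunct i π = nth-sat (conjuncts-sat (below r π) (proj₂ (assign π))) i

    Sat⇒Hom : Hom (pattern-of r) G x
    Sat⇒Hom = record
      { hom  = proj₁ ∘ assign
      ; root = refl
      ; atmᴴ = λ {i} {π} → atom-U _ _ (conjunct i π)
      ; edgᴴ = λ {i} {π} → descend-R _ _ (conjunct i π)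
      }

nth-++ˡ : ∀ rs {ss} i → kindᵉ (nth rs i) ≢ nil → nth (rs ++ ss) i ≡ nth rs i
nth-++ˡ []       i       n = contradiction refl n
nth-++ˡ (r ∷ rs) zero    n = refl
nth-++ˡ (r ∷ rs) (suc i) n = nth-++ˡ rs i n

nth-++ʳ : ∀ rs {ss} i → nth (rs ++ ss) (length rs + i) ≡ nth ss i
nth-++ʳ []       i = refl
nth-++ʳ (r ∷ rs) i = nth-++ʳ rs i

Hom⇒Sat : ∀ {G x} r → Hom (pattern-of r) G x → Sat G x r
Hom⇒Sat {G} r h = subst (λ x → Sat G x r) (root h) (go r [] 0 λ i _ → refl)
  where
  -- `s` is a part of the conjunction at `π`, where its conjuncts are numbered from `k`. The
  -- condition on kinds singles out the indices that belong to `s`, since `nth` yields ⊤ᵉ beyond the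
  -- end of a list.
  go : ∀ s π k → (∀ i → kindᵉ (nth (conjuncts s) i) ≢ nil →
                  nth (conjuncts (below r π)) (k + i) ≡ nth (conjuncts s) i) →
       Sat G (hom h π) s
  go ⊤ᵉ       π k eq = tt
  go (atom A) π k eq = atmᴴ h (cong kindᵉ (eq 0 λ ()))
  go (s ∧ᵉ t) π k eq =
      go s π k (λ i n → trans (eq i (n ∘ trans (sym (cong kindᵉ (nth-++ˡ (conjuncts s) i n)))))
                              (nth-++ˡ (conjuncts s) i n))
    , go t π (k + length (conjuncts s)) λ i n →
        let nt = nth-++ʳ (conjuncts s) {conjuncts t} i in
        trans (cong (nth (conjuncts (below r π))) (+-assoc k _ i))
              (trans (eq _ (n ∘ trans (sym (cong kindᵉ nt)))) nt)
  go (∃ᵉ S s) π k eq =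
    hom h ((k + 0) ∷ π) , edgᴴ h (cong kindᵉ (eq 0 λ ())) ,
    go s ((k + 0) ∷ π) 0 λ i _ → cong (λ t → nth (conjuncts (body t)) i) (eq 0 λ ())

-- The finitely many conjuncts of a query

-- `k` counts the conjuncts to the left of the query in the conjunction at `π`, so that the paths
-- agree with those of `pattern-of`.
support-from : ELI → Path → ℕ → List Path
support-from ⊤ᵉ       π k = []
support-from (atom A) π k = (k ∷ π) ∷ []
support-from (r ∧ᵉ s) π k = support-from r π k ++ support-from s π (k + length (conjuncts r))
support-from (∃ᵉ S r) π k = (k ∷ π) ∷ support-from r (k ∷ π) 0

length-support-from : ∀ r π k → length (support-from r π k) ≤ ∣ r ∣ᴱ
length-support-from ⊤ᵉ       π k = z≤n
length-support-from (atom A) π k = ≤-refl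
length-support-from (r ∧ᵉ s) π k = begin
  length (support-from r π k ++ _) ≡⟨ length-++ (support-from r π k) ⟩
  length (support-from r π k) + _  ≤⟨ +-mono-≤ (length-support-from r π k) (length-support-from s π _) ⟩
  ∣ r ∣ᴱ + ∣ s ∣ᴱ                  ≤⟨ +-monoˡ-≤ ∣ s ∣ᴱ (m≤m+n ∣ r ∣ᴱ 1) ⟩
  ∣ r ∣ᴱ + 1 + ∣ s ∣ᴱ              ∎
  where open ≤-Reasoning
length-support-from (∃ᵉ S r) π k = s≤s (≤-trans (length-support-from r _ 0) (n≤1+n _))

nth-split : ∀ rs {ss} i → (nth (rs ++ ss) i ≡ nth rs i) ⊎ (∃[ j ] i ≡ length rs + j × nth (rs ++ ss) i ≡ nth ss j)
nth-split []       i       = inj₂ (i , refl , refl)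
nth-split (r ∷ rs) zero    = inj₁ refl
nth-split (r ∷ rs) (suc i) with nth-split rs i
... | inj₁ e             = inj₁ e
... | inj₂ (j , e , e′) = inj₂ (j , cong suc e , e′)

conjunct∈support : ∀ r π k i → kindᵉ (nth (conjuncts r) i) ≢ nil → (k + i ∷ π) ∈ support-from r π k
conjunct∈support ⊤ᵉ       π k i       n = contradiction refl n
conjunct∈support (atom A) π k zero    n = here (cong (_∷ π) (+-identityʳ k))
conjunct∈support (atom A) π k (suc i) n = contradiction refl n
conjunct∈support (r ∧ᵉ s) π k i       n with nth-split (conjuncts r) i
... | inj₁ e = ∈-++⁺ˡ (conjunct∈support r π k i (n ∘ trans (cong kindᵉ e)))
... | inj₂ (j , refl , e) = ∈-++⁺ʳ _
  (subst (λ m → (m ∷ π) ∈ support-from s π (k + length (conjuncts r))) (+-assoc k _ j)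
    (conjunct∈support s π _ j (n ∘ trans (cong kindᵉ e))))
conjunct∈support (∃ᵉ S r) π k zero    n = here (cong (_∷ π) (+-identityʳ k))
conjunct∈support (∃ᵉ S r) π k (suc i) n = contradiction refl n

body-support : ∀ r π k i {ρ} → ρ ∈ support-from (body (nth (conjuncts r) i)) (k + i ∷ π) 0 → ρ ∈ support-from r π k
body-support (atom A) π k zero    ()
body-support (atom A) π k (suc i) ()
body-support (r ∧ᵉ s) π k i {ρ}   m with nth-split (conjuncts r) i
... | inj₁ e = ∈-++⁺ˡ (body-support r π k i (subst (λ e → ρ ∈ support-from (body e) _ 0) e m))
... | inj₂ (j , refl , e) = ∈-++⁺ʳ _
  (body-support s π _ j
    (subst₂ (λ e m → ρ ∈ support-from (body e) (m ∷ π) 0) e (sym (+-assoc k _ j)) m))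
body-support (∃ᵉ S r) π k zero    {ρ} m = there (subst (λ m → ρ ∈ support-from r (m ∷ π) 0) (+-identityʳ k) m)
body-support (∃ᵉ S r) π k (suc i) ()

below-support : ∀ r π {ρ} → ρ ∈ support-from (below r π) π 0 → ρ ∈ support-from r [] 0
below-support r []      m = m
below-support r (i ∷ π) m = below-support r π (body-support (below r π) π 0 i m)

-- Finite structures as data instances

data FactOver (X : Set) : Set where
  un : UnarySymbol → X → FactOver X
  bi : Role → X → X → FactOver X

FactStructure : ∀ {X} → List (FactOver X) → Structure
FactStructure {X} fs = record
  { X     = X
  ; U     = λ A x → un A x ∈ fs
  ; R     = λ S x y → bi S x y ∈ fs ⊎ bi (flip S) y x ∈ fs
  ; R-sym = λ { {S} (inj₁ e) → inj₂ (subst (λ S → bi S _ _ ∈ fs) (sym (flip-flip S)) e)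
              ; (inj₂ e) → inj₁ e }
  }

elements : ∀ {X} → FactOver X → List X
elements (un A x)   = x ∷ []
elements (bi S x y) = x ∷ y ∷ []

-- `x₀` heads `domain` and so receives the name 0, the point of every example. Since `decᴹ` inverts
-- `encᴹ` on all elements of facts, instance and structure satisfy the same queries.
module Realise {X : Set} (_≟ˣ_ : DecidableEquality X) (x₀ : X) (fs : List (FactOver X)) where

  code : List X → X → Individual
  code []       x = 0
  code (y ∷ ys) x with x ≟ˣ y
  ... | yes _ = 0
  ... | no  _ = suc (code ys x)

  decode : List X → Individual → X
  decode []       n       = x₀
  decode (y ∷ ys) zero    = y
  decode (y ∷ ys) (suc n) = decode ys n

  decode-code : ∀ {xs x} → x ∈ xs → decode xs (code xs x) ≡ x
  decode-code {y ∷ ys} {x} m with x ≟ˣ y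
  ... | yes refl = refl
  decode-code (here e)  | no n = contradiction e n
  decode-code (there m) | no n = decode-code m

  domain : List X
  domain = x₀ ∷ concatMap elements fs

  enc : X → Individual
  enc = code domain

  dec : Individual → X
  dec = decode domain

  enc-x₀ : enc x₀ ≡ 0
  enc-x₀ with x₀ ≟ˣ x₀
  ... | yes _ = refl
  ... | no  n = contradiction refl n

  fact : FactOver X → Fact
  fact (un A x)   = unary A (enc x)
  fact (bi S x y) = role S (enc x) (enc y)

  instanceOf : DataInstance
  instanceOf = map fact fs

  element : ∀ {f x} → f ∈ fs → x ∈ elements f → dec (enc x) ≡ x
  element f∈ x∈ = decode-code (there (∈-concatMap⁺ elements (lose f∈ x∈)))

  encᴹ : Morphism (FactStructure fs) ⟪ instanceOf ⟫
  encᴹ = record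
    { fun   = enc
    ; U-map = ∈-map⁺ fact
    ; R-map = λ { {S} (inj₁ e) → ∈-map⁺ fact e
                ; {S} (inj₂ e) → subst (λ S → role S _ _ ∈ instanceOf) (flip-flip S)
                                   (R-sym ⟪ instanceOf ⟫ {flip S} (∈-map⁺ fact e)) }
    }

  unary-fact : ∀ {A a} f → f ∈ fs → unary A a ≡ fact f → un A (dec a) ∈ fs
  unary-fact (un A x) f∈ refl =
    subst (λ y → un A y ∈ fs) (sym (element f∈ (here refl))) f∈
  unary-fact (bi (fwd P) x y) f∈ ()
  unary-fact (bi (inv P) x y) f∈ ()

  role-fact : ∀ S {a b} f → f ∈ fs → role S a b ≡ fact f → R (FactStructure fs) S (dec a) (dec b)
  role-fact (fwd P) (un A x)         f∈ ()
  role-fact (inv P) (un A x)         f∈ ()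
  role-fact (fwd P) (bi (fwd Q) x y) f∈ refl =
    inj₁ (subst₂ (λ x y → bi (fwd P) x y ∈ fs) (sym (element f∈ (here refl))) (sym (element f∈ (there (here refl)))) f∈)
  role-fact (fwd P) (bi (inv Q) x y) f∈ refl =
    inj₂ (subst₂ (λ x y → bi (inv P) x y ∈ fs) (sym (element f∈ (here refl))) (sym (element f∈ (there (here refl)))) f∈)
  role-fact (inv P) (bi (fwd Q) x y) f∈ refl =
    inj₂ (subst₂ (λ x y → bi (fwd P) x y ∈ fs) (sym (element f∈ (here refl))) (sym (element f∈ (there (here refl)))) f∈)
  role-fact (inv P) (bi (inv Q) x y) f∈ refl =
    inj₁ (subst₂ (λ x y → bi (inv P) x y ∈ fs) (sym (element f∈ (here refl))) (sym (element f∈ (there (here refl)))) f∈)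

  decᴹ : Morphism ⟪ instanceOf ⟫ (FactStructure fs)
  decᴹ = record
    { fun   = dec
    ; U-map = λ u → let f , f∈ , e = ∈-map⁻ fact u in unary-fact f f∈ e
    ; R-map = λ {S} u → let f , f∈ , e = ∈-map⁻ fact u in role-fact S f f∈ e
    }

  realise⁺ : ∀ r → Sat (FactStructure fs) x₀ r → instanceOf , 0 ⊨ᵉ r
  realise⁺ r p = Sat⇒⊨ᵉ r (subst (λ n → Sat ⟪ instanceOf ⟫ n r) enc-x₀ (Sat-map encᴹ r p))

  realise⁻ : ∀ r → instanceOf , 0 ⊨ᵉ r → Sat (FactStructure fs) x₀ r
  realise⁻ r p = Sat-map decᴹ r (⊨ᵉ⇒Sat r p)

-- The frontier of a tree

_≟ᵖ_ : DecidableEquality Path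
_≟ᵖ_ = List.≡-dec _≟_

-- In the frontier of a tree, a copy (p , just ρ) of the variable p is deprived of
-- its conjunct ρ: it keeps only those neighbours along ρ that are themselves
-- deprived of some conjunct. The copies (p , nothing) form the tree itself.

Label : Set
Label = Maybe Path

_≟ˡ_ : DecidableEquality Label
_≟ˡ_ = Maybe.≡-dec _≟ᵖ_

-- The neighbour must be labelled by a child of `ρ`: a copy of `ρ` with any other label lacks none
-- of its conjuncts.
Allowed : Label → Path → Label → Set
Allowed m ρ m′ = m ≡ just ρ → ∃[ j ] m′ ≡ just (j ∷ ρ)

allowed? : ∀ m ρ m′ → Dec (Allowed m ρ m′)
allowed? m ρ m′ = (m ≟ˡ just ρ) →-dec child? m′
  where
  child? : ∀ m′ → Dec (∃[ j ] m′ ≡ just (j ∷ ρ))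
  child? nothing        = no λ ()
  child? (just [])      = no λ ()
  child? (just (j ∷ π)) = map′ (λ { refl → j , refl }) (λ { (_ , refl) → refl }) (π ≟ᵖ ρ)

length-cartesianProduct : ∀ {X Y : Set} (xs : List X) (ys : List Y) →
                          length (cartesianProduct xs ys) ≡ length xs * length ys
length-cartesianProduct []       ys = refl
length-cartesianProduct (x ∷ xs) ys =
  trans (length-++ (map (x ,_) ys)) (cong₂ _+_ (length-map (x ,_) ys) (length-cartesianProduct xs ys))

length-map-filter : ∀ {X Y : Set} {P : X → Set} (f : X → Y) (P? : ∀ x → Dec (P x)) xs →
                    length (map f (filter P? xs)) ≤ length xs
length-map-filter f P? xs = ≤-trans (≤-reflexive (length-map f (filter P? xs))) (length-filter P? xs)

module Frontier (K : Path → Kind) (supp : List Path) (cover : ∀ {ρ} → K ρ ≢ nil → ρ ∈ supp) where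

  Point : Set
  Point = Path × Label

  labels : List Label
  labels = nothing ∷ map just supp

  atom-facts : UnarySymbol → Path → Path → List (FactOver Point)
  atom-facts A p ρ = map (λ m → un A (p , m)) (filter (λ m → ¬? (m ≟ˡ just ρ)) labels)

  edge-facts : Role → Path → Path → List (FactOver Point)
  edge-facts S p ρ = map (λ (m , m′) → bi S (p , m) (ρ , m′))
                         (filter (λ (m , m′) → allowed? m ρ m′) (cartesianProduct labels labels))

  facts-of : Path → Kind → List (FactOver Point)
  facts-of []      _       = []
  facts-of (i ∷ p) nil     = []
  facts-of (i ∷ p) (atm A) = atom-facts A p (i ∷ p)
  facts-of (i ∷ p) (edg S) = edge-facts S p (i ∷ p)

  facts : List (FactOver Point)
  facts = concatMap (λ ρ → facts-of ρ (K ρ)) supp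

  F : Structure
  F = FactStructure facts

  atom-fact⁺ : ∀ {i p A m} → K (i ∷ p) ≡ atm A → m ∈ labels → m ≢ just (i ∷ p) → un A (p , m) ∈ facts
  atom-fact⁺ {i} {p} {A} {m} k m∈ n = ∈-concatMap⁺ _ (lose (cover λ e → case trans (sym e) k of λ ())
    (subst (λ k → un A (p , m) ∈ facts-of (i ∷ p) k) (sym k)
      (∈-map⁺ _ (∈-filter⁺ (λ m → ¬? (m ≟ˡ just (i ∷ p))) m∈ n))))

  edge-fact⁺ : ∀ {i p S m m′} → K (i ∷ p) ≡ edg S → m ∈ labels → m′ ∈ labels → Allowed m (i ∷ p) m′ →
               bi S (p , m) (i ∷ p , m′) ∈ facts
  edge-fact⁺ {i} {p} {S} {m} {m′} k m∈ m′∈ n =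
    ∈-concatMap⁺ _ (lose (cover λ e → case trans (sym e) k of λ ())
      (subst (λ k → bi S (p , m) (i ∷ p , m′) ∈ facts-of (i ∷ p) k) (sym k)
        (∈-map⁺ _ (∈-filter⁺ (λ (m , m′) → allowed? m (i ∷ p) m′) (∈-cartesianProduct⁺ m∈ m′∈) n))))

  Edge : Role → Point → Point → Set
  Edge S (p , m) (q , m′) = ∃[ i ] q ≡ i ∷ p × K q ≡ edg S × m′ ∈ labels × Allowed m q m′

  fact-of⁻ : ∀ {f} → f ∈ facts → ∃[ ρ ] f ∈ facts-of ρ (K ρ)
  fact-of⁻ f∈ = let ρ , _ , e = find (∈-concatMap⁻ _ {xs = supp} f∈) in ρ , e

  atom-fact⁻ : ∀ {A p m} → un A (p , m) ∈ facts → ∃[ i ] K (i ∷ p) ≡ atm A × m ≢ just (i ∷ p)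
  atom-fact⁻ f∈ with fact-of⁻ f∈
  ... | (i ∷ q , e) with K (i ∷ q) in k
  ...   | atm A with ∈-map⁻ _ e
  ...     | m , m∈ , refl = i , k , proj₂ (∈-filter⁻ (λ m → ¬? (m ≟ˡ just (i ∷ q))) {xs = labels} m∈)
  atom-fact⁻ f∈ | (i ∷ q , e) | edg S with ∈-map⁻ _ e
  ...     | _ , _ , ()

  edge-fact⁻ : ∀ {S x y} → bi S x y ∈ facts → Edge S x y
  edge-fact⁻ f∈ with fact-of⁻ f∈
  ... | (i ∷ q , e) with K (i ∷ q) in k
  ...   | edg S with ∈-map⁻ _ e
  ...     | (m , m′) , m∈ , refl =
    let m∈L , a = ∈-filter⁻ (λ (m , m′) → allowed? m (i ∷ q) m′) {xs = cartesianProduct labels labels} m∈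
    in i , refl , k , proj₂ (∈-cartesianProduct⁻ labels labels m∈L) , a
  edge-fact⁻ f∈ | (i ∷ q , e) | atm A with ∈-map⁻ _ e
  ...     | _ , _ , ()

  projᴹ : Morphism F (Tree K)
  projᴹ = record
    { fun   = proj₁
    ; U-map = λ u → let i , k , _ = atom-fact⁻ u in i , k
    ; R-map = λ { (inj₁ e) → let i , eq , k , _ = edge-fact⁻ e in inj₁ (i , eq , k)
                ; (inj₂ e) → let i , eq , k , _ = edge-fact⁻ e in inj₂ (i , eq , k) }
    }

  embᴹ : Morphism (Tree K) F
  embᴹ = record
    { fun   = _, nothing
    ; U-map = λ (i , k) → atom-fact⁺ k (here refl) λ ()
    ; R-map = λ { (inj₁ (i , refl , k)) → inj₁ (edge-fact⁺ k (here refl) (here refl) λ ())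
                ; (inj₂ (i , refl , k)) → inj₂ (edge-fact⁺ k (here refl) (here refl) λ ()) }
    }

  open module Point (m : Label) =
    Realise {Point} (Product.≡-dec _≟ᵖ_ _≟ˡ_) ([] , m) facts
    using (realise⁺; realise⁻) renaming (instanceOf to letterAt) public

  canonical⁺ : ∀ r → Sat (Tree K) [] r → letterAt nothing , 0 ⊨ᵉ r
  canonical⁺ r p = realise⁺ nothing r (Sat-map embᴹ r p)

  canonical⁻ : ∀ r → letterAt nothing , 0 ⊨ᵉ r → Sat (Tree K) [] r
  canonical⁻ r p = Sat-map projᴹ r (realise⁻ nothing r p)

  length-facts : length facts ≤ length supp * (suc (length supp) * suc (length supp))
  length-facts = go supp
    where
    open ≤-Reasoning
    n = suc (length supp)
    ∣labels∣ : length labels ≡ n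
    ∣labels∣ = cong suc (length-map just supp)
    one : ∀ ρ k → length (facts-of ρ k) ≤ n * n
    one []      k       = z≤n
    one (i ∷ p) nil     = z≤n
    one (i ∷ p) (atm A) = begin
      length (atom-facts A p (i ∷ p)) ≤⟨ length-map-filter _ (λ m → ¬? (m ≟ˡ just (i ∷ p))) labels ⟩
      length labels                   ≡⟨ ∣labels∣ ⟩
      n                               ≤⟨ m≤m*n n n ⟩
      n * n                           ∎
    one (i ∷ p) (edg S) = begin
      length (edge-facts S p (i ∷ p))          ≤⟨ length-map-filter _ (λ (m , m′) → allowed? m (i ∷ p) m′)
                                                    (cartesianProduct labels labels) ⟩
      length (cartesianProduct labels labels)  ≡⟨ length-cartesianProduct labels labels ⟩
      length labels * length labels            ≡⟨ cong₂ _*_ ∣labels∣ ∣labels∣ ⟩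
      n * n                                    ∎
    go : ∀ ρs → length (concatMap (λ ρ → facts-of ρ (K ρ)) ρs) ≤ length ρs * (n * n)
    go []       = z≤n
    go (ρ ∷ ρs) = begin
      length (facts-of ρ (K ρ) ++ _)  ≡⟨ length-++ (facts-of ρ (K ρ)) ⟩
      length (facts-of ρ (K ρ)) + _   ≤⟨ +-mono-≤ (one ρ (K ρ)) (go ρs) ⟩
      n * n + length ρs * (n * n)     ∎

-- Deleting conjuncts

infix 4 _≼_ _≼?_

-- π ≼ ρ iff ρ is the conjunct π or lies below it.

data _≼_ (π : Path) : Path → Set where
  here : π ≼ π
  down : ∀ {i ρ} → π ≼ ρ → π ≼ i ∷ ρ

_≼?_ : ∀ π ρ → Dec (π ≼ ρ)
π ≼? ρ with π ≟ᵖ ρ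
π ≼? ρ       | yes refl = yes here
π ≼? []      | no n     = no λ { here → n refl }
π ≼? (i ∷ ρ) | no n     = map′ down (λ { here → contradiction refl n ; (down l) → l }) (π ≼? ρ)

≼-length : ∀ {π ρ} → π ≼ ρ → ρ ≡ π ⊎ length π < length ρ
≼-length here     = inj₁ refl
≼-length (down l) with ≼-length l
... | inj₁ refl = inj₂ ≤-refl
... | inj₂ less   = inj₂ (m<n⇒m<1+n less)

≼⇒≤ : ∀ {π ρ} → π ≼ ρ → length π ≤ length ρ
≼⇒≤ here     = ≤-refl
≼⇒≤ (down l) = m≤n⇒m≤1+n (≼⇒≤ l)

≼-siblings : ∀ {i j p} → i ∷ p ≼ j ∷ p → j ≡ i
≼-siblings l with ≼-length l
... | inj₁ refl = refl
... | inj₂ less   = contradiction less (<-irrefl refl)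

delete : (Path → Kind) → Path → Path → Kind
delete K π ρ with π ≼? ρ
... | yes _ = nil
... | no _  = K ρ

delete-⋠ : ∀ K π {ρ} → ¬ (π ≼ ρ) → delete K π ρ ≡ K ρ
delete-⋠ K π {ρ} n with π ≼? ρ
... | yes l = contradiction l n
... | no _  = refl

delete-≢nil : ∀ K π {ρ} → delete K π ρ ≢ nil → ¬ (π ≼ ρ) × K ρ ≢ nil
delete-≢nil K π {ρ} n with π ≼? ρ
... | yes _ = contradiction refl n
... | no ⋠  = ⋠ , n

delete-weaken : ∀ {K π G x} → Hom K G x → Hom (delete K π) G x
delete-weaken {K} {π} h = record
  { hom  = hom h
  ; root = root h
  ; atmᴴ = λ k → atmᴴ h (kept k λ ())
  ; edgᴴ = λ k → edgᴴ h (kept k λ ())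
  }
  where
  kept : ∀ {ρ k} → delete K π ρ ≡ k → k ≢ nil → K ρ ≡ k
  kept {ρ} e n with π ≼? ρ
  ... | yes _ = contradiction (sym e) n
  ... | no _  = e

Connected : (Path → Kind) → Set
Connected K = ∀ {j i p} → K (j ∷ i ∷ p) ≢ nil → ∃[ S ] K (i ∷ p) ≡ edg S

edg≢nil : ∀ {k S} → k ≡ edg S → k ≢ nil
edg≢nil refl ()

atm≢nil : ∀ {k A} → k ≡ atm A → k ≢ nil
atm≢nil refl ()

maximum : List ℕ → ℕ
maximum = foldr _⊔_ 0

∈⇒≤maximum : ∀ {n ns} → n ∈ ns → n ≤ maximum ns
∈⇒≤maximum {ns = n ∷ ns} (here refl) = m≤m⊔n n _
∈⇒≤maximum {ns = n ∷ ns} (there m)   = ≤-trans (∈⇒≤maximum m) (m≤n⊔m n _)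

neighbour-⋠ : ∀ {K i y S w} → R (Tree K) S y w → w ≢ i ∷ y → ¬ (i ∷ y ≼ w)
neighbour-⋠ {y = y} (inj₁ (_ , refl , _)) n l = n (cong (_∷ y) (≼-siblings l))
neighbour-⋠ (inj₂ (_ , refl , _)) n l = contradiction (≤-trans (n≤1+n _) (≼⇒≤ l)) 1+n≰n

neighbour-≢ : ∀ {K y S w} → R (Tree K) S y w → w ≢ y
neighbour-≢ (inj₁ (_ , refl , _)) e = contradiction (cong length (sym e)) (<⇒≢ ≤-refl)
neighbour-≢ (inj₂ (_ , refl , _)) e = contradiction (cong length e) (<⇒≢ ≤-refl)

-- If the branch at z maps to another S-neighbour w of the parent of z, then
-- mapping it there (φ) and all else identically is an endomorphism. It moves the part
-- of the branch that lands in the branch again at least two levels up, so that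
-- some iterate of φ avoids the branch, which is therefore redundant.

module Fold (K : Path → Kind) (supp : List Path) (cover : ∀ {ρ} → K ρ ≢ nil → ρ ∈ supp) (conn : Connected K)
            {i₀ y S₀ w} (kz : K (i₀ ∷ y) ≡ edg S₀)
            (yw : R (Tree K) S₀ y w) (w≢z : w ≢ i₀ ∷ y) (τ : Path → Path) (τz : τ (i₀ ∷ y) ≡ w)
            (τ-atm : ∀ {j v A} → i₀ ∷ y ≼ v → K (j ∷ v) ≡ atm A → U (Tree K) A (τ v))
            (τ-edg : ∀ {j v S} → i₀ ∷ y ≼ v → K (j ∷ v) ≡ edg S → R (Tree K) S (τ v) (τ (j ∷ v))) where

  private
    z : Path
    z = i₀ ∷ y

  φ : Path → Path
  φ v with z ≼? v
  ... | yes _ = τ v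
  ... | no _  = v

  φ-in : ∀ {v} → z ≼ v → φ v ≡ τ v
  φ-in {v} l with z ≼? v
  ... | yes _ = refl
  ... | no n  = contradiction l n

  φ-out : ∀ {v} → ¬ (z ≼ v) → φ v ≡ v
  φ-out {v} n with z ≼? v
  ... | yes l = contradiction l n
  ... | no _  = refl

  φᴴ : Hom K (Tree K) []
  φᴴ = record { hom = φ ; root = φ-out (λ ()) ; atmᴴ = φ-atm ; edgᴴ = φ-edg }
    where
    φ-atm : ∀ {j v A} → K (j ∷ v) ≡ atm A → U (Tree K) A (φ v)
    φ-atm {v = v} k with z ≼? v
    ... | yes l = τ-atm l k
    ... | no _  = _ , k
    φ-edg : ∀ {j v S} → K (j ∷ v) ≡ edg S → R (Tree K) S (φ v) (φ (j ∷ v))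
    φ-edg {j} {v} {S} k with z ≼? v
    ... | yes l = subst (R (Tree K) S (τ v)) (sym (φ-in (down l))) (τ-edg l k)
    ... | no n with z ≼? (j ∷ v)
    ...   | no _     = inj₁ (_ , refl , k)
    ...   | yes here with trans (sym k) kz
    ...     | refl   = subst (R (Tree K) S y) (sym τz) yw
    φ-edg k | no n | yes (down l) = contradiction l n

  w-out : ¬ (z ≼ w)
  w-out = neighbour-⋠ yw w≢z

  w≢y : w ≢ y
  w≢y = neighbour-≢ yw

  Higher : Path → Path → Set
  Higher v u = ¬ (z ≼ u) ⊎ (z ≼ u × (∃[ S ] K u ≡ edg S) × 2 + length u ≤ length v)

  parent-edge : ∀ {j u} → z ≼ u → K (j ∷ u) ≢ nil → ∃[ S ] K u ≡ edg S
  parent-edge {u = _ ∷ _} l k = conn k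

  z-length : ∀ {u} → z ≼ u → u ≢ z → suc (length z) ≤ length u
  z-length l n with ≼-length l
  ... | inj₁ e  = contradiction e n
  ... | inj₂ less = less

  -- Induction along the branch: `φ` preserves adjacency, so the image of a child lies at most one
  -- level below the image of its parent.
  φ-higher : ∀ {v S} → z ≼ v → K v ≡ edg S → Higher v (φ v)
  φ-higher here k = inj₁ (w-out ∘ subst (z ≼_) (trans (φ-in here) τz))
  φ-higher {j ∷ u} {S} (down l) k with parent-edge l (edg≢nil k)
  ... | _ , ku with φ-higher l ku | z ≼? φ (j ∷ u) | edgᴴ φᴴ k
  ... | _ | no n | _ = inj₁ n
  ... | inj₁ n | yes m | inj₂ (_ , e , _) = contradiction (subst (z ≼_) (sym e) (down m)) n
  -- The only edge into the branch leads from `y` to `z`, so these are the images of `u` and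
  -- `j ∷ u`. As `z` itself goes to `w`, which differs from `y`, the variable `u` lies strictly
  -- below `z`.
  ... | inj₁ n | yes m | inj₁ (_ , e , k′) = inj₂ (m , (_ , k′) ,
        subst (λ u′ → 2 + length u′ ≤ suc (length u)) (sym φv≡z) (s≤s (z-length l u≢z)))
    where
    at-z : ∀ {a b} → b ≡ a → z ≼ b → ∀ {i c} → a ≡ i ∷ c → ¬ (z ≼ c) → a ≡ z × c ≡ y
    at-z refl here     refl n = refl , refl
    at-z refl (down l) refl n = contradiction l n
    φv≡z = proj₁ (at-z refl m e n)
    φu≡y = proj₂ (at-z refl m e n)
    u≢z : u ≢ z
    u≢z refl = w≢y (trans (sym (trans (φ-in here) τz)) φu≡y)
  ... | inj₂ (m′ , _ , leq) | yes m | inj₁ (_ , e , k′) =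
        inj₂ (m , (_ , k′) , subst (λ u′ → 2 + length u′ ≤ suc (length u)) (sym e) (s≤s leq))
  ... | inj₂ (m′ , (_ , k″) , leq) | yes m | inj₂ (_ , e , _) =
        inj₂ (m , parent-edge m (edg≢nil (trans (sym (cong K e)) k″)) ,
              ≤-trans (s≤s (s≤s (≤-trans (n≤1+n _) (≤-reflexive (sym (cong length e)))))) (m≤n⇒m≤1+n leq))

  iterateᴹ : ℕ → Morphism (Tree K) (Tree K)
  iterateᴹ zero    = idᴹ
  iterateᴹ (suc n) = iterateᴹ n ∘ᴹ morphism φᴴ

  iterate-out : ∀ n {v} → ¬ (z ≼ v) → fun (iterateᴹ n) v ≡ v
  iterate-out zero    n = refl
  iterate-out (suc m) n = trans (cong (fun (iterateᴹ m)) (φ-out n)) (iterate-out m n)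

  -- Each application of `φ` either leaves the branch, after which the point stays fixed, or
  -- shortens the path; `n` bounds the length that is left.
  escapes : ∀ n {v S} → K v ≡ edg S → length v ≤ n → ¬ (z ≼ fun (iterateᴹ n) v)
  escapes n {v} k leq with z ≼? v
  ... | no o = o ∘ subst (z ≼_) (iterate-out n o)
  escapes zero    {[]}    k leq | yes ()
  escapes (suc n) {v} k leq | yes l with φ-higher l k
  ... | inj₁ o = o ∘ subst (z ≼_) (iterate-out n o)
  ... | inj₂ (_ , (_ , k′) , leq′) = escapes n k′ (≤-trans (n≤1+n _) (s≤s⁻¹ (≤-trans leq′ leq)))

  height : ℕ
  height = maximum (map length supp)

  escape : ∀ {j v} → K (j ∷ v) ≢ nil → ¬ (z ≼ fun (iterateᴹ height) v)
  escape {j} {v} k with z ≼? v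
  ... | no o  = o ∘ subst (z ≼_) (iterate-out height o)
  ... | yes l = escapes height (proj₂ (parent-edge l k))
                  (≤-trans (n≤1+n _) (∈⇒≤maximum (∈-map⁺ length (cover k))))

  escape-edg : ∀ {v S} → K v ≡ edg S → ¬ (z ≼ fun (iterateᴹ height) v)
  escape-edg {v} k with z ≼? v
  ... | no o  = o ∘ subst (z ≼_) (iterate-out height o)
  ... | yes l = escapes height k (∈⇒≤maximum (∈-map⁺ length (cover (edg≢nil k))))

  redundant : Hom K (Tree (delete K z)) []
  redundant = record
    { hom  = ψ
    ; root = iterate-out height λ ()
    ; atmᴴ = λ k → let j , k′ = U-map (iterateᴹ height) (_ , k) in j , keep-atm (escape (atm≢nil k)) k′
    ; edgᴴ = λ k → keep-edg (escape (edg≢nil k)) (escape-edg k) (R-map (iterateᴹ height) (inj₁ (_ , refl , k)))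
    }
    where
    ψ = fun (iterateᴹ height)
    keep-atm : ∀ {j v A} → ¬ (z ≼ v) → K (j ∷ v) ≡ atm A → delete K z (j ∷ v) ≡ atm A
    keep-atm o k = trans (delete-⋠ K z λ { here → case trans (sym k) kz of λ () ; (down l) → o l }) k
    keep-edg : ∀ {S u v} → ¬ (z ≼ u) → ¬ (z ≼ v) → R (Tree K) S u v → R (Tree (delete K z)) S u v
    keep-edg o o′ (inj₁ (j , e , k)) = inj₁ (j , e , trans (delete-⋠ K z o′) k)
    keep-edg o o′ (inj₂ (j , e , k)) = inj₂ (j , e , trans (delete-⋠ K z o) k)

-- Irredundant patterns

Irredundant : (Path → Kind) → List Path → Set
Irredundant K supp = ∀ {π} → π ∈ supp → ¬ Hom K (Tree (delete K π)) []

record Pattern (r : ELI) : Set₁ where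
  field
    kind     : Path → Kind
    supp     : List Path
    cover    : ∀ {ρ} → kind ρ ≢ nil → ρ ∈ supp
    conn     : Connected kind
    sound    : ∀ {G x} → Sat G x r → Hom kind G x
    complete : ∀ {G x} → Hom kind G x → Sat G x r

initial : ∀ r → Pattern r
initial r = record
  { kind     = pattern-of r
  ; supp     = support-from r [] 0
  ; cover    = cov
  ; conn     = λ {j} {i} {p} k → edge (nth (conjuncts (below r p)) i) k
  ; sound    = Sat⇒Hom r _
  ; complete = Hom⇒Sat r
  }
  where
  cov : ∀ {ρ} → pattern-of r ρ ≢ nil → ρ ∈ support-from r [] 0
  cov {[]}    n = contradiction refl n
  cov {i ∷ π} n = below-support r π (conjunct∈support (below r π) π 0 i n)
  edge : ∀ e {j} → kindᵉ (nth (conjuncts (body e)) j) ≢ nil → ∃[ S ] kindᵉ e ≡ edg S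
  edge ⊤ᵉ       n = contradiction refl n
  edge (atom A) n = contradiction refl n
  edge (_ ∧ᵉ _) n = contradiction refl n
  edge (∃ᵉ S r) n = S , refl

open Pattern

module _ {r : ELI} where

  remove : (P : Pattern r) (π : Path) → Hom (kind P) (Tree (delete (kind P) π)) [] → Pattern r
  remove P π h = record
    { kind     = delete (kind P) π
    ; supp     = filter (λ ρ → ¬? (π ≼? ρ)) (supp P)
    ; cover    = λ n → let ⋠ , k = delete-≢nil (kind P) π n in ∈-filter⁺ (λ ρ → ¬? (π ≼? ρ)) (cover P k) ⋠
    ; conn     = λ n → let ⋠ , k = delete-≢nil (kind P) π n ; S , e = conn P k in S , trans (delete-⋠ (kind P) π (⋠ ∘ down)) e
    ; sound    = λ p → delete-weaken {π = π} (sound P p)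
    ; complete = λ h′ → complete P (subst (Hom _ _) (root h′) (Hom-map (morphism h′) h))
    }

  -- Such a homomorphism exists iff `r` is true at the root of the smaller tree, and this is
  -- evaluated in the finite instance of that tree.
  deletable? : (P : Pattern r) (π : Path) → Dec (Hom (kind P) (Tree (delete (kind P) π)) [])
  deletable? P π = map′ (sound P ∘ canonical⁻ r) (canonical⁺ r ∘ complete P) (letterAt nothing , 0 ⊨ᵉ? r)
    where open Frontier (delete (kind P) π) (supp P) (cover P ∘ proj₂ ∘ delete-≢nil (kind P) π)

  reduce-from : ∀ n (P : Pattern r) → length (supp P) ≤ n →
                Σ (Pattern r) λ Q → Irredundant (kind Q) (supp Q) × length (supp Q) ≤ length (supp P)
  reduce-from n P leq with Any.any? (deletable? P) (supp P)
  ... | no none = P , (λ π∈ h → none (lose π∈ h)) , ≤-refl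
  ... | yes some with find some
  reduce-from zero P leq | yes some | π , π∈ , h with supp P
  reduce-from zero P () | yes some | π , here _ , h | _ ∷ _
  reduce-from zero P () | yes some | π , there _ , h | _ ∷ _
  reduce-from (suc n) P leq | yes some | π , π∈ , h =
    let less = filter-notAll (λ ρ → ¬? (π ≼? ρ)) (supp P) (lose π∈ λ n → n here)
        Q , irr , leq′ = reduce-from n (remove P π h) (s≤s⁻¹ (≤-trans less leq))
    in Q , irr , ≤-trans leq′ (<⇒≤ less)

-- Frontiers of ELI-queries

⊨ᵉ⇒⊨ᴱ : ∀ {r s} → (∀ {𝒜 a} → 𝒜 , a ⊨ᵉ r → 𝒜 , a ⊨ᵉ s) → r ⊨ᴱ s
⊨ᵉ⇒⊨ᴱ f 𝒟 a ℓ = f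

⊨ᴱ⇒⊨ᵉ : ∀ {r s} → r ⊨ᴱ s → ∀ {𝒜 a} → 𝒜 , a ⊨ᵉ r → 𝒜 , a ⊨ᵉ s
⊨ᴱ⇒⊨ᵉ f {𝒜} {a} = f (𝒜 ∷ []) a 0

⋀ : List ELI → ELI
⋀ = foldr _∧ᵉ_ ⊤ᵉ

⋀-sat⁺ : ∀ {G x rs} → (∀ {r} → r ∈ rs → Sat G x r) → Sat G x (⋀ rs)
⋀-sat⁺ {rs = []}     f = tt
⋀-sat⁺ {rs = r ∷ rs} f = f (here refl) , ⋀-sat⁺ (f ∘ there)

⋀-sat⁻ : ∀ {G x rs r} → Sat G x (⋀ rs) → r ∈ rs → Sat G x r
⋀-sat⁻ (p , q) (here refl) = p
⋀-sat⁻ (p , q) (there m)   = ⋀-sat⁻ q m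

Child : Path → Path → Set
Child z ρ = ∃[ i ] ρ ≡ i ∷ z

child? : ∀ z ρ → Dec (Child z ρ)
child? z []      = no λ ()
child? z (i ∷ p) = map′ (λ { refl → i , refl }) (λ { (_ , refl) → refl }) (p ≟ᵖ z)

module Canonical {r : ELI} (P : Pattern r) (irr : Irredundant (kind P) (supp P)) where

  private
    K = kind P

  open Frontier K (supp P) (cover P) public

  items : Path → List Path
  items z = filter (child? z) (supp P)

  item∈ : ∀ {i z} → (i ∷ z) ∈ supp P → (i ∷ z) ∈ items z
  item∈ {z = z} m = ∈-filter⁺ (child? z) m (_ , refl)

  item∈⁻ : ∀ {ρ} z → ρ ∈ items z → ρ ∈ supp P × ∃[ i ] ρ ≡ i ∷ z
  item∈⁻ z = ∈-filter⁻ (child? z) {xs = supp P}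

  height : ℕ
  height = suc (maximum (map length (supp P)))

  supp-height : ∀ {ρ} → ρ ∈ supp P → length ρ < height
  supp-height m = s≤s (∈⇒≤maximum (∈-map⁺ length m))

  ancestor : ∀ {i p ρ} → i ∷ p ≼ ρ → K ρ ≢ nil → ρ ≡ i ∷ p ⊎ ∃[ S ] K (i ∷ p) ≡ edg S
  ancestor here     k = inj₁ refl
  ancestor (down l) k with l
  ... | here    = inj₂ (conn P k)
  ... | down l′ = case ancestor l (edg≢nil (proj₂ (conn P k))) of λ
    { (inj₁ e)  → inj₂ (subst (λ ρ → ∃[ S ] K ρ ≡ edg S) e (conn P k))
    ; (inj₂ k′) → inj₂ k′ }

  -- Nothing that occurs in the pattern lies at or below a `nil` conjunct, so that its deletion
  -- would be without effect.
  item-≢nil : ∀ {i p} → (i ∷ p) ∈ supp P → K (i ∷ p) ≢ nil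
  item-≢nil {i} {p} m k = irr m record
    { hom = id ; root = refl
    ; atmᴴ = λ k′ → _ , trans (keep (atm≢nil k′)) k′
    ; edgᴴ = λ k′ → inj₁ (_ , refl , trans (keep (edg≢nil k′)) k′) }
    where
    keep : ∀ {ρ} → K ρ ≢ nil → delete K (i ∷ p) ρ ≡ K ρ
    keep n = delete-⋠ K (i ∷ p) λ l → case ancestor l n of λ
      { (inj₁ refl)     → n k
      ; (inj₂ (_ , k′)) → case trans (sym k) k′ of λ () }

  no-duplicate : ∀ {i j p A} → (i ∷ p) ∈ supp P → K (i ∷ p) ≡ atm A → K (j ∷ p) ≡ atm A → j ≢ i → ⊥
  no-duplicate {i} {j} {p} m k k′ n = irr m record
    { hom = id ; root = refl ; atmᴴ = keep-atm
    ; edgᴴ = λ k″ → inj₁ (_ , refl , trans (keep (edg≢nil k″) λ { refl → case trans (sym k) k″ of λ () }) k″) }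
    where
    keep : ∀ {ρ} → K ρ ≢ nil → ρ ≢ i ∷ p → delete K (i ∷ p) ρ ≡ K ρ
    keep n n′ = delete-⋠ K (i ∷ p) λ l → case ancestor l n of λ
      { (inj₁ e)        → n′ e
      ; (inj₂ (_ , k″)) → case trans (sym k) k″ of λ () }
    keep-atm : ∀ {l q A} → K (l ∷ q) ≡ atm A → ∃[ l′ ] delete K (i ∷ p) (l′ ∷ q) ≡ atm A
    keep-atm {l} {q} k″ with (l ∷ q) ≟ᵖ (i ∷ p)
    ... | no n′    = l , trans (keep (atm≢nil k″) n′) k″
    ... | yes refl with trans (sym k) k″
    ...   | refl = j , trans (keep (atm≢nil k′) λ { refl → n refl }) k′

  label-∈ : ∀ {ρ} → just ρ ∈ labels → ρ ∈ supp P
  label-∈ (there m) with ∈-map⁻ just m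
  ... | _ , m′ , refl = m′

  -- The defect is passed down the tree. The missing conjunct is not an atom, since another copy of
  -- that atom would be a duplicate. If it is an edge, its variable either goes to another
  -- neighbour, a fold that contradicts irredundancy, or to a copy of itself, which by `Allowed`
  -- lacks a conjunct in turn. The finite depth ends the descent.
  walk : ∀ n {i y x} (H : Hom K F x) → hom H y ≡ (y , just (i ∷ y)) → (i ∷ y) ∈ supp P →
         height ≤ n + length y → ⊥
  walk zero H e m leq = contradiction (≤-trans (supp-height m) leq) (<⇒≱ (≤-trans ≤-refl (n≤1+n _)))
  walk (suc n) {i} {y} H e m leq with K (i ∷ y) in k
  ... | nil   = item-≢nil m k
  ... | atm A with atom-fact⁻ (subst (λ x → un A x ∈ facts) e (atmᴴ H k))
  ...   | j , k′ , n≢ = no-duplicate m k k′ λ { refl → n≢ refl }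
  walk (suc n) {i} {y} H e m leq | edg S
    with proj₁ (hom H (i ∷ y)) ≟ᵖ (i ∷ y) | subst (λ x → R F S x (hom H (i ∷ y))) e (edgᴴ H k)
  ... | no w≢z | edge = irr m (Fold.redundant K (supp P) (cover P) (conn P) k
          (R-map projᴹ edge) w≢z (proj₁ ∘ hom H) refl
          (λ _ k′ → U-map projᴹ (atmᴴ H k′)) (λ _ k′ → R-map projᴹ (edgᴴ H k′)))
  ... | yes w≡z | inj₂ e′ with edge-fact⁻ e′
  ...   | _ , y≡ , _ = contradiction (cong length (trans y≡ (cong (_ ∷_) w≡z))) (<⇒≢ (n≤1+n _))
  walk (suc n) {i} {y} H e m leq | edg S | yes w≡z | inj₁ e′ with edge-fact⁻ e′
  ...   | _ , _ , _ , m′∈ , a with a (cong just (sym w≡z))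
  ...     | j , eq = walk n {j} {i ∷ y} H
              (cong₂ _,_ w≡z (trans eq (cong (λ z → just (j ∷ z)) w≡z)))
              (label-∈ (subst (_∈ labels) (trans eq (cong (λ z → just (j ∷ z)) w≡z)) m′∈))
              (≤-trans leq (≤-reflexive (sym (+-suc n (length y)))))

  frontier-unsat : ∀ {ρ} → ρ ∈ items [] → ¬ (letterAt (just ρ) , 0 ⊨ᵉ r)
  frontier-unsat {ρ} m p with item∈⁻ [] m
  ... | m′ , i , refl =
    let h = sound P (realise⁻ (just ρ) r p) in
    walk height h (root h) m′ (m≤m+n height 0)

  -- branch m z and item m ρ describe the tree below z and the conjunct ρ up to
  -- depth m.

  branch : ℕ → Path → ELI
  item   : ℕ → Path → ELI
  itemᵏ  : Kind → ℕ → Path → ELI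
  branch zero    z = ⊤ᵉ
  branch (suc m) z = ⋀ (map (item m) (items z))
  item m ρ = itemᵏ (K ρ) m ρ
  itemᵏ nil     m ρ = ⊤ᵉ
  itemᵏ (atm A) m ρ = atom A
  itemᵏ (edg S) m ρ = ∃ᵉ S (branch m ρ)

  item-edg : ∀ {m ρ S} → K ρ ≡ edg S → item m ρ ≡ ∃ᵉ S (branch m ρ)
  item-edg {m} {ρ} k = cong (λ k → itemᵏ k m ρ) k

  item-atm : ∀ {m ρ A} → K ρ ≡ atm A → item m ρ ≡ atom A
  item-atm {m} {ρ} k = cong (λ k → itemᵏ k m ρ) k

  module _ {G : Structure} (f : Path → X G) where

    -- `f` has to be a homomorphism only at and below the conjunct; hence the identity qualifies
    -- even if another conjunct of the tree has been deleted.
    item-sat : ∀ m {i p} →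
               (∀ {j q A} → i ∷ p ≼ j ∷ q → K (j ∷ q) ≡ atm A → U G A (f q)) →
               (∀ {j q S} → i ∷ p ≼ j ∷ q → K (j ∷ q) ≡ edg S → R G S (f q) (f (j ∷ q))) →
               Sat G (f p) (item m (i ∷ p))
    branch-sat : ∀ m {i p} →
               (∀ {j q A} → i ∷ p ≼ j ∷ q → K (j ∷ q) ≡ atm A → U G A (f q)) →
               (∀ {j q S} → i ∷ p ≼ j ∷ q → K (j ∷ q) ≡ edg S → R G S (f q) (f (j ∷ q))) →
               Sat G (f (i ∷ p)) (branch m (i ∷ p))
    item-sat m {i} {p} fa fe with K (i ∷ p) in k
    ... | nil   = tt
    ... | atm A = fa here k
    ... | edg S = f (i ∷ p) , fe here k , branch-sat m fa fe
    branch-sat zero    fa fe = tt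
    branch-sat (suc m) {i} {p} fa fe = ⋀-sat⁺ λ s∈ → case ∈-map⁻ (item m) s∈ of λ
      { (ρ , ρ∈ , refl) → case item∈⁻ (i ∷ p) ρ∈ of λ
        { (_ , j , refl) → item-sat m (fa ∘ below-trans) (fe ∘ below-trans) } }
      where
      below-trans : ∀ {j π ρ} → j ∷ π ≼ ρ → π ≼ ρ
      below-trans here     = down here
      below-trans (down l) = down (below-trans l)

  -- All paths of the support are shorter than `height`, so `branch (depth p) p` describes the whole
  -- tree below `p`.
  depth : Path → ℕ
  depth p = height ∸ length p

  module _ (𝒜 : DataInstance) where

    -- Witnesses are found by evaluation; the default makes the assignment total on paths, including
    -- those that no variable uses.
    choose : ∀ S s a → Dec (𝒜 , a ⊨ᵉ ∃ᵉ S s) → Individual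
    choose S s a (yes (b , _)) = b
    choose S s a (no _)        = a

    branch⇒Hom : ∀ {a} → Sat ⟪ 𝒜 ⟫ a (branch (depth []) []) → Hom K ⟪ 𝒜 ⟫ a
    branch⇒Hom {a} sat = record { hom = h ; root = refl ; atmᴴ = h-atm ; edgᴴ = h-edg }
      where
      h  : Path → Individual
      hᵏ : Kind → ℕ → Path → Individual
      h []      = a
      h (i ∷ p) = hᵏ (K (i ∷ p)) i p
      hᵏ (edg S) i p = choose S (branch (depth (i ∷ p)) (i ∷ p)) (h p)
                         (𝒜 , h p ⊨ᵉ? ∃ᵉ S (branch (depth (i ∷ p)) (i ∷ p)))
      hᵏ _       i p = h p

      Reached : Path → Set
      Reached p = p ≡ [] ⊎ ∃[ S ] K p ≡ edg S

      reached-parent : ∀ {i} p → K (i ∷ p) ≢ nil → Reached p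
      reached-parent []      k = inj₁ refl
      reached-parent (j ∷ p) k = inj₂ (conn P k)

      chosen : ∀ {S a} s d → Sat ⟪ 𝒜 ⟫ a (∃ᵉ S s) →
               Sat ⟪ 𝒜 ⟫ (choose S s a d) s × role S a (choose S s a d) ∈ 𝒜
      chosen s (yes (b , _ , e , p)) _ = ⊨ᵉ⇒Sat s p , e
      chosen s (no n) p = contradiction (Sat⇒⊨ᵉ (∃ᵉ _ _) p) n

      h-branch : ∀ p → Reached p → Sat ⟪ 𝒜 ⟫ (h p) (branch (depth p) p)
      h-item : ∀ {i} p → K (i ∷ p) ≢ nil → Sat ⟪ 𝒜 ⟫ (h p) (item (depth (i ∷ p)) (i ∷ p))
      h-item {i} p k = go (depth p) refl (h-branch p (reached-parent p k))
        where
        go : ∀ m → depth p ≡ m → Sat ⟪ 𝒜 ⟫ (h p) (branch m p) → Sat ⟪ 𝒜 ⟫ (h p) (item (depth (i ∷ p)) (i ∷ p))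
        go zero    e _ = contradiction (m∸n≡0⇒m≤n e) (<⇒≱ (≤-trans (n≤1+n _) (supp-height (cover P k))))
        go (suc m) e s = subst (λ m → Sat ⟪ 𝒜 ⟫ (h p) (item m (i ∷ p)))
          (trans (sym (cong pred e)) (pred[m∸n]≡m∸[1+n] height (length p)))
          (⋀-sat⁻ s (∈-map⁺ (item m) (item∈ (cover P k))))
      h-branch []      _                = sat
      h-branch (i ∷ p) (inj₂ (S , k)) =
        subst (λ k → Sat ⟪ 𝒜 ⟫ (hᵏ k i p) (branch (depth (i ∷ p)) (i ∷ p))) (sym k)
          (proj₁ (chosen (branch (depth (i ∷ p)) (i ∷ p)) (𝒜 , h p ⊨ᵉ? ∃ᵉ S (branch (depth (i ∷ p)) (i ∷ p))) (subst (Sat ⟪ 𝒜 ⟫ (h p)) (item-edg k) (h-item p (edg≢nil k)))))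
      h-atm : ∀ {i p A} → K (i ∷ p) ≡ atm A → unary A (h p) ∈ 𝒜
      h-atm {p = p} k = subst (Sat ⟪ 𝒜 ⟫ (h p)) (item-atm k) (h-item p (atm≢nil k))
      h-edg : ∀ {i p S} → K (i ∷ p) ≡ edg S → role S (h p) (h (i ∷ p)) ∈ 𝒜
      h-edg {i} {p} {S} k = subst (λ k → role S (h p) (hᵏ k i p) ∈ 𝒜) (sym k)
        (proj₂ (chosen (branch (depth (i ∷ p)) (i ∷ p)) (𝒜 , h p ⊨ᵉ? ∃ᵉ S (branch (depth (i ∷ p)) (i ∷ p))) (subst (Sat ⟪ 𝒜 ⟫ (h p)) (item-edg k) (h-item p (edg≢nil k)))))

    module _ (φ : Morphism ⟪ 𝒜 ⟫ (Tree K)) where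

      Lacks : Individual → Path → Set
      Lacks u ρ = ¬ (𝒜 , u ⊨ᵉ item (depth ρ) ρ)

      lacking : ∀ u → Dec (Any (Lacks u) (items (fun φ u)))
      lacking u = Any.any? (λ ρ → ¬? (𝒜 , u ⊨ᵉ? item (depth ρ) ρ)) (items (fun φ u))

      -- This lifts `φ` from the tree to its frontier: an element goes to a copy deprived of a
      -- conjunct that the element indeed lacks.
      label : Individual → Label
      label u with lacking u
      ... | yes some = just (proj₁ (find some))
      ... | no _     = nothing

      label-just : ∀ {u ρ} → label u ≡ just ρ → ρ ∈ items (fun φ u) × Lacks u ρ
      label-just {u} e with lacking u
      label-just refl | yes some = proj₂ (find some)

      label-nothing : ∀ {u ρ} → label u ≡ nothing → ρ ∈ items (fun φ u) → Sat ⟪ 𝒜 ⟫ u (item (depth ρ) ρ)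
      label-nothing {u} {ρ} e m with lacking u
      ... | no none with 𝒜 , u ⊨ᵉ? item (depth ρ) ρ
      ...   | yes p = ⊨ᵉ⇒Sat (item (depth ρ) ρ) p
      ...   | no n  = contradiction (lose m n) none

      full-branch : ∀ {u} → label u ≡ nothing → Sat ⟪ 𝒜 ⟫ u (branch (depth (fun φ u)) (fun φ u))
      full-branch {u} e = go (depth (fun φ u)) refl
        where
        go : ∀ m → depth (fun φ u) ≡ m → Sat ⟪ 𝒜 ⟫ u (branch m (fun φ u))
        go zero    _  = tt
        go (suc m) e′ = ⋀-sat⁺ λ s∈ → case ∈-map⁻ (item m) s∈ of λ
          { (ρ , ρ∈ , refl) → subst (λ m → Sat ⟪ 𝒜 ⟫ u (item m ρ))
              (trans (cong depth (proj₂ (proj₂ (item∈⁻ (fun φ u) ρ∈))))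
                (trans (sym (pred[m∸n]≡m∸[1+n] height (length (fun φ u)))) (cong pred e′)))
              (label-nothing e ρ∈) }

      label-∈labels : ∀ u → label u ∈ labels
      label-∈labels u with lacking u
      ... | yes some = there (∈-map⁺ just (proj₁ (item∈⁻ (fun φ u) (proj₁ (proj₂ (find some))))))
      ... | no _     = here refl

      -- If `v` lacked nothing, it would satisfy the full branch and so witness at `u` the very
      -- conjunct that `u` lacks.
      label-allowed : ∀ {S u v} → role S u v ∈ 𝒜 → ∀ {i} → fun φ v ≡ i ∷ fun φ u → K (fun φ v) ≡ edg S →
                      Allowed (label u) (fun φ v) (label v)
      label-allowed {S} {u} {v} e eq k lu with label v in lv
      ... | just ρ  = let _ , j , e′ = item∈⁻ (fun φ v) (proj₁ (label-just lv)) in j , cong just e′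
      ... | nothing = contradiction
        (Sat⇒⊨ᵉ (item (depth (fun φ v)) (fun φ v))
          (subst (Sat ⟪ 𝒜 ⟫ u) (sym (item-edg k)) (v , e , full-branch lv)))
        (proj₂ (label-just lu))

      labelᴹ : Morphism ⟪ 𝒜 ⟫ F
      labelᴹ = record
        { fun   = λ u → fun φ u , label u
        ; U-map = λ {A} {u} u∈ → let i , k = U-map φ u∈ in atom-fact⁺ k (label-∈labels u) λ e →
            proj₂ (label-just e) (subst (𝒜 , u ⊨ᵉ_) (sym (item-atm k)) u∈)
        ; R-map = λ {S} {u} {v} e → case R-map φ e of λ
            { (inj₁ (i , eq , k)) → inj₁ (edge {S} e eq k)
            ; (inj₂ (i , eq , k)) → inj₂ (edge {flip S} (R-sym ⟪ 𝒜 ⟫ {S} e) eq k) }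
        }
        where
        edge : ∀ {S u v} → role S u v ∈ 𝒜 → ∀ {i} → fun φ v ≡ i ∷ fun φ u → K (fun φ v) ≡ edg S →
               bi S (fun φ u , label u) (fun φ v , label v) ∈ facts
        edge {S} {u} {v} e {i} eq k = subst (λ p → bi S (fun φ u , label u) (p , label v) ∈ facts) (sym eq)
          (edge-fact⁺ (subst (λ p → K p ≡ edg S) eq k) (label-∈labels u) (label-∈labels v)
            (subst (λ p → Allowed (label u) p (label v)) eq (label-allowed e eq k)))

      root-label : ∀ {a} → fun φ a ≡ [] → ¬ (𝒜 , a ⊨ᵉ r) → ∃[ ρ ] label a ≡ just ρ × ρ ∈ items []
      root-label {a} e n with label a in la
      ... | just ρ  = ρ , refl , subst (λ p → ρ ∈ items p) e (proj₁ (label-just la))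
      ... | nothing = contradiction
        (Sat⇒⊨ᵉ r (complete P (branch⇒Hom (subst (λ p → Sat ⟪ 𝒜 ⟫ a (branch (depth p) p)) e (full-branch la))))) n

abstract
  reduce : ∀ r → Σ (Pattern r) λ P → Irredundant (kind P) (supp P) × length (supp P) ≤ ∣ r ∣ᴱ
  reduce r =
    let P , irr , leq = reduce-from _ (initial r) ≤-refl
    in P , irr , ≤-trans leq (length-support-from r [] 0)

reduced : ∀ r → Pattern r
reduced r = proj₁ (reduce r)

module Reduced (r : ELI) = Canonical {r} (reduced r) (proj₁ (proj₂ (reduce r)))

-- Trees and frontier elements as letters

Letter : Set
Letter = DataInstance

infix 4 _⊩ᴸ_

_⊩ᴸ_ : Letter → ELI → Set
l ⊩ᴸ r = l , 0 ⊨ᵉ r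

tree : ELI → Letter
tree r = Reduced.letterAt r nothing

frontier : ELI → List Letter
frontier r = map (λ ρ → Reduced.letterAt r (just ρ)) (Reduced.items r [])

tree⁺ : ∀ {r s} → r ⊨ᴱ s → tree r ⊩ᴸ s
tree⁺ {r} {s} e = ⊨ᴱ⇒⊨ᵉ {r} {s} e (canonical⁺ r (complete (reduced r) idᴴ))
  where open Reduced r

tree⁻ : ∀ {r s} → tree r ⊩ᴸ s → r ⊨ᴱ s
tree⁻ {r} {s} p = ⊨ᵉ⇒⊨ᴱ {r} {s} λ q →
  let h = sound (reduced r) (⊨ᵉ⇒Sat r q) in
  Sat⇒⊨ᵉ s (subst (λ x → Sat _ x s) (root h) (Sat-map (morphism h) s (canonical⁻ s p)))
  where open Reduced r

⊨ᴱ? : ∀ r s → Dec (r ⊨ᴱ s)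
⊨ᴱ? r s = map′ (tree⁻ {r} {s}) (tree⁺ {r} {s}) (tree r , 0 ⊨ᵉ? s)

⊨ᴱ-refl : ∀ {r} → r ⊨ᴱ r
⊨ᴱ-refl 𝒟 a ℓ p = p

⊨ᴱ-trans : ∀ {r s t} → r ⊨ᴱ s → s ⊨ᴱ t → r ⊨ᴱ t
⊨ᴱ-trans p q 𝒟 a ℓ x = q 𝒟 a ℓ (p 𝒟 a ℓ x)

frontier-sound : ∀ {r l} → l ∈ frontier r → ¬ (l ⊩ᴸ r)
frontier-sound {r} m p with ∈-map⁻ (λ ρ → Reduced.letterAt r (just ρ)) m
... | ρ , ρ∈ , refl = Reduced.frontier-unsat r ρ∈ p

-- The tree of `s` maps to that of `r` because `r` entails `s`, and its root lacks a conjunct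
-- because `s` does not entail `r`. The labelling turns this map into one to a frontier element.
frontier-complete : ∀ {r s} → r ⊨ᴱ s → ¬ (s ⊨ᴱ r) → ∃[ l ] l ∈ frontier r × l ⊩ᴸ s
frontier-complete {r} {s} rs sr =
  let ρ , e , ρ∈ = root-label (tree s) φ (root h) (sr ∘ tree⁻ {s} {r}) in
  Reduced.letterAt r (just ρ) , ∈-map⁺ (λ ρ → Reduced.letterAt r (just ρ)) ρ∈ ,
  realise⁺ (just ρ) s (subst (λ x → Sat F x s) (cong₂ _,_ (root h) e)
    (Sat-map (labelᴹ (tree s) φ) s (⊨ᵉ⇒Sat s (tree⁺ {s} {s} (⊨ᴱ-refl {s})))))
  where
  open Reduced r
  h : Hom (kind (reduced s)) (Tree (kind (reduced r))) []
  h = sound (reduced s) (canonical⁻ s (tree⁺ {r} {s} rs))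
  module S = Reduced s
  φ : Morphism ⟪ tree s ⟫ (Tree (kind (reduced r)))
  φ = morphism h ∘ᴹ (S.projᴹ ∘ᴹ Realise.decᴹ (Product.≡-dec _≟ᵖ_ _≟ˡ_) ([] , nothing) S.facts)

-- One-element frontiers and indecomposable queries

Homogeneous : ELI → Set
Homogeneous r = ∀ {l l′} → l ∈ frontier r → l′ ∈ frontier r → l ≡ l′

Decomposable : ELI → Set
Decomposable r = ∃[ p₁ ] ∃[ p₂ ] r ≣ᴱ p₁ ∧ᵉ p₂ × ¬ (p₁ ⊨ᴱ r) × ¬ (p₂ ⊨ᴱ r)

-- Given two distinct top-level conjuncts of the reduced pattern, `r` is the conjunction of one of
-- them with all others, and irredundancy makes both parts properly weaker.
homogeneous⊎decomposable : ∀ r → Homogeneous r ⊎ Decomposable r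
homogeneous⊎decomposable r = go (items []) (λ m → m) (λ m → m)
  where
  open Reduced r
  P = reduced r
  irr = proj₁ (proj₂ (reduce r))
  K = kind P
  split : ∀ {ρ₁ ρ₂} → ρ₁ ∈ items [] → ρ₂ ∈ items [] → ρ₁ ≢ ρ₂ → Decomposable r
  split {ρ₁} {ρ₂} m₁ m₂ n =
    p₁ , p₂ , (⊨ᵉ⇒⊨ᴱ {r} {p₁ ∧ᵉ p₂} to , ⊨ᵉ⇒⊨ᴱ {p₁ ∧ᵉ p₂} {r} from) ,
    weaker m₂ p₁ (λ f → f m₁ n) , weaker m₁ p₂ (λ f → ⋀-sat⁺ λ s∈ → case ∈-map⁻ it s∈ of λ
      { (ρ , ρ∈ , refl) → let ρ∈′ , n′ = ∈-filter⁻ (λ ρ → ¬? (ρ ≟ᵖ ρ₁)) ρ∈ in f ρ∈′ n′ })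
    where
    -- With this depth the conjunction of all `it ρ` is `branch (depth []) []`, from which
    -- `branch⇒Hom` recovers `r`.
    it : Path → ELI
    it = item (pred height)
    others = filter (λ ρ → ¬? (ρ ≟ᵖ ρ₁)) (items [])
    p₁ = it ρ₁
    p₂ = ⋀ (map it others)
    to : ∀ {𝒜 a} → 𝒜 , a ⊨ᵉ r → 𝒜 , a ⊨ᵉ p₁ ∧ᵉ p₂
    to {𝒜} {a} q = Sat⇒⊨ᵉ (p₁ ∧ᵉ p₂) (all m₁ , ⋀-sat⁺ λ s∈ → case ∈-map⁻ it s∈ of λ
      { (ρ , ρ∈ , refl) → all (proj₁ (∈-filter⁻ (λ ρ → ¬? (ρ ≟ᵖ ρ₁)) {xs = items []} ρ∈)) })
      where
      h = sound P (⊨ᵉ⇒Sat r q)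
      all : ∀ {ρ} → ρ ∈ items [] → Sat ⟪ 𝒜 ⟫ a (it ρ)
      all m with item∈⁻ [] m
      ... | _ , i , refl = subst (λ x → Sat ⟪ 𝒜 ⟫ x (it (i ∷ []))) (root h)
                             (item-sat (hom h) (pred height) (λ _ → atmᴴ h) (λ _ → edgᴴ h))
    from : ∀ {𝒜 a} → 𝒜 , a ⊨ᵉ p₁ ∧ᵉ p₂ → 𝒜 , a ⊨ᵉ r
    from {𝒜} {a} (q₁ , q₂) = Sat⇒⊨ᵉ r (complete P (branch⇒Hom 𝒜 (⋀-sat⁺ λ s∈ → case ∈-map⁻ it s∈ of λ
      { (ρ , ρ∈ , refl) → one ρ∈ })))
      where
      one : ∀ {ρ} → ρ ∈ items [] → Sat ⟪ 𝒜 ⟫ a (it ρ)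
      one {ρ} m with ρ ≟ᵖ ρ₁
      ... | yes refl = ⊨ᵉ⇒Sat p₁ q₁
      ... | no n′    = ⋀-sat⁻ (⊨ᵉ⇒Sat p₂ q₂) (∈-map⁺ it (∈-filter⁺ (λ ρ → ¬? (ρ ≟ᵖ ρ₁)) m n′))
    -- The tree without the conjunct `π` satisfies `p` but, by irredundancy, not `r`.
    weaker : ∀ {π} → π ∈ items [] → ∀ p →
             ((∀ {ρ} → ρ ∈ items [] → ρ ≢ π → Sat (Tree (delete K π)) [] (it ρ)) → Sat (Tree (delete K π)) [] p) →
             ¬ (p ⊨ᴱ r)
    weaker {π} m p f e with item∈⁻ [] m
    ... | m′ , i , refl = irr m′ (sound P (D.canonical⁻ r (⊨ᴱ⇒⊨ᵉ {p} {r} e (D.canonical⁺ p (f keeps)))))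
      where
      module D = Frontier (delete K π) (supp P) (cover P ∘ proj₂ ∘ delete-≢nil K π)
      same-root : ∀ {j ρ} → j ∷ [] ≼ ρ → i ∷ [] ≼ ρ → j ≡ i
      same-root here     l        = ≼-siblings l
      same-root (down l) here     = sym (≼-siblings (down l))
      same-root (down l) (down m) = same-root l m
      keeps : ∀ {ρ} → ρ ∈ items [] → ρ ≢ π → Sat (Tree (delete K π)) [] (it ρ)
      keeps ρ∈ n′ with item∈⁻ [] ρ∈
      ... | _ , j , refl = item-sat id (pred height)
        (λ l k → _ , trans (kept l) k) (λ l k → inj₁ (_ , refl , trans (kept l) k))
        where
        kept : ∀ {ρ} → j ∷ [] ≼ ρ → delete K (i ∷ []) ρ ≡ K ρ
        kept l = delete-⋠ K (i ∷ []) λ l′ → n′ (cong (_∷ []) (same-root l l′))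
  go : ∀ ρs → (∀ {ρ} → ρ ∈ ρs → ρ ∈ items []) → (∀ {ρ} → ρ ∈ items [] → ρ ∈ ρs) → Homogeneous r ⊎ Decomposable r
  go []       f g = inj₁ λ m → case ∈-map⁻ _ m of λ { (_ , m′ , _) → case g m′ of λ () }
  go (ρ ∷ ρs) f g with Any.any? (λ ρ′ → ¬? (ρ ≟ᵖ ρ′)) ρs
  ... | yes some = let ρ′ , m , n = find some in inj₂ (split (f (here refl)) (f (there m)) n)
  ... | no none = inj₁ λ m m′ → case ∈-map⁻ _ m , ∈-map⁻ _ m′ of λ
    { ((_ , k , refl) , (_ , k′ , refl)) → cong (λ ρ → letterAt (just ρ)) (trans (same (g k)) (sym (same (g k′)))) }
    where
    same : ∀ {ρ′} → ρ′ ∈ ρ ∷ ρs → ρ′ ≡ ρ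
    same (here e) = e
    same {ρ′} (there m) with ρ ≟ᵖ ρ′
    ... | yes e = sym e
    ... | no n  = contradiction (lose m n) none

-- Both parts hold in frontier elements; if these coincide, `r` would hold there as well.
homogeneous⇒indecomposable : ∀ {r} → Homogeneous r → ¬ Decomposable r
homogeneous⇒indecomposable {r} hom (p₁ , p₂ , (to , from) , n₁ , n₂) =
  let l₁ , m₁ , s₁ = frontier-complete {r} {p₁} (λ 𝒟 a ℓ → proj₁ ∘ to 𝒟 a ℓ) n₁
      l₂ , m₂ , s₂ = frontier-complete {r} {p₂} (λ 𝒟 a ℓ → proj₂ ∘ to 𝒟 a ℓ) n₂
  in frontier-sound {r} m₁ (⊨ᴱ⇒⊨ᵉ {p₁ ∧ᵉ p₂} {r} from (s₁ , subst (_⊩ᴸ p₂) (hom m₂ m₁) s₂))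

-- Tautologies and sizes of letters

[]-sat : ∀ r {b} → [] , b ⊨ᵉ r → ∀ {𝒜 a} → 𝒜 , a ⊨ᵉ r
[]-sat ⊤ᵉ       _       = tt
[]-sat (s ∧ᵉ t) (p , q) = []-sat s p , []-sat t q
[]-sat (∃ᵉ S r) (_ , () , _)

Trivial : ELI → Set
Trivial r = [] ⊩ᴸ r

Nontrivial : ELI → Set
Nontrivial r = ¬ Trivial r

≣ᴱ⊤⇒trivial : ∀ {r} → r ≣ᴱ ⊤ᵉ → Trivial r
≣ᴱ⊤⇒trivial {r} (_ , e) = ⊨ᴱ⇒⊨ᵉ {⊤ᵉ} {r} e tt

trivial⇒≣ᴱ⊤ : ∀ {r} → Trivial r → r ≣ᴱ ⊤ᵉ
trivial⇒≣ᴱ⊤ {r} t = (λ _ _ _ _ → tt) , ⊨ᵉ⇒⊨ᴱ {⊤ᵉ} {r} λ _ → []-sat r t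

-- For n conjuncts there are n + 1 labels, and each conjunct yields at most one fact per pair of
-- labels.
letter-bound : ℕ → ℕ
letter-bound n = n * (suc n * suc n)

letter-bound-mono : ∀ {m n} → m ≤ n → letter-bound m ≤ letter-bound n
letter-bound-mono leq = *-mono-≤ leq (*-mono-≤ (s≤s leq) (s≤s leq))

letterAt-bound : ∀ r m → ∣ Reduced.letterAt r m ∣ᴬ ≤ letter-bound ∣ r ∣ᴱ
letterAt-bound r m = begin
  ∣ letterAt m ∣ᴬ      ≤⟨ length-deduplicate _≟ᶠ_ (letterAt m) ⟩
  length (letterAt m)  ≡⟨ length-map _ facts ⟩
  length facts         ≤⟨ length-facts ⟩
  letter-bound (length (supp (reduced r))) ≤⟨ letter-bound-mono (proj₂ (proj₂ (reduce r))) ⟩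
  letter-bound ∣ r ∣ᴱ   ∎
  where
  open ≤-Reasoning
  open Reduced r

tree-bound : ∀ r → ∣ tree r ∣ᴬ ≤ letter-bound ∣ r ∣ᴱ
tree-bound r = letterAt-bound r nothing

frontier-bound : ∀ {r l} → l ∈ frontier r → ∣ l ∣ᴬ ≤ letter-bound ∣ r ∣ᴱ
frontier-bound {r} m with ∈-map⁻ (λ ρ → Reduced.letterAt r (just ρ)) m
... | ρ , _ , refl = letterAt-bound r (just ρ)

length-frontier : ∀ r → length (frontier r) ≤ ∣ r ∣ᴱ
length-frontier r = begin
  length (frontier r)                       ≡⟨ length-map _ (items []) ⟩
  length (items [])                         ≤⟨ length-filter (child? []) (supp (reduced r)) ⟩
  length (supp (reduced r))       ≤⟨ proj₂ (proj₂ (reduce r)) ⟩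
  ∣ r ∣ᴱ                                     ∎
  where
  open ≤-Reasoning
  open Reduced r

-- Sequences of blocks and their satisfaction

Valuation : Set₁
Valuation = ℕ → ELI → Set

Segment : Set
Segment = ℕ × Block

end : ELI → List ELI → ELI
end r []       = r
end r (s ∷ rs) = end s rs

lst : Block → ELI
lst (r ∷ rs) = end r rs

Row : Valuation → ℕ → List ELI → Set
Row V p []       = ⊤
Row V p (r ∷ rs) = V p r × Row V (suc p) rs

At : Valuation → ℕ → Block → Set
At V p b = Row V p (toList b)

-- A segment (g , b) asks for the block b at a distance of at least g from the last
-- point of the preceding block: g = 0 encodes ≤, and g > 0 a sequence of g many <.

Tail : Valuation → ℕ → List Segment → Set
Tail V p []            = ⊤
Tail V p ((g , b) ∷ t) = ∃[ q ] p + g ≤ q × At V q b × Tail V (q + lastIndex b) t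

Some : Valuation → List Segment → Set
Some V []            = ⊤
Some V ((g , b) ∷ t) = ∃[ p ] At V p b × Tail V (p + lastIndex b) t

Row-map : ∀ {V V′ : Valuation} {p p′} rs → (∀ {j} → j < length rs → ∀ r → V (p + j) r → V′ (p′ + j) r) →
          Row V p rs → Row V′ p′ rs
Row-map []       f _        = tt
Row-map {V} {V′} {p} {p′} (r ∷ rs) f (v , vs) =
  subst (λ q → V′ q r) (+-identityʳ p′) (f (s≤s z≤n) r (subst (λ q → V q r) (sym (+-identityʳ p)) v)) ,
  Row-map rs (λ {j} j< s v → subst (λ q → V′ q s) (+-suc p′ j) (f (s≤s j<) s (subst (λ q → V q s) (sym (+-suc p j)) v))) vs

At-lst : ∀ {V : Valuation} {p} b → At V p b → V (p + lastIndex b) (lst b)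
At-lst {V} {p} (r ∷ rs) = go r rs
  where
  go : ∀ {p} r rs → Row V p (r ∷ rs) → V (p + length rs) (end r rs)
  go r []       (v , _)  = subst (λ q → V q r) (sym (+-identityʳ _)) v
  go r (s ∷ rs) (_ , vs) = subst (λ q → V q (end s rs)) (sym (+-suc _ _)) (go s rs vs)

module _ {V V′ : Valuation} where

  Tail-from : ∀ {p} t → (∀ {q} → p ≤ q → ∀ r → V q r → V′ q r) → Tail V p t → Tail V′ p t
  Tail-from []            f _ = tt
  Tail-from {p} ((g , b) ∷ t) f (q , leq , a , ts) =
    q , leq , Row-map (toList b) (λ {j} _ → f (≤-trans p≤q (m≤m+n q j))) a ,
    Tail-from t (f ∘ ≤-trans (≤-trans p≤q (m≤m+n q _))) ts
    where p≤q = ≤-trans (m≤m+n p g) leq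

  module _ {k : ℕ} where

    Tail-shift⁺ : (∀ p r → V p r → V′ (k + p) r) → ∀ {p} t → Tail V p t → Tail V′ (k + p) t
    Tail-shift⁺ f []            _                   = tt
    Tail-shift⁺ f {p} ((g , b) ∷ t) (q , leq , a , ts) =
      k + q , ≤-trans (≤-reflexive (+-assoc k p g)) (+-monoʳ-≤ k leq) ,
      Row-map (toList b) (λ {j} _ r v → subst (λ q → V′ q r) (sym (+-assoc k q j)) (f (q + j) r v)) a ,
      subst (λ p → Tail V′ p t) (sym (+-assoc k q _)) (Tail-shift⁺ f t ts)

    Tail-shift⁻ : (∀ p r → V′ (k + p) r → V p r) → ∀ {p} t → Tail V′ (k + p) t → Tail V p t
    Tail-shift⁻ f []            _                    = tt
    Tail-shift⁻ f {p} ((g , b) ∷ t) (q′ , leq , a , ts) =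
      q , +-cancelˡ-≤ k _ _ (≤-trans (≤-reflexive (sym (+-assoc k p g))) (≤-trans leq (≤-reflexive q≡))) ,
      Row-map (toList b) (λ {j} _ r v → f (q + j) r (subst (λ q → V′ q r) (trans (cong (_+ j) q≡) (+-assoc k q j)) v)) a ,
      Tail-shift⁻ f t (subst (λ p → Tail V′ p t) (trans (cong (_+ lastIndex b) q≡) (+-assoc k q _)) ts)
      where
      q  = q′ ∸ k
      q≡ : q′ ≡ k + q
      q≡ = sym (m+[n∸m]≡n (≤-trans (m≤m+n k p) (≤-trans (m≤m+n (k + p) g) leq)))

Tail-early : ∀ {V p p′} t → p′ ≤ p → Tail V p t → Tail V p′ t
Tail-early []            leq _                     = tt
Tail-early ((g , b) ∷ t) leq (q , leq′ , a , ts) = q , ≤-trans (+-monoˡ-≤ g leq) leq′ , a , ts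

Tail⇒Some : ∀ {V p} t → Tail V p t → Some V t
Tail⇒Some []      _                = tt
Tail⇒Some (_ ∷ t) (q , _ , a , ts) = q , a , ts

-- Normal form conditions on segments

Good : Block → Set
Good b = Nontrivial (first b) × Nontrivial (lst b)

N3 : ELI → List Segment → Set
N3 x ((zero , r ∷ []) ∷ _) = ¬ (x ⊨ᴱ r)
N3 x _                     = ⊤

N4 : Block → List Segment → Set
N4 (r ∷ []) ((zero , b) ∷ _) = ¬ (first b ⊨ᴱ r)
N4 _        _                = ⊤

OKs : List Segment → Set
OKs []            = ⊤
OKs ((g , b) ∷ t) = Good b × N3 (lst b) t × N4 b t × OKs t

-- (n1), (n3) and (n4), with (n2) built into the numerical gaps. As in the definition of normal
-- form, the first block is exempt from (n4) and may begin with ⊤.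
OK : Block → List Segment → Set
OK b t = (0 < lastIndex b → Nontrivial (lst b)) × N3 (lst b) t × OKs t

-- Words of letters, joined by empty gaps

Word : Set
Word = List Letter

infixl 9 _!_

_!_ : Word → ℕ → Letter
[]      ! _     = []
(l ∷ w) ! zero  = l
(l ∷ w) ! suc p = w ! p

val : Word → Valuation
val w p r = (w ! p) ⊩ᴸ r

!-++ˡ : ∀ u {v p} → p < length u → (u ++ v) ! p ≡ u ! p
!-++ˡ (l ∷ u) {p = zero}  _         = refl
!-++ˡ (l ∷ u) {p = suc p} (s≤s p<) = !-++ˡ u p<

!-++ʳ : ∀ u {v} p → (u ++ v) ! (length u + p) ≡ v ! p
!-++ʳ []      p = refl
!-++ʳ (l ∷ u) p = !-++ʳ u p

!-beyond : ∀ u {p} → length u ≤ p → u ! p ≡ []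
!-beyond []      _                = refl
!-beyond (l ∷ u) {suc p} (s≤s leq) = !-beyond u leq

!-replicate : ∀ n {v p} → p < n → (replicate n [] ++ v) ! p ≡ []
!-replicate (suc n) {p = zero}  _        = refl
!-replicate (suc n) {p = suc p} (s≤s p<) = !-replicate n p<

!-nontrivial : ∀ u {p r} → Nontrivial r → val u p r → p < length u
!-nontrivial u {p} {r} n v with p <? length u
... | yes p< = p<
... | no p≮  = contradiction (subst (_⊩ᴸ r) (!-beyond u (≮⇒≥ p≮)) v) n

module Gapped (N : ℕ) where

  infixr 5 _⊕_

  _⊕_ : Word → Word → Word
  u ⊕ w = u ++ (replicate N [] ++ w)

  ⊕-right : ∀ u {w} p → (u ⊕ w) ! (length u + N + p) ≡ w ! p
  ⊕-right u {w} p = trans (cong ((u ⊕ w) !_) (+-assoc (length u) N p))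
    (trans (!-++ʳ u (N + p))
      (trans (cong (λ n → (replicate N [] ++ w) ! (n + p)) (sym (length-replicate N))) (!-++ʳ (replicate N []) p)))

  ⊕-nontrivial : ∀ u {w p r} → Nontrivial r → val (u ⊕ w) p r → p < length u ⊎ ∃[ q ] p ≡ length u + N + q
  ⊕-nontrivial u {w} {p} {r} n v with p <? length u | p <? length u + N
  ... | yes p< | _ = inj₁ p<
  ... | no p≮ | no p≮′ = inj₂ (p ∸ (length u + N) , sym (m+[n∸m]≡n (≮⇒≥ p≮′)))
  ... | no p≮ | yes p< = contradiction (subst (_⊩ᴸ r) gap v) n
    where
    q≡ = m+[n∸m]≡n (≮⇒≥ p≮)
    gap : (u ⊕ w) ! p ≡ []
    gap = trans (cong ((u ⊕ w) !_) (sym q≡)) (trans (!-++ʳ u (p ∸ length u))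
            (!-replicate N (+-cancelˡ-< (length u) _ _ (≤-trans (s≤s (≤-reflexive q≡)) p<))))

  Short : Segment → Set
  Short (g , b) = g ≤ N × lastIndex b < N

  At-left : ∀ u {w p} b → p + lastIndex b < length u → At (val (u ⊕ w)) p b → At (val u) p b
  At-left u {w} {p} b p< = Row-map (toList b) λ {j} j< r →
    subst (_⊩ᴸ r) (!-++ˡ u (≤-trans (s≤s (+-monoʳ-≤ p (s≤s⁻¹ j<))) p<))

  At-left⁺ : ∀ u {w p} b → p + lastIndex b < length u → At (val u) p b → At (val (u ⊕ w)) p b
  At-left⁺ u {w} {p} b p< = Row-map (toList b) λ {j} j< r →
    subst (_⊩ᴸ r) (sym (!-++ˡ u (≤-trans (s≤s (+-monoʳ-≤ p (s≤s⁻¹ j<))) p<)))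

  At-right : ∀ u {w p} b → At (val (u ⊕ w)) (length u + N + p) b → At (val w) p b
  At-right u {w} {p} b = Row-map (toList b) λ {j} _ r →
    subst (_⊩ᴸ r) (trans (cong ((u ⊕ w) !_) (+-assoc (length u + N) p j)) (⊕-right u (p + j)))

  At-right⁺ : ∀ u {w p} b → At (val w) p b → At (val (u ⊕ w)) (length u + N + p) b
  At-right⁺ u {w} {p} b = Row-map (toList b) λ {j} _ r →
    subst (_⊩ᴸ r) (sym (trans (cong ((u ⊕ w) !_) (+-assoc (length u + N) p j)) (⊕-right u (p + j))))

  Tail-right : ∀ u {w p} t → Tail (val (u ⊕ w)) (length u + N + p) t → Tail (val w) p t
  Tail-right u = Tail-shift⁻ λ p r → subst (_⊩ᴸ r) (⊕-right u p)

  Tail-right⁺ : ∀ u {w p} t → Tail (val w) p t → Tail (val (u ⊕ w)) (length u + N + p) t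
  Tail-right⁺ u = Tail-shift⁺ λ p r → subst (_⊩ᴸ r) (sym (⊕-right u p))

  Tail-right-+ : ∀ u w q n t → Tail (val (u ⊕ w)) (length u + N + q + n) t → Tail (val w) (q + n) t
  Tail-right-+ u w q n t ts = Tail-right u t (subst (λ p → Tail (val (u ⊕ w)) p t) (+-assoc (length u + N) q n) ts)

  skip : ∀ u {w} t → Some (val w) t → Some (val (u ⊕ w)) t
  skip u []            _            = tt
  skip u {w} ((g , b) ∷ t) (p , a , ts) =
    length u + N + p , At-right⁺ u b a ,
    subst (λ p → Tail (val (u ⊕ w)) p t) (sym (+-assoc (length u + N) p _)) (Tail-right⁺ u t ts)

  -- The `N` empty letters bridge any short gap, wherever in `u` the preceding block ends.
  leap : ∀ u {w p} t → p < length u → All Short t → Some (val w) t → Tail (val (u ⊕ w)) p t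
  leap u []            p< _  _            = tt
  leap u {w} {p} ((g , b) ∷ t) p< ((g≤ , _) ∷ _) s@(q , _ , _) =
    length u + N + q , ≤-trans (+-mono-≤ (<⇒≤ p<) g≤) (m≤m+n (length u + N) q) , proj₂ (skip u ((g , b) ∷ t) s)

  extend : ∀ u {w p g} b t → p + lastIndex b < length u → At (val u) p b → All Short t →
           Some (val w) t → Some (val (u ⊕ w)) ((g , b) ∷ t)
  extend u b t p< a sh s = _ , At-left⁺ u b p< a , leap u t p< sh s

  -- Blocks are shorter than the gaps, so none of them spans a gap.

  stays : ∀ u {w p} b → p < length u → (0 < lastIndex b → Nontrivial (lst b)) → lastIndex b < N →
          At (val (u ⊕ w)) p b → p + lastIndex b < length u
  stays u {w} {p} (r ∷ [])     p< n b< a = ≤-trans (s≤s (≤-reflexive (+-identityʳ p))) p<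
  stays u {w} {p} (r ∷ s ∷ rs) p< n b< a with ⊕-nontrivial u {w} (n (s≤s z≤n)) (At-lst {p = p} (r ∷ s ∷ rs) a)
  ... | inj₁ q<       = q<
  ... | inj₂ (q , e) = contradiction (≤-trans (m≤m+n _ q) (≤-reflexive (sym e))) (<⇒≱ (+-mono-< p< b<))

  data Located (u w : Word) (b : Block) : ℕ → Set where
    left  : ∀ {p} → p + lastIndex b < length u → At (val u) p b → Located u w b p
    right : ∀ {q} → At (val w) q b → Located u w b (length u + N + q)

  locate : ∀ u {w p} b → p < length u ⊎ Nontrivial (first b) → (0 < lastIndex b → Nontrivial (lst b)) →
           lastIndex b < N → At (val (u ⊕ w)) p b → Located u w b p
  locate u {w} b (inj₁ p<) n b< a = let q< = stays u b p< n b< a in left q< (At-left u b q< a)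
  locate u {w} b (inj₂ n₁) n b< a with ⊕-nontrivial u {w} n₁ (proj₁ a)
  ... | inj₁ p<          = let q< = stays u b p< n b< a in left q< (At-left u b q< a)
  ... | inj₂ (q , refl) = right (At-right u b a)

  N3ᴸ : Letter → List Segment → Set
  N3ᴸ l ((zero , r ∷ []) ∷ _) = ¬ (l ⊩ᴸ r)
  N3ᴸ l _                     = ⊤

  -- Nontrivial labels keep the next block out of the empty gap. Since `k` is the last position of
  -- `u`, this block could lie in `u` only as a primitive block at `k` related by ≤, which `N3ᴸ`
  -- excludes.
  leave : ∀ u {w k} t → suc k ≡ length u → OKs t → All Short t → N3ᴸ (u ! k) t →
          Tail (val (u ⊕ w)) k t → Some (val w) t
  leave u []            e ok sh n3 _ = tt
  leave u {w} {k} ((g , b) ∷ t) e (good , _) ((_ , b<) ∷ _) n3 (p , leq , a , ts)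
    with locate u {w} b (inj₂ (proj₁ good)) (λ _ → proj₂ good) b< a
  ... | right {q} a′ = q , a′ , Tail-right-+ u w q _ t ts
  ... | left p< a′ = ⊥-elim (stuck g b n3 leq (s≤s⁻¹ (≤-trans p< (≤-reflexive (sym e)))) a′)
    where
    stuck : ∀ g b → N3ᴸ (u ! k) ((g , b) ∷ t) → k + g ≤ p → p + lastIndex b ≤ k → At (val u) p b → ⊥
    stuck zero    (r ∷ [])     n3 leq leq′ (v , _) = n3 (subst (λ p → val u p r)
      (≤-antisym (≤-trans (≤-reflexive (sym (+-identityʳ p))) leq′) (≤-trans (≤-reflexive (sym (+-identityʳ k))) leq)) v)
    stuck zero    (r ∷ s ∷ rs) n3 leq leq′ _ =
      contradiction (≤-trans leq′ (≤-trans (m≤m+n k 0) leq)) (<⇒≱ (m<m+n p (s≤s z≤n)))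
    stuck (suc g) b            n3 leq leq′ _ =
      contradiction (≤-trans leq (≤-trans (m≤m+n p _) leq′)) (<⇒≱ (m<m+n k (s≤s z≤n)))

  -- The words of the form q₀ ∅ᴺ q₁ ∅ᴺ … qₙ

  word : Block → Word
  word b = map tree (toList b)

  spread : List Segment → Word
  spread []            = []
  spread ((g , b) ∷ t) = word b ⊕ spread t

  length-word : ∀ b → length (word b) ≡ suc (lastIndex b)
  length-word b = length-map tree (toList b)

  word-At : ∀ b → At (val (word b)) 0 b
  word-At (r ∷ rs) = go [] (r ∷ rs)
    where
    go : ∀ u rs → Row (val (u ++ map tree rs)) (length u) rs
    go u []       = tt
    go u (r ∷ rs) =
      subst (_⊩ᴸ r) (sym (trans (cong ((u ++ tree r ∷ map tree rs) !_) (sym (+-identityʳ _))) (!-++ʳ u 0)))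
        (tree⁺ {r} {r} (⊨ᴱ-refl {r})) ,
      subst₂ (λ w p → Row (val w) p rs) (++-assoc u (tree r ∷ []) (map tree rs))
        (trans (length-++ u) (+-comm (length u) 1)) (go (u ++ tree r ∷ []) rs)

  word-lst : ∀ b → word b ! lastIndex b ≡ tree (lst b)
  word-lst (r ∷ rs) = go r rs
    where
    go : ∀ r rs → map tree (r ∷ rs) ! length rs ≡ tree (end r rs)
    go r []       = refl
    go r (s ∷ rs) = go s rs

  fits⇒0 : ∀ {p} b → p + lastIndex b < length (word b) → p ≡ 0
  fits⇒0 {zero}  b p< = refl
  fits⇒0 {suc p} b p< = contradiction (≤-trans p< (≤-reflexive (length-word b))) (<⇒≱ (s≤s (s≤s (m≤n+m _ p))))

  N3⇒N3ᴸ : ∀ {x} t → N3 x t → N3ᴸ (tree x) t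
  N3⇒N3ᴸ []                       n = tt
  N3⇒N3ᴸ {x} ((zero , r ∷ []) ∷ _) n = n ∘ tree⁻ {x} {r}
  N3⇒N3ᴸ ((zero , r ∷ s ∷ rs) ∷ _) n = tt
  N3⇒N3ᴸ ((suc g , b) ∷ _)         n = tt

  -- A common form for the first block, fixed at 0, and for later ones, kept out of the gaps by
  -- their nontrivial first label.
  SomeFrom : Valuation → Block → List Segment → Set
  SomeFrom V b t = ∃[ p ] (p ≡ 0 ⊎ Nontrivial (first b)) × At V p b × Tail V (p + lastIndex b) t

  start : ∀ {p} (u : Word) b → 0 < length u → p ≡ 0 ⊎ Nontrivial (first b) → p < length u ⊎ Nontrivial (first b)
  start u b u> (inj₁ refl) = inj₁ u>
  start u b u> (inj₂ n)    = inj₂ n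

  -- Either `b` fills `word b`, and (n3) forces `t` to leave it, or `b` lies in `w` already and `t`
  -- after it.
  forward : ∀ {b t w} → OK b t → lastIndex b < N → All Short t →
            SomeFrom (val (word b ⊕ w)) b t → Some (val w) t
  forward {b} {t} {w} (n , n3 , ok) b< sh (p , st , a , ts)
    with locate (word b) {w} b (start (word b) b (s≤s z≤n) st) n b< a
  ... | right {q} a′ = Tail⇒Some t (Tail-right-+ (word b) w q _ t ts)
  ... | left p< a′ with fits⇒0 b p<
  ...   | refl = leave (word b) t (sym (length-word b)) ok sh
                   (subst (λ l → N3ᴸ l t) (sym (word-lst b)) (N3⇒N3ᴸ t n3)) ts

  weak : ∀ {b t} → Good b → N3 (lst b) t → OKs t → OK b t
  weak g n3 ok = (λ _ → proj₂ g) , n3 , ok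

  Some⇒From : ∀ {V g b t} → Good b → Some V ((g , b) ∷ t) → SomeFrom V b t
  Some⇒From g (p , a , ts) = p , inj₂ (proj₁ g) , a , ts

  -- Mutual induction on the number of blocks. A block that does not start at 0 is pushed into
  -- `spread t` together with `t`. There `t` has to start at 0, so `b` is primitive and shares that
  -- point with the first block of `t`, with gap 0, against (n4).
  starts-at-0 : ∀ {g b t p} → OKs ((g , b) ∷ t) → All Short ((g , b) ∷ t) →
                At (val (word b ⊕ spread t)) p b → Tail (val (word b ⊕ spread t)) (p + lastIndex b) t → p ≡ 0
  no-room : ∀ {b} t → Good b → lastIndex b < N → N4 b t → OKs t → All Short t →
            ∀ {p} → At (val (spread t)) p b → Tail (val (spread t)) (p + lastIndex b) t → ⊥

  starts-at-0 {g} {b} {t} {p} (good , n3 , n4 , ok) ((_ , b<) ∷ sh) a ts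
    with locate (word b) {spread t} b (inj₂ (proj₁ good)) (λ _ → proj₂ good) b< a
  ... | left p< _    = fits⇒0 b p<
  ... | right {q} a′ = ⊥-elim (no-room t good b< n4 ok sh a′
        (Tail-right-+ (word b) (spread t) q _ t ts))

  no-room {b} [] good b< n4 ok sh a _ = proj₁ good (proj₁ a)
  no-room {b} ((g , c) ∷ t) good b< n4 ok sh {p} a (q , leq , a′ , ts)
    with starts-at-0 {g} {c} {t} ok sh a′ ts
  ... | refl = clash b g n4 p≡0 (≤-trans (m≤n+m (lastIndex b) p) (≤-trans (m≤m+n _ g) leq)) (≤-trans (m≤n+m g (p + lastIndex b)) leq)
    where
    p≡0 : At (val (spread ((g , c) ∷ t))) 0 b
    p≡0 = subst (λ p → At (val (spread ((g , c) ∷ t))) p b) (n≤0⇒n≡0 (≤-trans (m≤m+n p _) (≤-trans (m≤m+n _ g) leq))) a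
    clash : ∀ b g → N4 b ((g , c) ∷ t) → At (val (word c ⊕ spread t)) 0 b → lastIndex b ≤ 0 → g ≤ 0 → ⊥
    clash (r ∷ []) zero n4 (v , _) _ _ = n4 (tree⁻ {first c} {r} v)

  -- The gaps confine `b` to a single piece, which does not contain it, or to `spread t`, where `t`
  -- leaves no room for it.
  avoid-pieces : ∀ {g b t} → OKs ((g , b) ∷ t) → All Short ((g , b) ∷ t) → ∀ us →
                 (∀ {u} → u ∈ us → ∀ {p} → p + lastIndex b < length u → ¬ At (val u) p b) →
                 ¬ Some (val (foldr _⊕_ (spread t) us)) ((g , b) ∷ t)
  avoid-pieces {t = t} (good , n3 , n4 , ok) ((_ , b<) ∷ sh) [] none (p , a , ts) = no-room t good b< n4 ok sh a ts
  avoid-pieces {b = b} {t} ok@(good , _) sh@((_ , b<) ∷ _) (u ∷ us) none (p , a , ts)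
    with locate u {foldr _⊕_ (spread t) us} b (inj₂ (proj₁ good)) (λ _ → proj₂ good) b< a
  ... | left p< a′   = none (here refl) p< a′
  ... | right {q} a′ = avoid-pieces ok sh us (none ∘ there)
      (q , a′ , Tail-right-+ u (foldr _⊕_ (spread t) us) q _ t ts)

  avoid-start : ∀ {b u w} → (0 < lastIndex b → Nontrivial (lst b)) → lastIndex b < N → 0 < length u →
                (lastIndex b < length u → ¬ At (val u) 0 b) → ¬ At (val (u ⊕ w)) 0 b
  avoid-start {b} {u} n b< u> none a = let p< = stays u b u> n b< a in none p< (At-left u b p< a)

-- Negative examples: one block is replaced by pieces in which it does not occur

splits : ∀ {A : Set} → List A → List (List A × A × List A)
splits []       = []
splits (x ∷ xs) = ([] , x , xs) ∷ map (λ (u , y , v) → x ∷ u , y , v) (splits xs)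

splits-sound : ∀ {A : Set} {xs u v : List A} {x} → (u , x , v) ∈ splits xs → xs ≡ u ++ x ∷ v
splits-sound {xs = x ∷ xs} (here refl) = refl
splits-sound {xs = x ∷ xs} (there m) with ∈-map⁻ _ m
... | _ , m′ , refl = cong (x ∷_) (splits-sound m′)

splits-complete : ∀ {A : Set} u {v : List A} {x} → (u , x , v) ∈ splits (u ++ x ∷ v)
splits-complete []      = here refl
splits-complete (y ∷ u) = there (∈-map⁺ (λ (u , z , v) → y ∷ u , z , v) (splits-complete u))

trees : List ELI → Word
trees = map tree

Split : Set
Split = List ELI × ELI × List ELI

-- `weakened` is satisfied by candidates with a properly weaker label. `broken` serves for a weaker
-- last label when the next block may start at that very point: it finds the intact copy of `r`
-- behind the gap.
weakened broken : Split → List (List Word)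
weakened (u , r , v) = map (λ l → (trees u ++ l ∷ trees v) ∷ []) (frontier r)
broken (u , r , v) = map (λ l → (trees u ++ l ∷ []) ∷ (tree r ∷ trees v) ∷ []) (frontier r)

-- For a candidate whose block ends too early, at `r`: its continuation may still use that point,
-- hence the second copy.
doubled : Split → List (List Word)
doubled (u , r , [])        = []
doubled (u , r , v@(_ ∷ _)) = ((trees u ++ tree r ∷ []) ∷ (tree r ∷ trees v) ∷ []) ∷ []

-- For candidates that miss the first point of a later block, or that put there only primitive
-- blocks and then continue behind it, or at it with a longer block whose first label is weaker than
-- `r`.
beheaded : Split → List (List Word)
beheaded (u , r , v) =
  (trees v ∷ []) ∷ ((tree r ∷ []) ∷ trees v ∷ []) ∷ map (λ l → (tree r ∷ []) ∷ (l ∷ trees v) ∷ []) (frontier r)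

-- At the first point of a block the second piece of `broken` and `doubled` is the entire block;
-- this refutes only a block that is fixed at time 0.
first-cut later-cut : Split → List (List Word)
first-cut s = weakened s ++ broken s ++ doubled s
later-cut s@([]    , _ , _) = weakened s ++ beheaded s
later-cut s@(_ ∷ _ , _ , _) = first-cut s

singletons : ELI → List Word
singletons r = map (_∷ []) (frontier r)

first-pieces : Block → List (List Word)
first-pieces b = concatMap first-cut (splits (toList b))

-- A later primitive block r may be satisfied in other queries by a sequence of
-- properly weaker labels related by ≤, of which M are taken care of.

later-pieces : ℕ → Block → List (List Word)
later-pieces M (r ∷ [])         = [] ∷ concat (replicate M (singletons r)) ∷ []
later-pieces M b@(_ ∷ _ ∷ _) = concatMap later-cut (splits (toList b))

Row-++⁻ : ∀ {V : Valuation} {p} u {v} → Row V p (u ++ v) → Row V p u × Row V (p + length u) v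
Row-++⁻ {V} {p} []      {v} a       = tt , subst (λ p → Row V p v) (sym (+-identityʳ p)) a
Row-++⁻ {V} {p} (r ∷ u) {v} (x , a) =
  let a₁ , a₂ = Row-++⁻ u a in (x , a₁) , subst (λ p → Row V p v) (sym (+-suc p (length u))) a₂

Row-++⁺ : ∀ {V : Valuation} {p} u {v} → Row V p u → Row V (p + length u) v → Row V p (u ++ v)
Row-++⁺ {V} {p} []      {v} _       a₂ = subst (λ p → Row V p v) (+-identityʳ p) a₂
Row-++⁺ {V} {p} (r ∷ u) {v} (x , a) a₂ =
  x , Row-++⁺ u a (subst (λ p → Row V p v) (+-suc p (length u)) a₂)

split-length : ∀ {b : Block} {u r v} → toList b ≡ u ++ r ∷ v → lastIndex b ≡ length u + length v
split-length {b} {u} {r} {v} e =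
  suc-injective (trans (cong length e) (trans (length-++ u) (+-suc (length u) (length v))))

At-label : ∀ {V : Valuation} {b u r v} → toList b ≡ u ++ r ∷ v → At V 0 b → V (length u) r
At-label {V} {b} {u} e a = proj₁ (proj₂ (Row-++⁻ u (subst (Row V 0) e a)))

length-trees : ∀ u → length (trees u) ≡ length u
length-trees = length-map tree

letter-at : ∀ u {l v} → (trees u ++ l ∷ v) ! length u ≡ l
letter-at []      = refl
letter-at (r ∷ u) = letter-at u

weak-letter : ∀ b {u r v l} w → toList b ≡ u ++ r ∷ v → l ∈ frontier r → ¬ At (val (trees u ++ l ∷ w)) 0 b
weak-letter b {u} {r} w e m a =
  frontier-sound {r} m (subst (_⊩ᴸ r) (letter-at u) (At-label {b = b} {u} e a))

length-snoc : ∀ u {l : Letter} → length (trees u ++ l ∷ []) ≡ suc (length u)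
length-snoc u = trans (length-++ (trees u)) (trans (cong (_+ 1) (length-trees u)) (+-comm (length u) 1))

module _ {b : Block} {u r v} (e : toList b ≡ u ++ r ∷ v) where

  private
    k≡ = split-length {b} {u} e

  first-cut-avoids : ∀ {us} → us ∈ first-cut (u , r , v) →
    ∃[ w ] ∃[ ws ] us ≡ w ∷ ws × 0 < length w × (lastIndex b < length w → ¬ At (val w) 0 b)
  first-cut-avoids m with ∈-++⁻ (weakened (u , r , v)) m
  first-cut-avoids m | inj₁ m′ with ∈-map⁻ _ m′
  ... | l , l∈ , refl = _ , _ , refl , nonempty (trees u) , λ _ → weak-letter b (trees v) e l∈
    where nonempty : ∀ u {l v} → 0 < length {A = Letter} (u ++ l ∷ v)
          nonempty []      = s≤s z≤n
          nonempty (_ ∷ _) = s≤s z≤n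
  first-cut-avoids m | inj₂ m′ with ∈-++⁻ (broken (u , r , v)) m′
  ... | inj₁ m″ with ∈-map⁻ _ m″
  ...   | l , l∈ , refl = _ , _ , refl , ≤-trans (s≤s z≤n) (≤-reflexive (sym (length-snoc u))) ,
          λ _ → weak-letter b [] e l∈
  first-cut-avoids m | inj₂ m′ | inj₂ m″ = go v refl m″
    where
    go : ∀ v′ → v′ ≡ v → ∀ {us} → us ∈ doubled (u , r , v′) →
      ∃[ w ] ∃[ ws ] us ≡ w ∷ ws × 0 < length w × (lastIndex b < length w → ¬ At (val w) 0 b)
    go (s ∷ v′) refl (here refl) = _ , _ , refl , ≤-trans (s≤s z≤n) (≤-reflexive (sym (length-snoc u))) ,
      λ k< _ → contradiction (≤-trans (s≤s (≤-reflexive (sym k≡))) (≤-trans k< (≤-reflexive (length-snoc u))))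
                 (<⇒≱ (s≤s (m<m+n (length u) (s≤s z≤n))))

  Avoids : Word → Set
  Avoids w = ∀ {p} → p + lastIndex b < length w → ¬ At (val w) p b

  too-short : ∀ w → length w ≤ lastIndex b → Avoids w
  too-short w w≤ {p} p< _ = contradiction (≤-trans p< w≤) (<⇒≱ (s≤s (m≤n+m (lastIndex b) p)))

  weak-avoids : ∀ {l} w → length w ≤ suc (lastIndex b) → l ∈ frontier r → (∃[ v′ ] w ≡ trees u ++ l ∷ v′) → Avoids w
  weak-avoids w w≤ l∈ (v′ , refl) {zero}  p< a = weak-letter b v′ e l∈ a
  weak-avoids w w≤ l∈ (v′ , refl) {suc p} p< a =
    contradiction (≤-trans p< w≤) (<⇒≱ (s≤s (s≤s (m≤n+m (lastIndex b) p))))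

  length-replaced : ∀ {l : Letter} → length (trees u ++ l ∷ trees v) ≡ suc (lastIndex b)
  length-replaced = trans (length-++ (trees u)) (trans (cong₂ (λ m n → m + suc n) (length-trees u) (length-trees v))
                      (trans (+-suc (length u) (length v)) (cong suc (sym k≡))))

  later-cut-avoids : 0 < lastIndex b → ∀ {us} → us ∈ later-cut (u , r , v) → ∀ {w} → w ∈ us → Avoids w
  later-cut-avoids k> = go u refl
    where
    weakened-avoids : ∀ {us} → us ∈ weakened (u , r , v) → ∀ {w} → w ∈ us → Avoids w
    weakened-avoids m w∈ with ∈-map⁻ _ m
    weakened-avoids m (here refl) | l , l∈ , refl = weak-avoids (trees u ++ l ∷ trees v) (≤-reflexive (length-replaced {l})) l∈ (_ , refl)
    first-avoids : ∀ v′ → v′ ≡ v → 0 < length u → ∀ {us} → us ∈ broken (u , r , v) ++ doubled (u , r , v′) →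
                   ∀ {w} → w ∈ us → Avoids w
    first-avoids v′ eq u> m w∈ with ∈-++⁻ (broken (u , r , v)) m
    first-avoids v′ eq u> m w∈ | inj₁ m′ with ∈-map⁻ _ m′
    first-avoids v′ eq u> m (here refl) | inj₁ m′ | l , l∈ , refl =
      weak-avoids (trees u ++ l ∷ []) (≤-trans (≤-reflexive (length-snoc u)) (s≤s (≤-trans (m≤m+n _ _) (≤-reflexive (sym k≡))))) l∈ (_ , refl)
    first-avoids v′ eq u> m (there (here refl)) | inj₁ m′ | l , l∈ , refl =
      too-short (tree r ∷ trees v) (≤-trans (≤-reflexive (cong suc (length-trees v))) (≤-trans (+-monoˡ-≤ (length v) u>) (≤-reflexive (sym k≡))))
    first-avoids (s ∷ v′) refl u> m w∈ | inj₂ (here refl) with w∈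
    ... | here refl = too-short (trees u ++ tree r ∷ []) (≤-trans (≤-reflexive (length-snoc u))
            (≤-trans (m<m+n (length u) (s≤s z≤n)) (≤-reflexive (sym k≡))))
    ... | there (here refl) =
      too-short (tree r ∷ trees v) (≤-trans (≤-reflexive (cong suc (length-trees v))) (≤-trans (+-monoˡ-≤ (length v) u>) (≤-reflexive (sym k≡))))
    go : ∀ u′ → u′ ≡ u → ∀ {us} → us ∈ later-cut (u′ , r , v) → ∀ {w} → w ∈ us → Avoids w
    go [] refl m w∈ with ∈-++⁻ (weakened (u , r , v)) m
    ... | inj₁ m′ = weakened-avoids m′ w∈
    ... | inj₂ (here refl) with w∈
    ...   | here refl = too-short (trees v) (≤-reflexive (trans (length-trees v) (sym k≡)))
    go [] refl m w∈ | inj₂ (there (here refl)) with w∈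
    ...   | here refl         = too-short (tree r ∷ []) k>
    ...   | there (here refl) = too-short (trees v) (≤-reflexive (trans (length-trees v) (sym k≡)))
    go [] refl m w∈ | inj₂ (there (there m′)) with ∈-map⁻ _ m′
    go [] refl m (here refl)         | inj₂ (there (there m′)) | l , l∈ , refl = too-short (tree r ∷ []) k>
    go [] refl m (there (here refl)) | inj₂ (there (there m′)) | l , l∈ , refl =
      weak-avoids (trees u ++ l ∷ trees v) (≤-reflexive (length-replaced {l})) l∈ (_ , refl)
    go (x ∷ u′) refl m w∈ with ∈-++⁻ (weakened (u , r , v)) m
    ... | inj₁ m′ = weakened-avoids m′ w∈
    ... | inj₂ m′ = first-avoids v refl (s≤s z≤n) m′ w∈

later-pieces-avoid : ∀ M b {us} → us ∈ later-pieces M b → ∀ {w} → w ∈ us →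
                     ∀ {p} → p + lastIndex b < length w → ¬ At (val w) p b
later-pieces-avoid M (r ∷ []) (here refl) ()
later-pieces-avoid M (r ∷ []) (there (here refl)) w∈ = go M w∈
  where
  go : ∀ m {w} → w ∈ concat (replicate m (singletons r)) → ∀ {p} → p + 0 < length w → ¬ At (val w) p (r ∷ [])
  go (suc m) w∈ with ∈-++⁻ (singletons r) w∈
  ... | inj₂ w∈′ = go m w∈′
  ... | inj₁ w∈′ with ∈-map⁻ _ w∈′
  go (suc m) w∈ | inj₁ w∈′ | l , l∈ , refl = at-0 l∈
    where
    at-0 : ∀ {l} → l ∈ frontier r → ∀ {p} → p + 0 < 1 → ¬ At (val (l ∷ [])) p (r ∷ [])
    at-0 l∈ {zero}  _        (a , _) = frontier-sound {r} l∈ a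
    at-0 l∈ {suc p} (s≤s ())
later-pieces-avoid M b@(_ ∷ _ ∷ _) m with find (∈-concatMap⁻ later-cut {xs = splits (toList b)} m)
... | (u , r , v) , s∈ , m′ = later-cut-avoids {b} {u} (splits-sound s∈) (s≤s z≤n) m′

module Negative (N M : ℕ) where
  open Gapped N

  Models : Valuation → Block → List Segment → Set
  Models V b t = At V 0 b × Tail V (lastIndex b) t

  negatives : List Segment → List Word
  negatives []            = []
  negatives ((g , b) ∷ t) = map (foldr _⊕_ (spread t)) (later-pieces M b) ++ map (word b ⊕_) (negatives t)

  negatives₀ : Block → List Segment → List Word
  negatives₀ b t = map (foldr _⊕_ (spread t)) (first-pieces b) ++ map (word b ⊕_) (negatives t)

  negatives-unsat : ∀ t → OKs t → All Short t → ∀ {w} → w ∈ negatives t → ¬ Some (val w) t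
  negatives-unsat ((g , b) ∷ t) ok@(good , n3 , _ , ok′) sh@((_ , b<) ∷ sh′) m s
    with ∈-++⁻ (map (foldr _⊕_ (spread t)) (later-pieces M b)) m
  ... | inj₁ m′ with ∈-map⁻ (foldr _⊕_ (spread t)) m′
  ...   | us , us∈ , refl = avoid-pieces ok sh us (later-pieces-avoid M b us∈) s
  negatives-unsat ((g , b) ∷ t) ok@(good , n3 , _ , ok′) sh@((_ , b<) ∷ sh′) m s | inj₂ m′
    with ∈-map⁻ (word b ⊕_) m′
  ...   | w , w∈ , refl = negatives-unsat t ok′ sh′ w∈ (forward {b} {t} {w} (weak {b} {t} good n3 ok′) b< sh′ (Some⇒From {g = g} {b} {t} good s))

  negatives₀-unsat : ∀ b t → OK b t → lastIndex b < N → All Short t → ∀ {w} → w ∈ negatives₀ b t → ¬ Models (val w) b t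
  negatives₀-unsat b t ok@(n , n3 , ok′) b< sh m (a , ts)
    with ∈-++⁻ (map (foldr _⊕_ (spread t)) (first-pieces b)) m
  ... | inj₂ m′ with ∈-map⁻ (word b ⊕_) m′
  ...   | w , w∈ , refl = negatives-unsat t ok′ sh w∈ (forward {b} {t} {w} ok b< sh (0 , inj₁ refl , a , ts))
  negatives₀-unsat b t ok@(n , n3 , ok′) b< sh m (a , ts) | inj₁ m′ with ∈-map⁻ (foldr _⊕_ (spread t)) m′
  ...   | us , us∈ , refl with find (∈-concatMap⁻ first-cut {xs = splits (toList b)} us∈)
  ...     | (u , r , v) , s∈ , us∈′ with first-cut-avoids {b} {u} (splits-sound s∈) us∈′
  ...       | w , ws , refl , w> , avoids = avoid-start {b} {w} {foldr _⊕_ (spread t) ws} n b< w> avoids a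

-- Queries that satisfy the word of a normal form but no negative example

agree-except : ∀ U {x l : Letter} {Y q} → q ≢ length U → (U ++ x ∷ Y) ! q ≡ (U ++ l ∷ Y) ! q
agree-except []      {q = zero}  n = contradiction refl n
agree-except []      {q = suc q} n = refl
agree-except (y ∷ U) {q = zero}  n = refl
agree-except (y ∷ U) {q = suc q} n = agree-except U (n ∘ cong suc)

letter-after : ∀ U {l : Letter} {Y} → (U ++ l ∷ Y) ! length U ≡ l
letter-after []      = refl
letter-after (x ∷ U) = letter-after U

Row-replace : ∀ U {x l : Letter} {Y} cu {s cv} → length cu ≡ length U → l ⊩ᴸ s →
              Row (val (U ++ x ∷ Y)) 0 (cu ++ s ∷ cv) → Row (val (U ++ l ∷ Y)) 0 (cu ++ s ∷ cv)
Row-replace U {x} {l} {Y} cu {s} {cv} eq ls a =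
  let a₁ , _ , a₂ = Row-++⁻ cu a in
  Row-++⁺ cu
    (Row-map cu (λ {j} j< r → subst (_⊩ᴸ r) (agree-except U λ e → contradiction (trans e (sym eq)) (<⇒≢ j<))) a₁)
    (subst (λ p → val (U ++ l ∷ Y) p s) (sym eq) (subst (_⊩ᴸ s) (sym (letter-after U)) ls) ,
     Row-map cv (λ {j} _ r → subst (_⊩ᴸ r) (agree-except U λ e →
       contradiction (trans eq (sym e)) (<⇒≢ (s≤s (m≤m+n (length cu) j))))) a₂)

At-prefix : ∀ P {X Y p} b → p + lastIndex b < length P → At (val (P ++ X)) p b → At (val (P ++ Y)) p b
At-prefix P {X} {Y} {p} b p< = Row-map (toList b) λ {j} j< r →
  let q< = ≤-trans (s≤s (+-monoʳ-≤ p (s≤s⁻¹ j<))) p< in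
  subst (_⊩ᴸ r) (trans (!-++ˡ P {X} q<) (sym (!-++ˡ P {Y} q<)))

split-at : ∀ {A : Set} (xs : List A) {e} → e < length xs → ∃[ u ] ∃[ x ] ∃[ v ] xs ≡ u ++ x ∷ v × length u ≡ e
split-at (x ∷ xs) {zero}  _        = [] , x , xs , refl , refl
split-at (x ∷ xs) {suc e} (s≤s e<) = let u , y , v , eq , l = split-at xs e< in x ∷ u , y , v , cong (x ∷_) eq , cong suc l

lst-split : ∀ b {u r} → toList b ≡ u ++ r ∷ [] → lst b ≡ r
lst-split (x ∷ xs) {u} = go x xs u
  where
  go : ∀ x xs u {r} → x ∷ xs ≡ u ++ r ∷ [] → end x xs ≡ r
  go x []       []          refl = refl
  go x (y ∷ ys) (_ ∷ u)     e    = go y ys u (List.∷-injectiveʳ e)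
  go x []       (_ ∷ [])    ()
  go x []       (_ ∷ _ ∷ _) ()

no-suffix : ∀ {b : Block} {u r v} → toList b ≡ u ++ r ∷ v → length u ≡ lastIndex b → v ≡ []
no-suffix {b} {u} {r} {[]}    e l = refl
no-suffix {b} {u} {r} {_ ∷ v} e l = contradiction (trans l (split-length {b} {u} e)) (<⇒≢ (m<m+n (length u) (s≤s z≤n)))

N3-weaken : ∀ {x y} t → y ⊨ᴱ x → N3 y t → N3 x t
N3-weaken []                               e n = tt
N3-weaken {x} {y} ((zero , r ∷ []) ∷ _)    e n = n ∘ ⊨ᴱ-trans {y} {x} {r} e
N3-weaken ((zero , r ∷ s ∷ rs) ∷ _)        e n = tt
N3-weaken ((suc g , b) ∷ _)                e n = tt

-- Only a block related by ≤ can start at the last point of its predecessor.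
run : List Segment → ℕ
run []                = 0
run ((zero , _) ∷ t)  = suc (run t)
run ((suc _ , _) ∷ _) = 0

-- With this bound, each label of a sequence related by ≤ can be given a frontier copy of its own.
Bounded : ℕ → List Segment → Set
Bounded M []      = ⊤
Bounded M (_ ∷ t) = suc (run t) ≤ M × Bounded M t

infix 4 _≈_

_≈_ : Block → Block → Set
c ≈ b = Pointwise _≣ᴱ_ (toList c) (toList b)

Matches : List Segment → List Segment → Set
Matches = Pointwise λ (_ , c) (_ , b) → c ≈ b

≈-At : ∀ {c b} → c ≈ b → At (val (trees (toList b))) 0 c
≈-At {c} {b} e = go [] e
  where
  go : ∀ u {cs bs} → Pointwise _≣ᴱ_ cs bs → Row (val (trees u ++ trees bs)) (length u) cs
  go u []       = tt
  go u {s ∷ cs} {r ∷ bs} ((_ , rs) ∷ es) =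
    subst (_⊩ᴸ s) (sym (letter-at u)) (tree⁺ {r} {s} rs) ,
    subst₂ (λ w p → Row (val w) p cs)
      (trans (cong (_++ trees bs) (map-++ tree u (r ∷ []))) (++-assoc (trees u) (tree r ∷ []) (trees bs)))
      (trans (length-++ u) (+-comm (length u) 1)) (go (u ++ r ∷ []) es)

≈-last : ∀ {c b} → c ≈ b → lastIndex c ≡ lastIndex b
≈-last {c} {b} e = suc-injective (Pointwise.Pointwise-length e)

-- A candidate block that starts where the given block starts

module Analysis (N M : ℕ) where
  open Gapped N
  open Negative N M

  word-split : ∀ {b : Block} {u r v} w → toList b ≡ u ++ r ∷ v →
               word b ⊕ w ≡ trees u ++ ((tree r ∷ trees v) ⊕ w)
  word-split {b} {u} {r} {v} w e =
    trans (cong (λ rs → trees rs ⊕ w) e)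
      (trans (cong (_⊕ w) (map-++ tree u (r ∷ v))) (++-assoc (trees u) (tree r ∷ trees v) _))

  snoc-assoc : ∀ (U : Word) {l X} → (U ++ l ∷ []) ++ X ≡ U ++ l ∷ X
  snoc-assoc U {l} {X} = ++-assoc U (l ∷ []) X

  restart : ∀ {b : Block} {u r v} w t → toList b ≡ u ++ r ∷ v →
            Tail (val (word b ⊕ w)) (length u) t → Tail (val ((tree r ∷ trees v) ⊕ w)) 0 t
  restart {b} {u} {r} {v} w t e ts = Tail-shift⁻ {k = length (trees u)}
    (λ p s → subst (_⊩ᴸ s) (!-++ʳ (trees u) p)) t
    (subst₂ (λ w p → Tail (val w) p t) (word-split {b} {u} w e)
      (trans (sym (length-trees u)) (sym (+-identityʳ _))) ts)

  module _ {b c : Block} {t : List Segment} {w : Word}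
           (a : At (val (word b ⊕ w)) 0 c) (ts : Tail (val (word b ⊕ w)) (lastIndex c) t)
           (k≤ : lastIndex c ≤ lastIndex b) (n3 : N3 (lst c) t) (ok : OKs t) (sh : All Short t)
           (not-doubled : ∀ {u r v} → toList b ≡ u ++ r ∷ v → v ≢ [] → length u ≡ lastIndex c →
              ¬ Models (val ((trees u ++ tree r ∷ []) ⊕ ((tree r ∷ trees v) ⊕ w))) c t)
           (not-broken : ∀ {u r l} → toList b ≡ u ++ r ∷ [] → l ∈ frontier r →
              ¬ Models (val ((trees u ++ l ∷ []) ⊕ ((tree r ∷ []) ⊕ w))) c t)
           (not-weakened : ∀ {u r v l} → toList b ≡ u ++ r ∷ v → l ∈ frontier r →
              ¬ Models (val ((trees u ++ l ∷ trees v) ⊕ w)) c t) where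

    -- If `c` ended earlier, at a point `r`, it would fit into the first piece of the doubled word,
    -- and the rest could restart at the second copy of `r`.
    full : lastIndex c ≡ lastIndex b
    full with m≤n⇒m<n∨m≡n k≤
    ... | inj₂ e = e
    ... | inj₁ k< with split-at (toList b) (s≤s k≤)
    ...   | u , r , v , e , l = ⊥-elim (not-doubled e (λ { refl → <⇒≢ k< (trans (sym l)
              (trans (sym (+-identityʳ _)) (sym (split-length {b} {u} e)))) }) l
              ( At-prefix (trees u ++ tree r ∷ []) c P>
                  (subst (λ w → At (val w) 0 c) (trans (word-split {b} {u} w e) (sym (snoc-assoc (trees u)))) a)
              , leap (trees u ++ tree r ∷ []) t P> sh
                  (Tail⇒Some t (restart {b} {u} w t e (subst (λ p → Tail _ p t) (sym l) ts)))))
      where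
      P> : lastIndex c < length (trees u ++ tree r ∷ [])
      P> = ≤-reflexive (trans (cong suc (sym l)) (sym (length-snoc u)))

    private
      k< : lastIndex b < length (toList b)
      k< = ≤-refl

    -- The last label is compared first: only then does (n3), known for the last label of `c`, carry
    -- over to that of `b` and show that `t` continues in `w`, as the comparison of the other labels
    -- requires.
    last-label : lst c ⊨ᴱ lst b × Tail (val (word b ⊕ w)) (lastIndex b) t
    last-label with split-at (toList b) k< | split-at (toList c) {lastIndex c} ≤-refl
    ... | u , r , v , e , l | cu , s , cv , e′ , l′
      with no-suffix {b} {u} e l | no-suffix {c} {cu} e′ l′ | ⊨ᴱ? s r
    ...   | refl | refl | yes sr = subst₂ _⊨ᴱ_ (sym (lst-split c e′)) (sym (lst-split b e)) sr ,
                                   subst (λ p → Tail _ p t) full ts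
    ...   | refl | refl | no n =
      let x , x∈ , xs = frontier-complete {r} {s} (tree⁻ {r} {s} rs) n in
      ⊥-elim (not-broken e x∈
        ( At-prefix (trees u ++ x ∷ []) c (P> x)
            (subst (λ w → At (val w) 0 c) (sym (snoc-assoc (trees u)))
              (subst (Row (val (trees u ++ x ∷ _)) 0) (sym e′)
                (Row-replace (trees u) cu (trans l′ (trans full (trans (sym l) (sym (length-trees u))))) xs
                  (subst (Row _ 0) e′ a′))))
        , leap (trees u ++ x ∷ []) t (P> x) sh
            (Tail⇒Some t (restart {b} {u} w t e (subst (λ p → Tail _ p t) (trans full (sym l)) ts)))))
      where
      P> : ∀ x → lastIndex c < length (trees u ++ x ∷ [])
      P> x = ≤-reflexive (trans (cong suc (trans full (sym l))) (sym (length-snoc u)))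
      a′ : At (val (trees u ++ ((tree r ∷ []) ⊕ w))) 0 c
      a′ = subst (λ w → At (val w) 0 c) (word-split {b} {u} w e) a
      rs : tree r ⊩ᴸ s
      rs = subst (_⊩ᴸ s) (trans (cong ((trees u ++ ((tree r ∷ []) ⊕ w)) !_)
             (trans l′ (trans full (sym l)))) (letter-at u)) (At-label {b = c} {cu} e′ a′)

    covered : c ≈ b × Some (val w) t
    covered = labels [] [] refl refl refl (cong suc full) , rest
      where
      rest : Some (val w) t
      rest = leave (word b) t (sym (length-word b)) ok sh
        (subst (λ l → N3ᴸ l t) (sym (word-lst b))
          (N3⇒N3ᴸ t (N3-weaken {lst b} {lst c} t (proj₁ last-label) n3))) (proj₂ last-label)
      labels : ∀ u cu {rs cs} → toList b ≡ u ++ rs → toList c ≡ cu ++ cs → length cu ≡ length u →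
               length cs ≡ length rs → Pointwise _≣ᴱ_ cs rs
      labels u cu {[]}     {[]}     e e′ l l′ = []
      labels u cu {r ∷ rs} {s ∷ cs} e e′ l l′ =
        (sr , tree⁻ {r} {s} rs′) ∷
        labels (u ++ r ∷ []) (cu ++ s ∷ []) (trans e (sym (++-assoc u (r ∷ []) rs))) (trans e′ (sym (++-assoc cu (s ∷ []) cs)))
          (trans (length-++ cu) (trans (cong (_+ 1) l) (sym (length-++ u)))) (suc-injective l′)
        where
        a′ : At (val (trees u ++ ((tree r ∷ trees rs) ⊕ w))) 0 c
        a′ = subst (λ w → At (val w) 0 c) (word-split {b} {u} w e) a
        rs′ : tree r ⊩ᴸ s
        rs′ = subst (_⊩ᴸ s) (trans (cong ((trees u ++ ((tree r ∷ trees rs) ⊕ w)) !_) l) (letter-at u))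
                (At-label {b = c} {cu} e′ a′)
        sr : s ⊨ᴱ r
        sr with ⊨ᴱ? s r
        ... | yes p = p
        ... | no n = let x , x∈ , xs = frontier-complete {r} {s} (tree⁻ {r} {s} rs′) n in
          ⊥-elim (not-weakened {u} {r} {rs} {x} e x∈
            ( subst (λ w → At (val w) 0 c) (sym (++-assoc (trees u) (x ∷ trees rs) _))
                (subst (Row (val (trees u ++ x ∷ (trees rs ++ _))) 0) (sym e′)
                  (Row-replace (trees u) cu (trans l (sym (length-trees u))) xs (subst (Row _ 0) e′ a′)))
            , leap (trees u ++ x ∷ trees rs) t
                (≤-reflexive (trans (cong suc full) (sym (trans (length-++ (trees u))
                  (trans (cong₂ (λ m n → m + suc n) (length-trees u) (length-trees rs))
                    (trans (sym (length-++ u)) (cong length (sym e)))))))) sh rest ))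

split∈ : ∀ {xs u v : List ELI} {r} → xs ≡ u ++ r ∷ v → (u , r , v) ∈ splits xs
split∈ {u = u} refl = splits-complete u

weakened∈ : ∀ u {r v l} → l ∈ frontier r → ((trees u ++ l ∷ trees v) ∷ []) ∈ weakened (u , r , v)
weakened∈ u {v = v} m = ∈-map⁺ (λ l → (trees u ++ l ∷ trees v) ∷ []) m

broken∈ : ∀ u {r v l} → l ∈ frontier r → ((trees u ++ l ∷ []) ∷ (tree r ∷ trees v) ∷ []) ∈ broken (u , r , v)
broken∈ u {r} {v} m = ∈-map⁺ (λ l → (trees u ++ l ∷ []) ∷ (tree r ∷ trees v) ∷ []) m

doubled∈ : ∀ u {r v} → v ≢ [] → ((trees u ++ tree r ∷ []) ∷ (tree r ∷ trees v) ∷ []) ∈ doubled (u , r , v)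
doubled∈ u {v = []}    n = contradiction refl n
doubled∈ u {v = _ ∷ _} n = here refl

weakened⊆first : ∀ s {us} → us ∈ weakened s → us ∈ first-cut s
weakened⊆first s m = ∈-++⁺ˡ m

broken⊆first : ∀ s {us} → us ∈ broken s → us ∈ first-cut s
broken⊆first s m = ∈-++⁺ʳ (weakened s) (∈-++⁺ˡ m)

doubled⊆first : ∀ s {us} → us ∈ doubled s → us ∈ first-cut s
doubled⊆first s m = ∈-++⁺ʳ (weakened s) (∈-++⁺ʳ (broken s) m)

first⊆later : ∀ {u r v us} → 0 < length u → us ∈ first-cut (u , r , v) → us ∈ later-cut (u , r , v)
first⊆later {_ ∷ _} _ m = m

weakened⊆later : ∀ u {r v us} → us ∈ weakened (u , r , v) → us ∈ later-cut (u , r , v)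
weakened⊆later []      m = ∈-++⁺ˡ m
weakened⊆later (x ∷ u) {r} {v} m = weakened⊆first (x ∷ u , r , v) m

-- Matching all blocks of a candidate

module Shape (N M : ℕ) where
  open Gapped N
  open Negative N M
  open Analysis N M

  skips : ∀ us {w} t → Some (val w) t → Some (val (foldr _⊕_ w us)) t
  skips []       t s = s
  skips (u ∷ us) t s = skip u t (skips us t s)

  first-block : ∀ b c t w → OK c t → lastIndex c < N → All Short t → Models (val (word b ⊕ w)) c t →
                (∀ {us} → us ∈ first-pieces b → ¬ Models (val (foldr _⊕_ w us)) c t) → c ≈ b × Some (val w) t
  first-block b c t w (n , n3 , ok) c< sh (a , ts) avoid =
    covered {b} {c} {t} {w} a ts
      (s≤s⁻¹ (≤-trans (stays (word b) c (s≤s z≤n) n c< a) (≤-reflexive (length-word b)))) n3 ok sh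
      (λ {u} {r} {v} e v≢ _ → avoid (∈cut e (doubled⊆first (u , r , v) (doubled∈ u v≢))))
      (λ {u} {r} e l∈ → avoid (∈cut e (broken⊆first (u , r , []) (broken∈ u l∈))))
      (λ {u} {r} {v} e l∈ → avoid (∈cut e (weakened⊆first (u , r , v) (weakened∈ u l∈))))
    where
    ∈cut : ∀ {u r v us} → toList b ≡ u ++ r ∷ v → us ∈ first-cut (u , r , v) → us ∈ first-pieces b
    ∈cut e m = ∈-concatMap⁺ first-cut (lose (split∈ e) m)

  -- Either a single frontier letter serves all properly weaker labels, or there are enough copies
  -- for all labels of the run.
  Tame : ℕ → Block → List Segment → Set
  Tame m b t = (∀ {r} → b ≡ r ∷ [] → Homogeneous r) × 1 ≤ m ⊎ run t < m

  -- A run of primitive blocks related by ≤, all satisfied at the only point of a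
  -- primitive block r, none of them as strong as r.

  module Runs (r : ELI) (w w′ : Word) (later : ∀ t → Some (val w) t → Some (val w′) t) where

    only-point : ∀ {g c t} → OKs ((g , c) ∷ t) → All Short ((g , c) ∷ t) →
                 Tail (val ((tree r ∷ []) ⊕ w)) 0 ((g , c) ∷ t) →
                 Some (val w) ((g , c) ∷ t) ⊎
                 ∃[ s ] c ≡ s ∷ [] × g ≡ 0 × r ⊨ᴱ s × Tail (val ((tree r ∷ []) ⊕ w)) 0 t
    only-point {g} {c} {t} (good , _) ((_ , c<) ∷ _) (q , g≤ , a , ts)
      with locate (tree r ∷ []) {w} c (inj₂ (proj₁ good)) (λ _ → proj₂ good) c< a
    ... | right {q} a′ = inj₁ (q , a′ , Tail-right-+ (tree r ∷ []) w q _ t ts)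
    only-point {g} {s ∷ []} {t} ok sh (zero , g≤ , a , ts) | left q< (v , _) =
      inj₂ (s , refl , n≤0⇒n≡0 g≤ , tree⁻ {r} {s} v , ts)
    only-point {g} {_ ∷ _ ∷ _} ok sh (zero , g≤ , a , ts) | left (s≤s ()) _
    only-point ok sh (suc q , g≤ , a , ts) | left (s≤s ()) _

    -- As `r` entails `x`, a label entailing `r` would entail `x`, against (n4). Thus every label of
    -- the run holds in some frontier element.
    still-weaker : ∀ {s x t} → N4 (x ∷ []) ((0 , s ∷ []) ∷ t) → r ⊨ᴱ x → ¬ (s ⊨ᴱ r)
    still-weaker {s} {x} n4 rx sr = n4 (⊨ᴱ-trans {s} {r} {x} sr rx)

    one-letter : ∀ {l} → Homogeneous r → l ∈ frontier r → ∀ x t → r ⊨ᴱ x → N4 (x ∷ []) t → OKs t → All Short t →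
                 Tail (val ((tree r ∷ []) ⊕ w)) 0 t → Tail (val ((l ∷ []) ⊕ w′)) 0 t
    one-letter h l∈ x []            rx n4 ok sh ts = tt
    one-letter {l} h l∈ x ((g , c) ∷ t) rx n4 ok sh ts with only-point ok sh ts
    ... | inj₁ s = leap (l ∷ []) ((g , c) ∷ t) (s≤s z≤n) sh (later ((g , c) ∷ t) s)
    one-letter {l} h l∈ x (_ ∷ t) rx n4 (_ , _ , n4′ , ok) (_ ∷ sh) ts | inj₂ (s , refl , refl , rs , ts′) =
      let l′ , l′∈ , l′s = frontier-complete {r} {s} rs (still-weaker {s} {x} {t} n4 rx) in
      0 , z≤n , (subst (_⊩ᴸ s) (h l′∈ l∈) l′s , tt) , one-letter h l∈ s t rs n4′ ok sh ts′

  place : ∀ {r l w′ g x t} → l ∈ frontier r → l ⊩ᴸ x → All Short t → Some (val w′) t →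
          Some (val (foldr _⊕_ w′ (singletons r))) ((g , x ∷ []) ∷ t)
  place {r} {l} {w′} {g} {x} {t} m lx sh s = go (frontier r) m
    where
    go : ∀ ls → l ∈ ls → Some (val (foldr _⊕_ w′ (map (_∷ []) ls))) ((g , x ∷ []) ∷ t)
    go (l′ ∷ ls) (here refl) =
      extend (l′ ∷ []) {g = g} (x ∷ []) t (s≤s z≤n) (lx , tt) sh (skips (map (_∷ []) ls) t s)
    go (l′ ∷ ls) (there m)   = skip (l′ ∷ []) ((g , x ∷ []) ∷ t) (go ls m)

  repeated : ∀ m r w → Word
  repeated m r w = foldr _⊕_ w (concat (replicate m (singletons r)))

  repeated-suc : ∀ m r w → repeated (suc m) r w ≡ foldr _⊕_ (repeated m r w) (singletons r)
  repeated-suc m r w = List.foldr-++ _⊕_ w (singletons r) _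

  -- The labels of the run are placed one by one, each in the next copy of the frontier, until a
  -- block lies in `w`.
  run-in-copies : ∀ m r w {g} x t → run t < m → r ⊨ᴱ x → ¬ (x ⊨ᴱ r) → N4 (x ∷ []) t → OKs t → All Short t →
                  Tail (val ((tree r ∷ []) ⊕ w)) 0 t → Some (val (repeated m r w)) ((g , x ∷ []) ∷ t)
  run-in-copies (suc m) r w {g} x t (s≤s m≤) rx xr n4 ok sh ts =
    subst (λ w → Some (val w) ((g , x ∷ []) ∷ t)) (sym (repeated-suc m r w))
      (let l , l∈ , lx = frontier-complete {r} {x} rx xr in place {r} {g = g} {x = x} l∈ lx sh (rest t m≤ n4 ok sh ts))
    where
    open Runs r w (repeated m r w) (skips (concat (replicate m (singletons r))))
    rest : ∀ t → run t ≤ m → N4 (x ∷ []) t → OKs t → All Short t → Tail (val ((tree r ∷ []) ⊕ w)) 0 t →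
           Some (val (repeated m r w)) t
    rest []            m≤ n4 ok sh ts = tt
    rest ((g , c) ∷ t) m≤ n4 ok sh ts with only-point ok sh ts
    ... | inj₁ s = skips (concat (replicate m (singletons r))) ((g , c) ∷ t) s
    rest (_ ∷ t) m≤ n4 (_ , _ , n4′ , ok) (_ ∷ sh) ts | inj₂ (s , refl , refl , rs , ts′) =
      run-in-copies m r w {0} s t m≤ rs (still-weaker {s} {x} {t} n4 rx) n4′ ok sh ts′

  run-in-one : ∀ m r w {g} x t → Homogeneous r → 1 ≤ m → r ⊨ᴱ x → ¬ (x ⊨ᴱ r) → N4 (x ∷ []) t → OKs t → All Short t →
               Tail (val ((tree r ∷ []) ⊕ w)) 0 t → Some (val (repeated m r w)) ((g , x ∷ []) ∷ t)
  run-in-one (suc m) r w {g} x t h (s≤s _) rx xr n4 ok sh ts =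
    subst (λ w → Some (val w) ((g , x ∷ []) ∷ t)) (sym (repeated-suc m r w)) (go (frontier r) (λ k → k) l∈)
    where
    choice = frontier-complete {r} {x} rx xr
    l  = proj₁ choice
    l∈ = proj₁ (proj₂ choice)
    lx = proj₂ (proj₂ choice)
    w′  = repeated m r w
    go : ∀ ls → (∀ {l} → l ∈ ls → l ∈ frontier r) → l ∈ ls →
         Some (val (foldr _⊕_ w′ (map (_∷ []) ls))) ((g , x ∷ []) ∷ t)
    go (l′ ∷ ls) sub (there k)  = skip (l′ ∷ []) ((g , x ∷ []) ∷ t) (go ls (sub ∘ there) k)
    go (_ ∷ ls) sub (here refl) = 0 , (lx , tt) , one-letter h l∈ x t rx n4 ok sh ts
      where open Runs r w (foldr _⊕_ w′ (map (_∷ []) ls))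
                   (λ t → skips (map (_∷ []) ls) t ∘ skips (concat (replicate m (singletons r))) t)

  -- Primitive blocks at the first point stay there. A later start allows a leap to `v`. A longer
  -- block at the first point cannot have a first label entailing `r`, by (n4), so this label holds
  -- in a frontier letter `l` put before `v`.
  run-at-start : ∀ r v w x t → r ⊨ᴱ x → N4 (x ∷ []) t → OKs t → All Short t →
                 Tail (val ((tree r ∷ v) ⊕ w)) 0 t →
                 Tail (val ((tree r ∷ []) ⊕ (v ⊕ w))) 0 t ⊎
                 ∃[ l ] l ∈ frontier r × Tail (val ((tree r ∷ []) ⊕ ((l ∷ v) ⊕ w))) 0 t
  run-at-start r v w x []            rx n4 ok sh ts = inj₁ tt
  run-at-start r v w x ((g , c) ∷ t) rx n4 ok sh (suc q , leq , a , ts) =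
    inj₁ (leap (tree r ∷ []) ((g , c) ∷ t) (s≤s z≤n) sh
      (q , Row-map (toList c) (λ _ _ z → z) a , Tail-shift⁻ {k = 1} (λ _ _ z → z) t ts))
  run-at-start r v w x ((zero , y ∷ []) ∷ t) rx n4 (_ , _ , n4′ , ok) (_ ∷ sh) (zero , leq , (ry , _) , ts)
    with run-at-start r v w y t (tree⁻ {r} {y} ry) n4′ ok sh ts
  ... | inj₁ ts′            = inj₁ (0 , z≤n , (ry , tt) , ts′)
  ... | inj₂ (l , l∈ , ts′) = inj₂ (l , l∈ , 0 , z≤n , (ry , tt) , ts′)
  run-at-start r v w x ((zero , c@(y ∷ z ∷ zs)) ∷ t) rx n4 ok sh (zero , leq , (ry , a) , ts) with ⊨ᴱ? y r
  ... | yes yr = contradiction (⊨ᴱ-trans {y} {r} {x} yr rx) n4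
  ... | no n   = let l , l∈ , ly = frontier-complete {r} {y} (tree⁻ {r} {y} ry) n in
    inj₂ (l , l∈ , leap (tree r ∷ []) ((0 , c) ∷ t) (s≤s z≤n) sh
      (0 , (ly , Row-map (z ∷ zs) (λ _ _ u → u) a) ,
       Tail-from t (λ { {zero} () ; {suc q} _ _ u → u }) ts))

  -- `c` starts where `b` does, since otherwise the word without the first point of `b` satisfies
  -- the candidate. If both are primitive, the frontier copies decide; a primitive `c` on a longer
  -- `b` is left to `beheaded`, and longer blocks are compared as the first ones.
  later-block : ∀ b g c t w → OKs ((g , c) ∷ t) → All Short ((g , c) ∷ t) → Tame M b t →
                Some (val (word b ⊕ w)) ((g , c) ∷ t) →
                (∀ {us} → us ∈ later-pieces M b → ¬ Some (val (foldr _⊕_ w us)) ((g , c) ∷ t)) →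
                c ≈ b × Some (val w) t
  later-block b g c t w ok@(good , n3 , n4 , ok′) sh@((_ , c<) ∷ sh′) tame (p , a , ts) avoid
    with locate (word b) {w} c (inj₂ (proj₁ good)) (λ _ → proj₂ good) c< a
  ... | right {q} a′ = ⊥-elim (never b avoid)
    where
    s : Some (val w) ((g , c) ∷ t)
    s = q , a′ , Tail-right-+ (word b) w q _ t ts
    never : ∀ b → (∀ {us} → us ∈ later-pieces M b → ¬ Some (val (foldr _⊕_ w us)) ((g , c) ∷ t)) → ⊥
    never (r ∷ [])     avoid = avoid (here refl) s
    never (r ∷ r′ ∷ v) avoid = avoid
      (∈-concatMap⁺ later-cut {xs = splits (r ∷ r′ ∷ v)} (here (∈-++⁺ʳ (weakened ([] , r , r′ ∷ v)) (here refl))))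
      (skip (trees (r′ ∷ v)) ((g , c) ∷ t) s)
  later-block (r ∷ []) g (x ∷ []) t w ok@(good , n3 , n4 , ok′) (_ ∷ sh′) tame (zero , a , ts) avoid | left p< (v , _)
    with ⊨ᴱ? x r
  ... | yes xr = (xr , rx) ∷ [] , leave (tree r ∷ []) t refl ok′ sh′ (N3⇒N3ᴸ t (N3-weaken {r} {x} t xr n3)) ts
    where rx = tree⁻ {r} {x} v
  ... | no xr = ⊥-elim (avoid (there (here refl)) (case tame of λ
      { (inj₁ (h , 1≤M)) → run-in-one M r w {g} x t (h refl) 1≤M rx xr n4 ok′ sh′ ts
      ; (inj₂ m)         → run-in-copies M r w {g} x t m rx xr n4 ok′ sh′ ts }))
    where rx = tree⁻ {r} {x} v
  later-block (r ∷ []) g (_ ∷ _ ∷ _) t w ok sh tame (zero , a , ts) avoid | left (s≤s ()) _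
  later-block (r ∷ []) g c t w ok sh tame (suc p , a , ts) avoid | left (s≤s ()) _
  later-block b@(r ∷ v@(_ ∷ _)) g c t w ok sh tame (suc p , a , ts) avoid | left p< a′ =
    ⊥-elim (avoid
      (∈-concatMap⁺ later-cut {xs = splits (toList b)} (here (∈-++⁺ʳ (weakened ([] , r , v)) (here refl))))
      (p , Row-map (toList c) (λ _ _ z → z) a , Tail-shift⁻ {k = 1} (λ _ _ z → z) t ts))
  later-block b@(r ∷ v@(_ ∷ _)) g (x ∷ []) t w (good , n3 , n4 , ok′) (_ ∷ sh′) tame (zero , (rx , _) , ts) avoid | left p< _
    with run-at-start r (trees v) w x t (tree⁻ {r} {x} rx) n4 ok′ sh′ ts
  ... | inj₁ ts′ = ⊥-elim (avoid
      (∈-concatMap⁺ later-cut {xs = splits (toList b)} (here (∈-++⁺ʳ (weakened ([] , r , v)) (there (here refl)))))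
      (0 , (rx , tt) , ts′))
  ... | inj₂ (l , l∈ , ts′) = ⊥-elim (avoid
      (∈-concatMap⁺ later-cut {xs = splits (toList b)} (here (∈-++⁺ʳ (weakened ([] , r , v))
        (there (there (∈-map⁺ (λ l → (tree r ∷ []) ∷ (l ∷ trees v) ∷ []) l∈))))))
      (0 , (rx , tt) , ts′))
  later-block b@(r ∷ v@(_ ∷ _)) g c@(_ ∷ _ ∷ _) t w (good , n3 , n4 , ok′) (_ ∷ sh′) tame (zero , a , ts) avoid | left p< _ =
    covered {b} {c} {t} {w} a ts (s≤s⁻¹ (≤-trans p< (≤-reflexive (length-word b)))) n3 ok′ sh′
      (λ {u} {r} {v} e v≢ l → avoid′ (∈cut e
        (first⊆later {u} (≤-trans (s≤s z≤n) (≤-reflexive (sym l))) (doubled⊆first (u , r , v) (doubled∈ u v≢)))))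
      (λ {u} {r} e l∈ → avoid′ (∈cut e
        (first⊆later {u} (positive u e) (broken⊆first (u , r , []) (broken∈ u l∈)))))
      (λ {u} {r} {v} e l∈ → avoid′ (∈cut e (weakened⊆later u (weakened∈ u l∈))))
    where
    avoid′ : ∀ {us} → us ∈ later-pieces M b → ¬ Models (val (foldr _⊕_ w us)) c t
    avoid′ m (a , ts) = avoid m (0 , a , ts)
    ∈cut : ∀ {u r v us} → toList b ≡ u ++ r ∷ v → us ∈ later-cut (u , r , v) → us ∈ later-pieces M b
    ∈cut e m = ∈-concatMap⁺ later-cut (lose (split∈ e) m)
    positive : ∀ u {r} → toList b ≡ u ++ r ∷ [] → 0 < length u
    positive (_ ∷ _) e = s≤s z≤n

  ≈-extend : ∀ {g b c t w} → c ≈ b → All Short t → Some (val w) t → Some (val (word b ⊕ w)) ((g , c) ∷ t)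
  ≈-extend {g} {b} {c} {t} e sh s =
    extend (word b) {g = g} c t (≤-trans (s≤s (≤-reflexive (≈-last {c} {b} e))) (≤-reflexive (sym (length-word b)))) (≈-At {c} {b} e) sh s

  Tames : List Segment → List Segment → Set
  Tames S ts = All (λ (_ , b) → ∀ {r} → b ≡ r ∷ [] → Homogeneous r) S × 1 ≤ M ⊎ Bounded M ts

  later-blocks : ∀ S ts → OKs ts → All Short ts → Tames S ts → Some (val (spread S)) ts →
                 (∀ {w} → w ∈ negatives S → ¬ Some (val w) ts) → Matches ts S
  later-blocks []            []            ok sh tame s avoid = []
  later-blocks []            ((g , c) ∷ t) (good , _) sh tame (p , a , _) avoid = contradiction (proj₁ a) (proj₁ good)
  later-blocks ((h , b) ∷ S) []            ok sh tame s avoid = ⊥-elim (never b avoid)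
    where
    never : ∀ b → (∀ {w} → w ∈ negatives ((h , b) ∷ S) → ¬ Some (val w) []) → ⊥
    never (r ∷ [])     avoid = avoid (∈-++⁺ˡ (∈-map⁺ (foldr _⊕_ (spread S)) {xs = later-pieces M (r ∷ [])} (here refl))) tt
    never (r ∷ r′ ∷ v) avoid = avoid (∈-++⁺ˡ (∈-map⁺ (foldr _⊕_ (spread S))
      (∈-concatMap⁺ later-cut {xs = splits (r ∷ r′ ∷ v)} (here (∈-++⁺ʳ (weakened ([] , r , r′ ∷ v)) (here refl)))))) tt
  later-blocks ((h , b) ∷ S) ((g , c) ∷ t) ok@(_ , _ , _ , ok′) sh@(_ ∷ sh′) tame s avoid =
    let e , s′ = later-block b g c t (spread S) ok sh (tame₁ tame) s
                   (λ m → avoid (∈-++⁺ˡ (∈-map⁺ (foldr _⊕_ (spread S)) m)))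
    in e ∷ later-blocks S t ok′ sh′ (tame₂ tame) s′ λ m s″ →
         avoid (∈-++⁺ʳ (map (foldr _⊕_ (spread S)) (later-pieces M b)) (∈-map⁺ (word b ⊕_) m)) (≈-extend {g} {b} {c} {t} e sh′ s″)
    where
    tame₁ : Tames ((h , b) ∷ S) ((g , c) ∷ t) → Tame M b t
    tame₁ (inj₁ ((f ∷ _) , m)) = inj₁ (f , m)
    tame₁ (inj₂ (m , _))       = inj₂ m
    tame₂ : Tames ((h , b) ∷ S) ((g , c) ∷ t) → Tames S t
    tame₂ (inj₁ ((_ ∷ fs) , m)) = inj₁ (fs , m)
    tame₂ (inj₂ (_ , m))        = inj₂ m

  all-blocks : ∀ b S c ts → OK c ts → lastIndex c < N → All Short ts → Tames S ts →
               Models (val (word b ⊕ spread S)) c ts →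
               (∀ {w} → w ∈ negatives₀ b S → ¬ Models (val w) c ts) → c ≈ b × Matches ts S
  all-blocks b S c ts ok@(_ , _ , oks) c< sh tame m avoid =
    let e , s = first-block b c ts (spread S) ok c< sh m (λ us∈ → avoid (∈-++⁺ˡ (∈-map⁺ (foldr _⊕_ (spread S)) us∈)))
    in e , later-blocks S ts oks sh tame s λ {w} w∈ s′ →
         avoid (∈-++⁺ʳ (map (foldr _⊕_ (spread S)) (first-pieces b)) (∈-map⁺ (word b ⊕_) w∈))
           (At-left⁺ (word b) {w} c (len e) (≈-At {c} {b} e) , leap (word b) ts (len e) sh s′)
    where
    len : c ≈ b → lastIndex c < length (word b)
    len e = ≤-trans (s≤s (≤-reflexive (≈-last {c} {b} e))) (≤-reflexive (sym (length-word b)))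

-- Examples that determine the gaps between blocks

tight-from : ℕ → ELI → List ELI → Block → Word
-- At distance 0 the two points coincide and carry both labels.
tight-from zero    r []       (r′ ∷ rs′) = tree (r ∧ᵉ r′) ∷ trees rs′
tight-from (suc g) r []       b          = tree r ∷ (replicate g [] ++ trees (toList b))
tight-from g       r (s ∷ rs) b          = tree r ∷ tight-from g s rs b

-- The last point of b and the first point of b′ are g apart.

tight : ℕ → Block → Block → Word
tight g (r ∷ rs) b′ = tight-from g r rs b′

length-tight : ∀ g b b′ → length (tight g b b′) ≡ suc (lastIndex b + g + lastIndex b′)
length-tight g (r ∷ rs) b′ = go g r rs
  where
  go : ∀ g r rs → length (tight-from g r rs b′) ≡ suc (length rs + g + lastIndex b′)
  go zero    r []       = cong suc (length-trees (List⁺.tail b′))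
  go (suc g) r []       = cong suc (trans (length-++ (replicate g []))
    (trans (cong₂ _+_ (length-replicate g) (length-trees (toList b′))) (+-suc g (lastIndex b′))))
  go zero    r (s ∷ rs) = cong suc (go zero s rs)
  go (suc g) r (s ∷ rs) = cong suc (go (suc g) s rs)

trees-Row : ∀ rs → Row (val (trees rs)) 0 rs
trees-Row []       = tt
trees-Row (r ∷ rs) = tree⁺ {r} {r} (⊨ᴱ-refl {r}) , Row-map rs (λ _ _ v → v) (trees-Row rs)

tight-first : ∀ g b b′ → At (val (tight g b b′)) 0 b
tight-first g (r ∷ rs) b′ = go g r rs b′
  where
  go : ∀ g r rs b′ → Row (val (tight-from g r rs b′)) 0 (r ∷ rs)
  go zero    r []       (r′ ∷ rs′) = tree⁺ {r ∧ᵉ r′} {r} (λ _ _ _ → proj₁) , tt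
  go (suc g) r []       b′         = tree⁺ {r} {r} (⊨ᴱ-refl {r}) , tt
  go zero    r (s ∷ rs) b′         = tree⁺ {r} {r} (⊨ᴱ-refl {r}) , Row-map (s ∷ rs) (λ _ _ v → v) (go zero s rs b′)
  go (suc g) r (s ∷ rs) b′         = tree⁺ {r} {r} (⊨ᴱ-refl {r}) , Row-map (s ∷ rs) (λ _ _ v → v) (go (suc g) s rs b′)

tight-second : ∀ g b b′ → At (val (tight g b b′)) (lastIndex b + g) b′
tight-second g (r ∷ rs) b′ = go g r rs b′
  where
  go : ∀ g r rs b′ → At (val (tight-from g r rs b′)) (length rs + g) b′
  go zero    r []       (r′ ∷ rs′) = tree⁺ {r ∧ᵉ r′} {r′} (λ _ _ _ → proj₂) , Row-map rs′ (λ _ _ v → v) (trees-Row rs′)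
  go (suc g) r []       b′         = Row-map (toList b′) (λ {j} _ s → subst (_⊩ᴸ s)
    (sym (trans (cong (λ n → (replicate g [] ++ trees (toList b′)) ! (n + j)) (sym (length-replicate g))) (!-++ʳ (replicate g []) j))))
    (trees-Row (toList b′))
  go zero    r (s ∷ rs) b′         = Row-map (toList b′) (λ _ _ v → v) (go zero s rs b′)
  go (suc g) r (s ∷ rs) b′         = Row-map (toList b′) (λ _ _ v → v) (go (suc g) s rs b′)

SameBlocks : List Segment → List Segment → Set
SameBlocks = Pointwise λ (_ , b) (_ , b′) → b ≡ b′

module Tight (N M : ℕ) where
  open Gapped N
  open Negative N M using (Models)

  spread-same : ∀ {S S′} → SameBlocks S S′ → spread S ≡ spread S′
  spread-same []         = refl
  spread-same {(_ , b) ∷ _} (refl ∷ s) = cong (word b ⊕_) (spread-same s)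

  Models-⊕ : ∀ {b t w} → All Short t → Some (val w) t → Models (val (word b ⊕ w)) b t
  Models-⊕ {b} {t} {w} sh s = At-left⁺ (word b) {w} {0} b len (word-At b) , leap (word b) t len sh s
    where
    len : lastIndex b < length (word b)
    len = ≤-reflexive (sym (length-word b))

  spread-sat : ∀ t → All Short t → Some (val (spread t)) t
  spread-sat []            _        = tt
  spread-sat ((g , b) ∷ t) (_ ∷ sh) = 0 , Models-⊕ {b} {t} {spread t} sh (spread-sat t sh)

  -- Neither block can move on to `spread t`, where the remaining blocks leave no room. Both lie in
  -- `tight g b b′`, whose length bounds their distance.
  gap-bound : ∀ {g g′ b b′ t} → OK b ((g′ , b′) ∷ t) → lastIndex b < N → All Short ((g′ , b′) ∷ t) →
              SomeFrom (val (tight g b b′ ⊕ spread t)) b ((g′ , b′) ∷ t) → g′ ≤ g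
  gap-bound {g} {g′} {b} {b′} {t} (n , _ , good , _ , n4 , ok) b< ((_ , b<′) ∷ sh) (p , st , a , p′ , leq , a′ , ts)
    with locate (tight g b b′) {spread t} b (start (tight g b b′) b
           (≤-trans (s≤s z≤n) (≤-reflexive (sym (length-tight g b b′)))) st) n b< a
  ... | right {q} a₁ =
    let q′ , _ , a₁′ , ts′ = Tail-right-+ (tight g b b′) (spread t) q (lastIndex b) ((g′ , b′) ∷ t) (p′ , leq , a′ , ts)
    in ⊥-elim (no-room t good b<′ n4 ok sh a₁′ ts′)
  ... | left p< _ with locate (tight g b b′) {spread t} b′ (inj₂ (proj₁ good)) (λ _ → proj₂ good) b<′ a′
  ...   | right {q} a₁ = ⊥-elim (no-room t good b<′ n4 ok sh a₁ (Tail-right-+ (tight g b b′) (spread t) q _ t ts))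
  ...   | left p<′ _   = +-cancelˡ-≤ (lastIndex b) _ _ (+-cancelʳ-≤ (lastIndex b′) _ _ (begin
      lastIndex b + g′ + lastIndex b′     ≤⟨ +-monoˡ-≤ (lastIndex b′) (+-monoˡ-≤ g′ (m≤n+m (lastIndex b) p)) ⟩
      p + lastIndex b + g′ + lastIndex b′ ≤⟨ +-monoˡ-≤ (lastIndex b′) leq ⟩
      p′ + lastIndex b′                   ≤⟨ s≤s⁻¹ (≤-trans p<′ (≤-reflexive (length-tight g b b′))) ⟩
      lastIndex b + g + lastIndex b′      ∎))
    where open ≤-Reasoning

  gap-realised : ∀ {g g′ b b′ t w} → g′ ≤ g → All Short t → Some (val w) t →
                 Models (val (tight g b b′ ⊕ w)) b ((g′ , b′) ∷ t)
  gap-realised {g} {g′} {b} {b′} {t} {w} leq sh s =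
    At-left⁺ (tight g b b′) {w} {0} b
      (≤-trans (s≤s (≤-trans (m≤m+n _ g) (m≤m+n _ (lastIndex b′)))) len) (tight-first g b b′) ,
    lastIndex b + g , +-monoʳ-≤ (lastIndex b) leq ,
    At-left⁺ (tight g b b′) {w} b′ len (tight-second g b b′) ,
    leap (tight g b b′) t len sh s
    where
    len : suc (lastIndex b + g + lastIndex b′) ≤ length (tight g b b′)
    len = ≤-reflexive (sym (length-tight g b b′))

  exact : Block → List Segment → List Word
  exact b []             = []
  exact b ((g , b′) ∷ t) = (tight g b b′ ⊕ spread t) ∷ map (word b ⊕_) (exact b′ t)

  -- A gap 0 cannot be shortened and contributes no word of its own.
  narrow : Block → List Segment → List Word
  narrow b []                 = []
  narrow b ((zero  , b′) ∷ t) = map (word b ⊕_) (narrow b′ t)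
  narrow b ((suc g , b′) ∷ t) = (tight g b b′ ⊕ spread t) ∷ map (word b ⊕_) (narrow b′ t)

  narrow-tail : ∀ g {b b′ t w} → w ∈ narrow b′ t → (word b ⊕ w) ∈ narrow b ((g , b′) ∷ t)
  narrow-tail zero    {b} m = ∈-map⁺ (word b ⊕_) m
  narrow-tail (suc g) {b} m = there (∈-map⁺ (word b ⊕_) m)

  exact-sat : ∀ b t → All Short t → ∀ {w} → w ∈ exact b t → Models (val w) b t
  exact-sat b ((g , b′) ∷ t) (_ ∷ sh) (here refl) = gap-realised {g} {g} {b} {b′} {t} ≤-refl sh (spread-sat t sh)
  exact-sat b ((g , b′) ∷ t) sh@(_ ∷ sh′) (there m) with ∈-map⁻ (word b ⊕_) m
  ... | w , w∈ , refl = Models-⊕ {b} {(g , b′) ∷ t} {w} sh (0 , exact-sat b′ t sh′ w∈)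

  narrow-unsat : ∀ b t → OK b t → lastIndex b < N → All Short t → ∀ {w} → w ∈ narrow b t → ¬ SomeFrom (val w) b t
  narrow-unsat b ((suc g , b′) ∷ t) ok b< sh (here refl) s =
    contradiction (gap-bound {g} {suc g} {b} {b′} {t} ok b< sh s) (<⇒≱ ≤-refl)
  narrow-unsat b ((suc g , b′) ∷ t) ok@(_ , _ , good , n3 , _ , ok′) b< sh@((_ , b<′) ∷ sh′) (there m) s
    with ∈-map⁻ (word b ⊕_) m
  ... | w , w∈ , refl = narrow-unsat b′ t (weak {b′} {t} good n3 ok′) b<′ sh′ w∈
          (Some⇒From {g = suc g} {b′} {t} good (forward {b} {_} {w} ok b< sh s))
  narrow-unsat b ((zero , b′) ∷ t) ok@(_ , _ , good , n3 , _ , ok′) b< sh@((_ , b<′) ∷ sh′) m s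
    with ∈-map⁻ (word b ⊕_) m
  ... | w , w∈ , refl = narrow-unsat b′ t (weak {b′} {t} good n3 ok′) b<′ sh′ w∈
          (Some⇒From {g = zero} {b′} {t} good (forward {b} {_} {w} ok b< sh s))

  -- `exact` bounds the gaps of the candidate from above and `narrow` from below; `forward` passes
  -- to the next gap.
  same-gaps : ∀ b S S′ → SameBlocks S′ S → OK b S′ → lastIndex b < N → All Short S′ →
              (∀ {w} → w ∈ exact b S → SomeFrom (val w) b S′) → (∀ {w} → w ∈ narrow b S → ¬ Models (val w) b S′) →
              S′ ≡ S
  same-gaps b []             []               []        ok b< sh pos neg = refl
  same-gaps b ((g , b′) ∷ S) ((g′ , _) ∷ S′) (refl ∷ s) ok@(_ , _ , good , n3 , _ , ok′) b< sh@((_ , b<′) ∷ sh′) pos neg =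
    cong₂ (λ g S → (g , b′) ∷ S) (≤-antisym
      (gap-bound {g} {g′} {b} {b′} {S′} ok b< sh (subst (λ w → SomeFrom (val (tight g b b′ ⊕ w)) b ((g′ , b′) ∷ S′)) (sym (spread-same s)) (pos (here refl))))
      (at-least g neg))
      (same-gaps b′ S S′ s (weak {b′} {S′} good n3 ok′) b<′ sh′
        (λ {w} m → Some⇒From {g = g′} {b′} {S′} good (forward {b} {_} {w} ok b< sh (pos (there (∈-map⁺ (word b ⊕_) m)))))
        (λ {w} m m′ → neg (narrow-tail g m) (Models-⊕ {b} {(g′ , b′) ∷ S′} {w} sh (0 , m′))))
    where
    at-least : ∀ g → (∀ {w} → w ∈ narrow b ((g , b′) ∷ S) → ¬ Models (val w) b ((g′ , b′) ∷ S′)) → g ≤ g′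
    at-least zero    neg = z≤n
    at-least (suc g) neg with suc g ≤? g′
    ... | yes p = p
    ... | no n  = contradiction
      (gap-realised {g} {g′} {b} {b′} {S′} (s≤s⁻¹ (≰⇒> n)) sh′ (subst (λ w → Some (val w) S′) (spread-same s) (spread-sat S′ sh′)))
      (neg (here refl))

-- Replacing blocks by equivalent ones

Coherent : Valuation → Set
Coherent V = ∀ r s p → r ⊨ᴱ s → V p r → V p s

-- The candidate keeps its gaps but takes over the given blocks, so that the comparison of gaps may
-- assume identical blocks.
regap : ∀ {ts S} → Matches ts S → List Segment
regap []                             = []
regap {(g , _) ∷ _} {(_ , b) ∷ _} (_ ∷ m) = (g , b) ∷ regap m

regap-same : ∀ {ts S} (m : Matches ts S) → SameBlocks (regap m) S
regap-same []      = []
regap-same (_ ∷ m) = refl ∷ regap-same m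

≈-sym : ∀ {b c} → b ≈ c → c ≈ b
≈-sym = Pointwise.symmetric λ (p , q) → q , p

≈-end : ∀ {c b} → c ≈ b → lst c ≣ᴱ lst b
≈-end {r ∷ rs} {s ∷ ss} (e ∷ es) = go e es
  where
  go : ∀ {r rs s ss} → r ≣ᴱ s → Pointwise _≣ᴱ_ rs ss → end r rs ≣ᴱ end s ss
  go e []        = e
  go e (e′ ∷ es) = go e′ es

≈-first : ∀ {c b} → c ≈ b → first c ≣ᴱ first b
≈-first (e ∷ _) = e

≣-nontrivial : ∀ {r s} → r ≣ᴱ s → Nontrivial r → Nontrivial s
≣-nontrivial {r} {s} (_ , sr) n t = n (⊨ᴱ⇒⊨ᵉ {s} {r} sr t)

module _ {V : Valuation} (coh : Coherent V) where

  ≈-Row : ∀ {cs bs p} → Pointwise _≣ᴱ_ cs bs → Row V p cs → Row V p bs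
  ≈-Row []            _        = tt
  ≈-Row {c ∷ _} {b ∷ _} ((e , _) ∷ es) (v , vs) = coh c b _ e v , ≈-Row es vs

  regap⁺ : ∀ {ts S p} (m : Matches ts S) → Tail V p ts → Tail V p (regap m)
  regap⁺ []      _                    = tt
  regap⁺ {(_ , c) ∷ _} {(_ , b) ∷ _} (e ∷ m) (q , leq , a , ts) =
    q , leq , ≈-Row e a , subst (λ k → Tail V (q + k) (regap m)) (≈-last {c} {b} e) (regap⁺ m ts)

  regap⁻ : ∀ {ts S p} (m : Matches ts S) → Tail V p (regap m) → Tail V p ts
  regap⁻ []      _                    = tt
  regap⁻ {(_ , c) ∷ ts} {(_ , b) ∷ _} (e ∷ m) (q , leq , a , s) =
    q , leq , ≈-Row (≈-sym {c} {b} e) a , subst (λ k → Tail V (q + k) ts) (sym (≈-last {c} {b} e)) (regap⁻ m s)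

regap-N3 : ∀ {x y ts S} → x ≣ᴱ y → (m : Matches ts S) → N3 x ts → N3 y (regap m)
regap-N3 e [] n = tt
regap-N3 {x} {y} {(zero , r ∷ []) ∷ _} {(_ , s ∷ []) ∷ _} (xy , _) (((_ , sr) ∷ []) ∷ m) n =
  λ ys → n (⊨ᴱ-trans {x} {y} {r} xy (⊨ᴱ-trans {y} {s} {r} ys sr))
regap-N3 {ts = (zero , _ ∷ _ ∷ _) ∷ _} {(_ , _ ∷ _ ∷ _) ∷ _} _ (_ ∷ m) n = tt
regap-N3 {ts = (zero , _ ∷ []) ∷ _} {(_ , _ ∷ _ ∷ _) ∷ _} _ ((_ ∷ ()) ∷ m) n
regap-N3 {ts = (zero , _ ∷ _ ∷ _) ∷ _} {(_ , _ ∷ []) ∷ _} _ ((_ ∷ ()) ∷ m) n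
regap-N3 {ts = (suc g , _) ∷ _} {_ ∷ _} _ (_ ∷ m) n = tt

regap-N4 : ∀ {c b ts S} → c ≈ b → (m : Matches ts S) → N4 c ts → N4 b (regap m)
regap-N4 {r ∷ []} {s ∷ []} (_ ∷ []) [] n = tt
regap-N4 {r ∷ []} {s ∷ []} {(zero , c) ∷ _} {(_ , b) ∷ _} ((rs , sr) ∷ []) (e ∷ m) n =
  λ bs → n (⊨ᴱ-trans {first c} {first b} {r} (proj₁ (≈-first {c} {b} e)) (⊨ᴱ-trans {first b} {s} {r} bs sr))
regap-N4 {r ∷ []} {s ∷ []} {(suc g , _) ∷ _} _ (_ ∷ m) n = tt
regap-N4 {_ ∷ _ ∷ _} {_ ∷ _ ∷ _} _ m n = tt
regap-N4 {_ ∷ _ ∷ _} {_ ∷ []} (_ ∷ ()) m n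

regap-OKs : ∀ {ts S} (m : Matches ts S) → OKs ts → OKs (regap m)
regap-OKs []      ok = tt
regap-OKs {(_ , c) ∷ _} {(_ , b) ∷ _} (e ∷ m) ((n₁ , n₂) , n3 , n4 , ok) =
  (≣-nontrivial {first c} {first b} (≈-first {c} {b} e) n₁ , ≣-nontrivial {lst c} {lst b} (≈-end {c} {b} e) n₂) ,
  regap-N3 {lst c} {lst b} (≈-end {c} {b} e) m n3 , regap-N4 {c} {b} e m n4 , regap-OKs m ok

regap-OK : ∀ {c b ts S} → c ≈ b → (m : Matches ts S) → OK c ts → OK b (regap m)
regap-OK {c} {b} e m (n , n3 , ok) =
  (λ k> → ≣-nontrivial {lst c} {lst b} (≈-end {c} {b} e) (n (subst (0 <_) (sym (≈-last {c} {b} e)) k>))) ,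
  regap-N3 {lst c} {lst b} (≈-end {c} {b} e) m n3 , regap-OKs m ok

-- Normal forms of queries

trivial? : ∀ r → Dec (Trivial r)
trivial? r = [] , 0 ⊨ᵉ? r

Holds : Valuation → ℕ → Block → List Segment → Set
Holds V p b t = At V p b × Tail V (p + lastIndex b) t

Val : TemporalInstance → Individual → Valuation
Val 𝒟 a p r = 𝒟 at p , a ⊨ᵉ r

Val-coherent : ∀ {𝒟 a} → Coherent (Val 𝒟 a)
Val-coherent {𝒟} {a} r s p e = e 𝒟 a p

widen : ℕ → List Segment → List Segment
widen c []            = []
widen c ((g , b) ∷ t) = (c + g , b) ∷ t

-- Restores (n4): a primitive block entailed by the start of the block related to it by ≤ holds
-- there anyway.
absorb-first : ℕ → Block → List Segment → List Segment
absorb-first c (r ∷ []) t@((zero , b) ∷ t′) with ⊨ᴱ? (first b) r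
... | yes _ = (c , b) ∷ t′
... | no _  = (c , r ∷ []) ∷ t
absorb-first c b t = (c , b) ∷ t

-- Restores (n1): tautologies at the front of a block only delay it, so each adds 1 to the gap. A
-- lone tautology vanishes and its two gaps merge.
push : ℕ → ELI → List ELI → List Segment → List Segment
push c r rs t with trivial? r
push c r rs       t | no _  = absorb-first c (r ∷ rs) t
push c r []       t | yes _ = widen c t
push c r (s ∷ rs) t | yes _ = push (suc c) s rs t

-- Restores (n3): a primitive block entailed by `x` can be satisfied at the point of `x`. Its
-- removal exposes the next block, hence the recursion.
absorb-last : ELI → List Segment → List Segment
absorb-last x t@((zero , s ∷ []) ∷ t′) with ⊨ᴱ? x s
... | yes _ = absorb-last x t′
... | no _  = t
absorb-last x t = t

diamond : ℕ → ELI → Block × List Segment → Block × List Segment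
diamond c r (s ∷ rs , t) = r ∷ [] , absorb-last r (push c s rs t)

-- Prefixing a label to a one-point block labelled by a tautology would violate (n1); that point
-- becomes part of the gap.
next : ELI → Block × List Segment → Block × List Segment
next r (s ∷ rs , t) with trivial? s
next r (s ∷ rs , t)       | no _  = r ∷ s ∷ rs , t
next r (s ∷ s′ ∷ rs , t)  | yes _ = r ∷ s ∷ s′ ∷ rs , t
next r (s ∷ [] , t)       | yes _ = r ∷ [] , widen 1 t

normalise : Query → Block × List Segment
normalise ⌊ r ⌋         = r ∷ [] , []
normalise (r ∧[ ○ ] q)  = next r (normalise q)
normalise (r ∧[ ◇ ] q)  = diamond 1 r (normalise q)
normalise (r ∧[ ◇ᵣ ] q) = diamond 0 r (normalise q)

widen-OKs : ∀ c t → OKs t → OKs (widen c t)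
widen-OKs c []      ok = tt
widen-OKs c (_ ∷ t) ok = ok

absorb-first-OKs : ∀ c b t → Good b → N3 (lst b) t → OKs t → OKs (absorb-first c b t)
absorb-first-OKs c (r ∷ []) []                  g n3 ok = g , n3 , tt , ok
absorb-first-OKs c (r ∷ []) ((zero , b) ∷ t)    g n3 ok with ⊨ᴱ? (first b) r
... | yes _ = ok
... | no n  = g , n3 , n , ok
absorb-first-OKs c (r ∷ []) ((suc _ , b) ∷ t)   g n3 ok = g , n3 , tt , ok
absorb-first-OKs c (r ∷ _ ∷ _) t                g n3 ok = g , n3 , tt , ok

push-OKs : ∀ c r rs t → (0 < length rs → Nontrivial (end r rs)) → N3 (end r rs) t → OKs t → OKs (push c r rs t)
push-OKs c r rs t n n3 ok with trivial? r
push-OKs c r []       t n n3 ok | no ¬t = absorb-first-OKs c (r ∷ []) t (¬t , ¬t) n3 ok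
push-OKs c r (s ∷ rs) t n n3 ok | no ¬t = absorb-first-OKs c (r ∷ s ∷ rs) t (¬t , n (s≤s z≤n)) n3 ok
push-OKs c r []       t n n3 ok | yes _ = widen-OKs c t ok
push-OKs c r (s ∷ rs) t n n3 ok | yes _ = push-OKs (suc c) s rs t (λ _ → n (s≤s z≤n)) n3 ok

absorb-last-OKs : ∀ x t → OKs t → OKs (absorb-last x t)
absorb-last-OKs x []                          ok = tt
absorb-last-OKs x ((zero , s ∷ []) ∷ t)       ok@(_ , _ , _ , ok′) with ⊨ᴱ? x s
... | yes _ = absorb-last-OKs x t ok′
... | no _  = ok
absorb-last-OKs x ((zero , s ∷ _ ∷ _) ∷ t)    ok = ok
absorb-last-OKs x ((suc g , _) ∷ t)           ok = ok

absorb-last-N3 : ∀ x t → N3 x (absorb-last x t)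
absorb-last-N3 x []                       = tt
absorb-last-N3 x ((zero , s ∷ []) ∷ t)    with ⊨ᴱ? x s
... | yes _ = absorb-last-N3 x t
... | no n  = n
absorb-last-N3 x ((zero , s ∷ _ ∷ _) ∷ t) = tt
absorb-last-N3 x ((suc g , _) ∷ t)        = tt

diamond-OK : ∀ c r b t → OK b t → let b′ , t′ = diamond c r (b , t) in OK b′ t′
diamond-OK c r (s ∷ rs) t (n , n3 , ok) =
  (λ ()) , absorb-last-N3 r (push c s rs t) , absorb-last-OKs r (push c s rs t) (push-OKs c s rs t n n3 ok)

next-OK : ∀ r b t → OK b t → let b′ , t′ = next r (b , t) in OK b′ t′
next-OK r (s ∷ rs) t (n , n3 , ok) with trivial? s
next-OK r (s ∷ [])      t (n , n3 , ok) | no ¬t = (λ _ → ¬t) , n3 , ok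
next-OK r (s ∷ s′ ∷ rs) t (n , n3 , ok) | no ¬t = (λ _ → n (s≤s z≤n)) , n3 , ok
next-OK r (s ∷ s′ ∷ rs) t (n , n3 , ok) | yes _ = (λ _ → n (s≤s z≤n)) , n3 , ok
next-OK r (s ∷ [])      t (n , n3 , ok) | yes _ = (λ ()) , n3′ t , widen-OKs 1 t ok
  where
  n3′ : ∀ t → N3 r (widen 1 t)
  n3′ []      = tt
  n3′ (_ ∷ t) = tt

normalise-OK : ∀ q → let b , t = normalise q in OK b t
normalise-OK ⌊ r ⌋         = (λ ()) , tt , tt
normalise-OK (r ∧[ ○ ] q)  = next-OK r (proj₁ (normalise q)) (proj₂ (normalise q)) (normalise-OK q)
normalise-OK (r ∧[ ◇ ] q)  = diamond-OK 1 r (proj₁ (normalise q)) (proj₂ (normalise q)) (normalise-OK q)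
normalise-OK (r ∧[ ◇ᵣ ] q) = diamond-OK 0 r (proj₁ (normalise q)) (proj₂ (normalise q)) (normalise-OK q)

module _ {V : Valuation} (coh : Coherent V) (triv : ∀ r p → Trivial r → V p r) where

  widen⁺ : ∀ c {p q} t → p + c ≤ q → Tail V q t → Tail V p (widen c t)
  widen⁺ c []            leq _                     = tt
  widen⁺ c {p} ((g , b) ∷ t) leq (q′ , leq′ , ts) =
    q′ , ≤-trans (≤-reflexive (sym (+-assoc p c g))) (≤-trans (+-monoˡ-≤ g leq) leq′) , ts

  widen⁻ : ∀ c {p} t → Tail V p (widen c t) → Tail V (p + c) t
  widen⁻ c []                _              = tt
  widen⁻ c {p} ((g , b) ∷ t) (q , leq , ts) = q , ≤-trans (≤-reflexive (+-assoc p c g)) leq , ts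

  absorb-first⁺ : ∀ c b t {p q} → p + c ≤ q → Holds V q b t → Tail V p (absorb-first c b t)
  absorb-first⁺ c (r ∷ []) []                 leq (a , ts) = _ , leq , a , ts
  absorb-first⁺ c (r ∷ []) ((zero , b) ∷ t)   {q = q} leq (a , ts@(q′ , leq′ , a′ , ts′)) with ⊨ᴱ? (first b) r
  ... | yes _ = q′ , ≤-trans leq (≤-trans (m≤m+n q 0) (≤-trans (m≤m+n (q + 0) 0) leq′)) , a′ , ts′
  ... | no _  = _ , leq , a , ts
  absorb-first⁺ c (r ∷ []) ((suc _ , b) ∷ t)  leq (a , ts) = _ , leq , a , ts
  absorb-first⁺ c (r ∷ _ ∷ _) t               leq (a , ts) = _ , leq , a , ts

  absorb-first⁻ : ∀ c b t {p} → Tail V p (absorb-first c b t) → ∃[ q ] p + c ≤ q × Holds V q b t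
  absorb-first⁻ c (r ∷ []) []                (q , leq , a , ts) = q , leq , a , ts
  absorb-first⁻ c (r ∷ []) ((zero , b) ∷ t)  ts with ⊨ᴱ? (first b) r
  absorb-first⁻ c (r ∷ []) ((zero , b) ∷ t)  (q , leq , a , ts) | yes br =
    q , leq , (coh (first b) r _ br (proj₁ a) , tt) ,
    q , ≤-reflexive (trans (+-identityʳ (q + 0)) (+-identityʳ q)) , a , ts
  absorb-first⁻ c (r ∷ []) ((zero , b) ∷ t)  ts | no _ = ts
  absorb-first⁻ c (r ∷ []) ((suc _ , b) ∷ t) ts = ts
  absorb-first⁻ c (r ∷ _ ∷ _) t              ts = ts

  push⁺ : ∀ c r rs t {p q} → p + c ≤ q → Holds V q (r ∷ rs) t → Tail V p (push c r rs t)
  push⁺ c r rs t leq h with trivial? r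
  push⁺ c r rs       t leq h | no _ = absorb-first⁺ c (r ∷ rs) t leq h
  push⁺ c r []       t leq (_ , ts) | yes _ = widen⁺ c t (≤-trans leq (m≤m+n _ 0)) ts
  push⁺ c r (s ∷ rs) t {p} {q} leq ((_ , a) , ts) | yes _ =
    push⁺ (suc c) s rs t (≤-trans (≤-reflexive (+-suc p c)) (s≤s leq))
      (a , subst (λ q → Tail V q t) (+-suc q (length rs)) ts)

  push⁻ : ∀ c r rs t {p} → Tail V p (push c r rs t) → ∃[ q ] p + c ≤ q × Holds V q (r ∷ rs) t
  push⁻ c r rs t ts with trivial? r
  push⁻ c r rs       t ts | no _  = absorb-first⁻ c (r ∷ rs) t ts
  push⁻ c r []       t {p} ts | yes tr =
    p + c , ≤-refl , (triv _ _ tr , tt) , subst (λ q → Tail V q t) (sym (+-identityʳ (p + c))) (widen⁻ c t ts)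
  push⁻ c r (s ∷ rs) t {p} ts | yes tr with push⁻ (suc c) s rs t ts
  ... | zero  , leq , _ = contradiction (≤-trans (≤-reflexive (sym (+-suc p c))) leq) λ ()
  ... | suc q , leq , a , ts′ = q , s≤s⁻¹ (≤-trans (≤-reflexive (sym (+-suc p c))) leq) , (triv _ _ tr , a) ,
          subst (λ q → Tail V q t) (sym (+-suc q (length rs))) ts′

  absorb-last⁺ : ∀ x t {p} → Tail V p t → Tail V p (absorb-last x t)
  absorb-last⁺ x []                       ts = ts
  absorb-last⁺ x ((zero , s ∷ []) ∷ t)    ts@(q , leq , _ , ts′) with ⊨ᴱ? x s
  ... | yes _ = absorb-last⁺ x t (Tail-early t (≤-trans (m≤m+n _ 0) (≤-trans leq (m≤m+n q 0))) ts′)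
  ... | no _  = ts
  absorb-last⁺ x ((zero , s ∷ _ ∷ _) ∷ t) ts = ts
  absorb-last⁺ x ((suc g , _) ∷ t)        ts = ts

  absorb-last⁻ : ∀ x t {p} → V p x → Tail V p (absorb-last x t) → Tail V p t
  absorb-last⁻ x []                       v ts = ts
  absorb-last⁻ x ((zero , s ∷ []) ∷ t) {p} v ts with ⊨ᴱ? x s
  ... | yes xs = p , ≤-reflexive (+-identityʳ p) , (coh x s _ xs v , tt) ,
                 subst (λ p → Tail V p t) (sym (+-identityʳ p)) (absorb-last⁻ x t v ts)
  ... | no _  = ts
  absorb-last⁻ x ((zero , s ∷ _ ∷ _) ∷ t) v ts = ts
  absorb-last⁻ x ((suc g , _) ∷ t)        v ts = ts

  diamond⁺ : ∀ c r b t {p q} → V p r → p + c ≤ q → Holds V q b t →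
             let b′ , t′ = diamond c r (b , t) in Holds V p b′ t′
  diamond⁺ c r (s ∷ rs) t {p} v leq h =
    (v , tt) , absorb-last⁺ r (push c s rs t) (push⁺ c s rs t (≤-trans (≤-reflexive (cong (_+ c) (+-identityʳ p))) leq) h)

  diamond⁻ : ∀ c r b t {p} → let b′ , t′ = diamond c r (b , t) in Holds V p b′ t′ →
             V p r × ∃[ q ] p + c ≤ q × Holds V q b t
  diamond⁻ c r (s ∷ rs) t {p} ((v , _) , ts) = v ,
    push⁻ c s rs t (absorb-last⁻ r (push c s rs t) v (subst (λ q → Tail V q (absorb-last r (push c s rs t))) (+-identityʳ p) ts))

  next⁺ : ∀ r b t {p} → V p r → Holds V (suc p) b t → let b′ , t′ = next r (b , t) in Holds V p b′ t′
  next⁺ r (s ∷ rs) t v h with trivial? s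
  next⁺ r (s ∷ rs)      t {p} v (a , ts) | no _  = (v , a) , subst (λ q → Tail V q t) (sym (+-suc p (length rs))) ts
  next⁺ r (s ∷ s′ ∷ rs) t {p} v (a , ts) | yes _ = (v , a) , subst (λ q → Tail V q t) (sym (+-suc p (suc (length rs)))) ts
  next⁺ r (s ∷ [])      t {p} v (a , ts) | yes _ = (v , tt) , widen⁺ 1 t
    (≤-reflexive (trans (cong (_+ 1) (+-identityʳ p)) (trans (+-comm p 1) (sym (+-identityʳ (suc p)))))) ts

  next⁻ : ∀ r b t {p} → let b′ , t′ = next r (b , t) in Holds V p b′ t′ → V p r × Holds V (suc p) b t
  next⁻ r (s ∷ rs) t h with trivial? s
  next⁻ r (s ∷ rs)      t {p} ((v , a) , ts) | no _  = v , a , subst (λ q → Tail V q t) (+-suc p (length rs)) ts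
  next⁻ r (s ∷ s′ ∷ rs) t {p} ((v , a) , ts) | yes _ = v , a , subst (λ q → Tail V q t) (+-suc p (suc (length rs))) ts
  next⁻ r (s ∷ [])      t {p} ((v , _) , ts) | yes tr = v , (triv _ _ tr , tt) ,
    subst (λ q → Tail V q t) (trans (cong (_+ 1) (+-identityʳ p)) (trans (+-comm p 1) (sym (+-identityʳ (suc p))))) (widen⁻ 1 t ts)

Val-trivial : ∀ {𝒟 a} r p → Trivial r → Val 𝒟 a p r
Val-trivial r p t = []-sat r t

normalise⁺ : ∀ q {𝒟 a ℓ} → 𝒟 , a , ℓ ⊨ q → let b , t = normalise q in Holds (Val 𝒟 a) ℓ b t
normalise⁻ : ∀ q {𝒟 a ℓ} → let b , t = normalise q in Holds (Val 𝒟 a) ℓ b t → 𝒟 , a , ℓ ⊨ q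

normalise⁺ ⌊ r ⌋ p = (p , tt) , tt
normalise⁺ (r ∧[ ○ ] q) {𝒟} {a} (p , s) =
  next⁺ (Val-coherent {𝒟} {a}) (Val-trivial {𝒟} {a}) r (proj₁ (normalise q)) (proj₂ (normalise q)) p (normalise⁺ q s)
normalise⁺ (r ∧[ ◇ ] q) {𝒟} {a} {ℓ} (p , m , leq , s) =
  diamond⁺ (Val-coherent {𝒟} {a}) (Val-trivial {𝒟} {a})
    1 r (proj₁ (normalise q)) (proj₂ (normalise q)) p (≤-trans (≤-reflexive (+-comm ℓ 1)) leq) (normalise⁺ q s)
normalise⁺ (r ∧[ ◇ᵣ ] q) {𝒟} {a} {ℓ} (p , m , leq , s) =
  diamond⁺ (Val-coherent {𝒟} {a}) (Val-trivial {𝒟} {a})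
    0 r (proj₁ (normalise q)) (proj₂ (normalise q)) p (≤-trans (≤-reflexive (+-identityʳ ℓ)) leq) (normalise⁺ q s)

normalise⁻ ⌊ r ⌋ ((p , _) , _) = p
normalise⁻ (r ∧[ ○ ] q) {𝒟} {a} h =
  let p , s = next⁻ (Val-coherent {𝒟} {a}) (Val-trivial {𝒟} {a}) r (proj₁ (normalise q)) (proj₂ (normalise q)) h
  in p , normalise⁻ q s
normalise⁻ (r ∧[ ◇ ] q) {𝒟} {a} {ℓ} h =
  let p , m , leq , s = diamond⁻ (Val-coherent {𝒟} {a}) (Val-trivial {𝒟} {a}) 1 r (proj₁ (normalise q)) (proj₂ (normalise q)) h
  in p , m , ≤-trans (≤-reflexive (+-comm 1 ℓ)) leq , normalise⁻ q s
normalise⁻ (r ∧[ ◇ᵣ ] q) {𝒟} {a} {ℓ} h =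
  let p , m , leq , s = diamond⁻ (Val-coherent {𝒟} {a}) (Val-trivial {𝒟} {a}) 0 r (proj₁ (normalise q)) (proj₂ (normalise q)) h
  in p , m , ≤-trans (m≤m+n ℓ 0) leq , normalise⁻ q s

-- The size of normal forms

rows-size : List ELI → ℕ
rows-size rs = sum (map ∣_∣ᴱ rs)

block-size : Block → ℕ
block-size b = rows-size (toList b)

-- Gaps are not counted: they turn into empty letters, which contain no facts.
tail-size : List Segment → ℕ
tail-size t = sum (map (λ (_ , b) → block-size b) t)

widen-size : ∀ c t → tail-size (widen c t) ≡ tail-size t
widen-size c []      = refl
widen-size c (_ ∷ t) = refl

absorb-first-size : ∀ c b t → tail-size (absorb-first c b t) ≤ block-size b + tail-size t
absorb-first-size c (r ∷ []) []                = ≤-refl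
absorb-first-size c (r ∷ []) ((zero , b) ∷ t)  with ⊨ᴱ? (first b) r
... | yes _ = m≤n+m _ (block-size (r ∷ []))
... | no _  = ≤-refl
absorb-first-size c (r ∷ []) ((suc _ , b) ∷ t) = ≤-refl
absorb-first-size c (r ∷ _ ∷ _) t              = ≤-refl

push-size : ∀ c r rs t → tail-size (push c r rs t) ≤ rows-size (r ∷ rs) + tail-size t
push-size c r rs t with trivial? r
push-size c r rs       t | no _  = absorb-first-size c (r ∷ rs) t
push-size c r []       t | yes _ = ≤-trans (≤-reflexive (widen-size c t)) (m≤n+m _ (rows-size (r ∷ [])))
push-size c r (s ∷ rs) t | yes _ = ≤-trans (push-size (suc c) s rs t) (+-monoˡ-≤ (tail-size t) (m≤n+m _ ∣ r ∣ᴱ))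

absorb-last-size : ∀ x t → tail-size (absorb-last x t) ≤ tail-size t
absorb-last-size x []                       = ≤-refl
absorb-last-size x ((zero , s ∷ []) ∷ t)    with ⊨ᴱ? x s
... | yes _ = ≤-trans (absorb-last-size x t) (m≤n+m _ (block-size (s ∷ [])))
... | no _  = ≤-refl
absorb-last-size x ((zero , s ∷ _ ∷ _) ∷ t) = ≤-refl
absorb-last-size x ((suc g , _) ∷ t)        = ≤-refl

size : Block × List Segment → ℕ
size (b , t) = block-size b + tail-size t

diamond-size : ∀ c r b t → size (diamond c r (b , t)) ≤ ∣ r ∣ᴱ + size (b , t)
diamond-size c r (s ∷ rs) t = +-mono-≤ (≤-reflexive (+-identityʳ ∣ r ∣ᴱ))
  (≤-trans (absorb-last-size r (push c s rs t)) (push-size c s rs t))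

next-size : ∀ r b t → size (next r (b , t)) ≤ ∣ r ∣ᴱ + size (b , t)
next-size r (s ∷ rs) t with trivial? s
next-size r (s ∷ rs)      t | no _  = ≤-reflexive (+-assoc ∣ r ∣ᴱ _ _)
next-size r (s ∷ s′ ∷ rs) t | yes _ = ≤-reflexive (+-assoc ∣ r ∣ᴱ _ _)
next-size r (s ∷ [])      t | yes _ =
  +-mono-≤ (≤-reflexive (+-identityʳ ∣ r ∣ᴱ)) (≤-trans (≤-reflexive (widen-size 1 t)) (m≤n+m _ (block-size (s ∷ []))))

normalise-size : ∀ q → size (normalise q) ≤ ∣ q ∣
normalise-size ⌊ r ⌋ = ≤-reflexive (trans (+-identityʳ _) (+-identityʳ ∣ r ∣ᴱ))
normalise-size (r ∧[ ○ ] q) = ≤-trans (next-size r (proj₁ (normalise q)) (proj₂ (normalise q)))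
  (+-mono-≤ (m≤m+n ∣ r ∣ᴱ 2) (normalise-size q))
normalise-size (r ∧[ ◇ ] q) = ≤-trans (diamond-size 1 r (proj₁ (normalise q)) (proj₂ (normalise q)))
  (+-mono-≤ (m≤m+n ∣ r ∣ᴱ 2) (normalise-size q))
normalise-size (r ∧[ ◇ᵣ ] q) = ≤-trans (diamond-size 0 r (proj₁ (normalise q)) (proj₂ (normalise q)))
  (+-mono-≤ (m≤m+n ∣ r ∣ᴱ 2) (normalise-size q))

ELI-size>0 : ∀ r → 0 < ∣ r ∣ᴱ
ELI-size>0 ⊤ᵉ       = s≤s z≤n
ELI-size>0 (atom A) = s≤s z≤n
ELI-size>0 (r ∧ᵉ s) = ≤-trans (≤-trans (ELI-size>0 r) (m≤m+n ∣ r ∣ᴱ 1)) (m≤m+n _ ∣ s ∣ᴱ)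
ELI-size>0 (∃ᵉ S r) = s≤s z≤n

length≤rows-size : ∀ rs → length rs ≤ rows-size rs
length≤rows-size []       = z≤n
length≤rows-size (r ∷ rs) = +-mono-≤ (ELI-size>0 r) (length≤rows-size rs)

length≤tail-size : ∀ t → length t ≤ tail-size t
length≤tail-size []            = z≤n
length≤tail-size ((g , b) ∷ t) = +-mono-≤ (≤-trans (s≤s z≤n) (length≤rows-size (toList b))) (length≤tail-size t)

run≤length : ∀ t → run t ≤ length t
run≤length []                = z≤n
run≤length ((zero , _) ∷ t)  = s≤s (run≤length t)
run≤length ((suc _ , _) ∷ t) = z≤n

length≤⇒Bounded : ∀ {M} t → length t ≤ M → Bounded M t
length≤⇒Bounded []      leq = tt
length≤⇒Bounded (_ ∷ t) leq = ≤-trans (s≤s (run≤length t)) leq , length≤⇒Bounded t (≤-trans (n≤1+n _) leq)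

-- Normal forms without ≤

Strict : List Segment → Set
Strict = All λ (g , _) → 0 < g

Strict⇒Bounded : ∀ {t} → Strict t → Bounded 1 t
Strict⇒Bounded []                        = tt
Strict⇒Bounded {_ ∷ t} (_ ∷ st) = s≤s (run≡0 st) , Strict⇒Bounded st
  where
  run≡0 : ∀ {t} → Strict t → run t ≤ 0
  run≡0 []                             = z≤n
  run≡0 {(suc g , _) ∷ _} (s≤s _ ∷ _) = z≤n

widen-Strict : ∀ c {t} → Strict t → Strict (widen c t)
widen-Strict c []        = []
widen-Strict c {(g , _) ∷ _} (g> ∷ st) = ≤-trans g> (m≤n+m g c) ∷ st

absorb-first-Strict : ∀ c b {t} → 0 < c → Strict t → Strict (absorb-first c b t)
absorb-first-Strict c (r ∷ []) {[]}              c> st = c> ∷ st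
absorb-first-Strict c (r ∷ []) {(zero , b) ∷ t}  c> (() ∷ _)
absorb-first-Strict c (r ∷ []) {(suc _ , b) ∷ t} c> st = c> ∷ st
absorb-first-Strict c (r ∷ _ ∷ _)                c> st = c> ∷ st

push-Strict : ∀ c r rs {t} → 0 < c → Strict t → Strict (push c r rs t)
push-Strict c r rs c> st with trivial? r
push-Strict c r rs       c> st | no _  = absorb-first-Strict c (r ∷ rs) c> st
push-Strict c r []       c> st | yes _ = widen-Strict c st
push-Strict c r (s ∷ rs) c> st | yes _ = push-Strict (suc c) s rs (s≤s z≤n) st

absorb-last-Strict : ∀ x {t} → Strict t → Strict (absorb-last x t)
absorb-last-Strict x {[]}              st       = st
absorb-last-Strict x {(zero , _) ∷ _}  (() ∷ _)
absorb-last-Strict x {(suc _ , _) ∷ _} st       = st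

normalise-Strict : ∀ q → 𝒬ₚ[ ｛ ○ ｝ ∪ ｛ ◇ ｝ ] q → Strict (proj₂ (normalise q))
normalise-Strict ⌊ r ⌋         _             = []
normalise-Strict (r ∧[ ○ ] q)  (_ , m)       = go (proj₁ (normalise q)) (normalise-Strict q m)
  where
  go : ∀ b {t} → Strict t → Strict (proj₂ (next r (b , t)))
  go (s ∷ rs) st with trivial? s
  go (s ∷ rs)      st | no _  = st
  go (s ∷ _ ∷ rs)  st | yes _ = st
  go (s ∷ [])      st | yes _ = widen-Strict 1 st
normalise-Strict (r ∧[ ◇ ] q)  (_ , m)       = go (proj₁ (normalise q)) (normalise-Strict q m)
  where
  go : ∀ b {t} → Strict t → Strict (proj₂ (diamond 1 r (b , t)))
  go (s ∷ rs) st = absorb-last-Strict r (push-Strict 1 s rs (s≤s z≤n) st)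
normalise-Strict (r ∧[ ◇ᵣ ] q) (inj₁ () , _)
normalise-Strict (r ∧[ ◇ᵣ ] q) (inj₂ () , _)

-- Queries and divisions of normal forms

-- A distance of at least `g` is written with `g` many ○ before ◇ᵣ, which stays within the class.
delay : ℕ → ELI → Query → Query
delay zero    r q = r ∧[ ◇ᵣ ] q
delay (suc g) r q = r ∧[ ○ ] delay g ⊤ᵉ q

query : ELI → List ELI → List Segment → Query
query r []       []                   = ⌊ r ⌋
query r []       ((g , s ∷ rs) ∷ t) = delay g r (query s rs t)
query r (s ∷ rs) t                  = r ∧[ ○ ] query s rs t

query∈ : ∀ r rs t → 𝒬ₚ[ ｛ ○ ｝ ∪ ｛ ◇ᵣ ｝ ] (query r rs t)
query∈ r []       []                 = tt
query∈ r []       ((g , s ∷ rs) ∷ t) = go g r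
  where
  go : ∀ g r → 𝒬ₚ[ ｛ ○ ｝ ∪ ｛ ◇ᵣ ｝ ] (delay g r (query s rs t))
  go zero    r = inj₂ refl , query∈ s rs t
  go (suc g) r = inj₁ refl , go g ⊤ᵉ
query∈ r (s ∷ rs) t                  = inj₁ refl , query∈ s rs t

module _ {𝒟 : TemporalInstance} {a : Individual} where

  private
    V : Valuation
    V = Val 𝒟 a

  delay⁺ : ∀ g {r q ℓ m} → V ℓ r → ℓ + g ≤ m → 𝒟 , a , m ⊨ q → 𝒟 , a , ℓ ⊨ delay g r q
  delay⁺ zero    v leq s = v , _ , ≤-trans (m≤m+n _ 0) leq , s
  delay⁺ (suc g) v leq s = v , delay⁺ g tt (≤-trans (≤-reflexive (sym (+-suc _ g))) leq) s

  delay⁻ : ∀ g {r q ℓ} → 𝒟 , a , ℓ ⊨ delay g r q → V ℓ r × ∃[ m ] ℓ + g ≤ m × 𝒟 , a , m ⊨ q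
  delay⁻ zero    (v , m , leq , s) = v , m , ≤-trans (≤-reflexive (+-identityʳ _)) leq , s
  delay⁻ (suc g) {ℓ = ℓ} (v , s)   = let _ , m , leq , s′ = delay⁻ g s in v , m , ≤-trans (≤-reflexive (+-suc ℓ g)) leq , s′

  query⁺ : ∀ r rs t {ℓ} → Holds V ℓ (r ∷ rs) t → 𝒟 , a , ℓ ⊨ query r rs t
  query⁺ r []       []                 ((v , _) , _) = v
  query⁺ r []       ((g , s ∷ rs) ∷ t) {ℓ} ((v , _) , m , leq , h) =
    delay⁺ g v (≤-trans (≤-reflexive (cong (_+ g) (sym (+-identityʳ ℓ)))) leq) (query⁺ s rs t h)
  query⁺ r (s ∷ rs) t                  {ℓ} ((v , a) , ts) =
    v , query⁺ s rs t (a , subst (λ p → Tail V p t) (+-suc ℓ (length rs)) ts)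

  query⁻ : ∀ r rs t {ℓ} → 𝒟 , a , ℓ ⊨ query r rs t → Holds V ℓ (r ∷ rs) t
  query⁻ r []       []                 v = (v , tt) , tt
  query⁻ r []       ((g , s ∷ rs) ∷ t) {ℓ} h =
    let v , m , leq , h′ = delay⁻ g h
    in (v , tt) , m , ≤-trans (≤-reflexive (cong (_+ g) (+-identityʳ ℓ))) leq , query⁻ s rs t h′
  query⁻ r (s ∷ rs) t                  {ℓ} (v , h) =
    let a , ts = query⁻ s rs t h in (v , a) , subst (λ p → Tail V p t) (sym (+-suc ℓ (length rs))) ts

-- Segments and divisions

strict : Gap → ℕ
strict lt = 1
strict le = 0

width : Gap → List Gap → ℕ
width g []        = strict g
width g (g′ ∷ gs) = strict g + width g′ gs

unfold : ∀ {n} → Vec Block (suc n) → Vec Gaps n → Block × List Segment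
unfold (b ∷ []) []                     = b , []
unfold (b ∷ bs@(_ ∷ _)) ((g ∷ gs) ∷ gss) = let b′ , t = unfold bs gss in b , (width g gs , b′) ∷ t

gapsOf : ℕ → Gaps
gapsOf zero    = le ∷ []
gapsOf (suc g) = lt ∷ replicate g lt

blocksOf : (t : List Segment) → Vec Block (length t)
blocksOf []            = []
blocksOf ((_ , b) ∷ t) = b ∷ blocksOf t

gapssOf : (t : List Segment) → Vec Gaps (length t)
gapssOf []            = []
gapssOf ((g , _) ∷ t) = gapsOf g ∷ gapssOf t

divide : Block → List Segment → Division
divide b t = division (b ∷ blocksOf t) (gapssOf t)

width-gapsOf : ∀ g → let h ∷ hs = gapsOf g in width h hs ≡ g
width-gapsOf zero          = refl
width-gapsOf (suc zero)    = refl
width-gapsOf (suc (suc g)) = cong suc (width-gapsOf (suc g))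

unfold-first : ∀ {n} b (bs : Vec Block n) gss → proj₁ (unfold (b ∷ bs) gss) ≡ b
unfold-first b []       []              = refl
unfold-first b (_ ∷ _) ((_ ∷ _) ∷ gss) = refl

unfold-divide : ∀ b t → unfold (b ∷ blocksOf t) (gapssOf t) ≡ (b , t)
unfold-divide b []            = refl
unfold-divide b ((g , b′) ∷ t) with gapsOf g in e
... | h ∷ hs rewrite unfold-divide b′ t =
  cong (λ g → b , (g , b′) ∷ t) (trans (cong (λ { (h ∷ hs) → width h hs }) (sym e)) (width-gapsOf g))

module _ {𝒟 : TemporalInstance} {a : Individual} where

  private
    V : Valuation
    V = Val 𝒟 a

  jump⁺ : ∀ r g gs {q ℓ m} → V ℓ r → ℓ + width g gs ≤ m → 𝒟 , a , m ⊨ q → 𝒟 , a , ℓ ⊨ jump r g gs q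
  jump⁺ r lt []        {ℓ = ℓ} v leq s = v , _ , ≤-trans (≤-reflexive (+-comm 1 ℓ)) leq , s
  jump⁺ r le []        v leq s = v , _ , ≤-trans (m≤m+n _ 0) leq , s
  jump⁺ r lt (g′ ∷ gs) {ℓ = ℓ} v leq s =
    v , suc ℓ , ≤-refl , jump⁺ ⊤ᵉ g′ gs tt (≤-trans (≤-reflexive (sym (+-suc ℓ _))) leq) s
  jump⁺ r le (g′ ∷ gs) v leq s = v , _ , ≤-refl , jump⁺ ⊤ᵉ g′ gs tt leq s

  jump⁻ : ∀ r g gs {q ℓ} → 𝒟 , a , ℓ ⊨ jump r g gs q → V ℓ r × ∃[ m ] ℓ + width g gs ≤ m × 𝒟 , a , m ⊨ q
  jump⁻ r lt []        {ℓ = ℓ} (v , m , leq , s) = v , m , ≤-trans (≤-reflexive (+-comm ℓ 1)) leq , s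
  jump⁻ r le []        (v , m , leq , s) = v , m , ≤-trans (≤-reflexive (+-identityʳ _)) leq , s
  jump⁻ r lt (g′ ∷ gs) {ℓ = ℓ} (v , m , leq , s) =
    let _ , n , leq′ , s′ = jump⁻ ⊤ᵉ g′ gs s
    in v , n , ≤-trans (≤-reflexive (+-suc ℓ _)) (≤-trans (+-monoˡ-≤ (width g′ gs) leq) leq′) , s′
  jump⁻ r le (g′ ∷ gs) (v , m , leq , s) =
    let _ , n , leq′ , s′ = jump⁻ ⊤ᵉ g′ gs s in v , n , ≤-trans (+-monoˡ-≤ (width g′ gs) leq) leq′ , s′

  chain⁺ : ∀ r rs {k ℓ} → Row V ℓ (r ∷ rs) → (V (ℓ + length rs) (end r rs) → 𝒟 , a , ℓ + length rs ⊨ k (end r rs)) →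
           𝒟 , a , ℓ ⊨ chain r rs k
  chain⁺ r []       {k} {ℓ} (v , _) f =
    subst (λ m → 𝒟 , a , m ⊨ k r) (+-identityʳ ℓ) (f (subst (λ m → V m r) (sym (+-identityʳ ℓ)) v))
  chain⁺ r (s ∷ rs) {k} {ℓ} (v , vs) f = v , chain⁺ s rs vs
    (subst (λ m → V m (end s rs) → 𝒟 , a , m ⊨ k (end s rs)) (+-suc ℓ (length rs)) f)

  chain⁻ : ∀ r rs {k ℓ} → (∀ {m} → 𝒟 , a , m ⊨ k (end r rs) → V m (end r rs)) → 𝒟 , a , ℓ ⊨ chain r rs k →
           Row V ℓ (r ∷ rs) × 𝒟 , a , ℓ + length rs ⊨ k (end r rs)
  chain⁻ r []       {k} {ℓ} f h = (f h , tt) , subst (λ m → 𝒟 , a , m ⊨ k r) (sym (+-identityʳ ℓ)) h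
  chain⁻ r (s ∷ rs) {k} {ℓ} f (v , h) =
    let vs , h′ = chain⁻ s rs f h in (v , vs) , subst (λ m → 𝒟 , a , m ⊨ k (end s rs)) (sym (+-suc ℓ (length rs))) h′

  unfold⁺ : ∀ {n} (bs : Vec Block (suc n)) gss {ℓ} → let b , t = unfold bs gss in Holds V ℓ b t → 𝒟 , a , ℓ ⊨ blocksToQuery bs gss
  unfold⁺ ((r ∷ rs) ∷ []) [] (a , _) = chain⁺ r rs a id
  unfold⁺ ((r ∷ rs) ∷ bs@(_ ∷ _)) ((g ∷ gs) ∷ gss) (a , m , leq , h) =
    chain⁺ r rs a λ v → jump⁺ (end r rs) g gs v leq (unfold⁺ bs gss h)

  unfold⁻ : ∀ {n} (bs : Vec Block (suc n)) gss {ℓ} → 𝒟 , a , ℓ ⊨ blocksToQuery bs gss → let b , t = unfold bs gss in Holds V ℓ b t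
  unfold⁻ ((r ∷ rs) ∷ []) [] h = proj₁ (chain⁻ r rs {⌊_⌋} (λ v → v) h) , tt
  unfold⁻ ((r ∷ rs) ∷ bs@(_ ∷ _)) ((g ∷ gs) ∷ gss) h =
    let a , j = chain⁻ r rs {λ r → jump r g gs (blocksToQuery bs gss)} (λ j → proj₁ (jump⁻ (end r rs) g gs j)) h
        _ , m , leq , h′ = jump⁻ (end r rs) g gs j
    in a , m , leq , unfold⁻ bs gss h′

final≡lst : ∀ b → final b ≡ lst b
final≡lst (r ∷ rs) = go r rs
  where
  final-∷ : ∀ r s rs → final (r ∷ s ∷ rs) ≡ final (s ∷ rs)
  final-∷ r s rs with List.initLast rs
  ... | []           = refl
  ... | _ List.∷ʳ′ _ = refl
  go : ∀ r rs → final (r ∷ rs) ≡ end r rs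
  go r []       = refl
  go r (s ∷ rs) = trans (final-∷ r s rs) (go s rs)

module _ {P : Block → Set} where

  All-lookup⁺ : ∀ {n} (bs : Vec Block (suc n)) gss g → (∀ i → P (Vec.lookup bs i)) →
                let b , t = unfold bs gss in All (P ∘ proj₂) ((g , b) ∷ t)
  All-lookup⁺ (b ∷ [])           []               g p = p Fin.zero ∷ []
  All-lookup⁺ (b ∷ bs@(_ ∷ _)) ((h ∷ hs) ∷ gss) g p =
    p Fin.zero ∷ All-lookup⁺ bs gss (width h hs) (p ∘ Fin.suc)

  All-lookup⁻ : ∀ t → All (P ∘ proj₂) t → ∀ i → P (Vec.lookup (blocksOf t) i)
  All-lookup⁻ (_ ∷ t) (p ∷ ps) Fin.zero    = p
  All-lookup⁻ (_ ∷ t) (p ∷ ps) (Fin.suc i) = All-lookup⁻ t ps i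

N3⁺ : ∀ {x} w b t → (w ≡ 0 → Primitive b → ¬ (x ⊨ᴱ first b)) → N3 x ((w , b) ∷ t)
N3⁺ zero    (r ∷ [])    t f = f refl refl
N3⁺ zero    (r ∷ _ ∷ _) t f = tt
N3⁺ (suc w) b           t f = tt

N3⁻ : ∀ {x} w b t → N3 x ((w , b) ∷ t) → w ≡ 0 → Primitive b → ¬ (x ⊨ᴱ first b)
N3⁻ zero (r ∷ []) t n _ _ = n

N4⁺ : ∀ b w b′ t → (w ≡ 0 → Primitive b → ¬ (first b′ ⊨ᴱ lst b)) → N4 b ((w , b′) ∷ t)
N4⁺ (r ∷ [])    zero    b′ t f = f refl refl
N4⁺ (r ∷ [])    (suc w) b′ t f = tt
N4⁺ (r ∷ _ ∷ _) w       b′ t f = tt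

N4⁻ : ∀ b w b′ t → N4 b ((w , b′) ∷ t) → w ≡ 0 → Primitive b → ¬ (first b′ ⊨ᴱ lst b)
N4⁻ (r ∷ []) zero b′ t n _ _ = n

width≡0⇒le : ∀ {g gs} → IsLe (g ∷ gs) ⊎ All (_≡ lt) (g ∷ gs) → width g gs ≡ 0 → IsLe (g ∷ gs)
width≡0⇒le (inj₁ e)                       _ = e
width≡0⇒le {gs = []}    (inj₂ (refl ∷ _)) ()
width≡0⇒le {gs = _ ∷ _} (inj₂ (refl ∷ _)) ()

module _ {n} (b : Block) (bs : Vec Block (suc n)) (g : Gap) (gs : List Gap) (gss : Vec Gaps n) where

  private
    b′ = proj₁ (unfold bs gss)
    t′ = proj₂ (unfold bs gss)
    head≡ : b′ ≡ Vec.head bs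
    head≡ = go bs gss
      where go : ∀ {n} (bs : Vec Block (suc n)) gss → proj₁ (unfold bs gss) ≡ Vec.head bs
            go (b ∷ bs) gss = unfold-first b bs gss

  unfold-N3 : IsLe (g ∷ gs) ⊎ All (_≡ lt) (g ∷ gs) →
              (Primitive (Vec.head bs) → IsLe (g ∷ gs) → ¬ (final b ⊨ᴱ first (Vec.head bs))) →
              N3 (lst b) ((width g gs , b′) ∷ t′)
  unfold-N3 n2 n3 = N3⁺ (width g gs) b′ t′ λ w p →
    subst₂ (λ x c → ¬ (x ⊨ᴱ first c)) (final≡lst b) (sym head≡) (n3 (subst Primitive head≡ p) (width≡0⇒le n2 w))

  unfold-N4 : IsLe (g ∷ gs) ⊎ All (_≡ lt) (g ∷ gs) →
              (Primitive b → IsLe (g ∷ gs) → ¬ (first (Vec.head bs) ⊨ᴱ final b)) →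
              N4 b ((width g gs , b′) ∷ t′)
  unfold-N4 n2 n4 = N4⁺ b (width g gs) b′ t′ λ w p →
    subst₂ (λ x c → ¬ (first c ⊨ᴱ x)) (final≡lst b) (sym head≡) (n4 p (width≡0⇒le n2 w))

unfold-OKs : ∀ {n} (bs : Vec Block (suc n)) (gss : Vec Gaps n) g₀ → (∀ i → Good (Vec.lookup bs i)) →
  (∀ i → IsLe (Vec.lookup gss i) ⊎ All (_≡ lt) (toList (Vec.lookup gss i))) →
  (∀ i → Primitive (Vec.lookup bs (Fin.suc i)) → IsLe (Vec.lookup gss i) →
     ¬ (final (Vec.lookup bs (inject₁ i)) ⊨ᴱ first (Vec.lookup bs (Fin.suc i)))) →
  (∀ i → Primitive (Vec.lookup bs (inject₁ i)) → IsLe (Vec.lookup gss i) →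
     ¬ (first (Vec.lookup bs (Fin.suc i)) ⊨ᴱ final (Vec.lookup bs (inject₁ i)))) →
  let b , t = unfold bs gss in OKs ((g₀ , b) ∷ t)
unfold-OKs (b ∷ [])           []               g₀ good n2 n3 n4 = good Fin.zero , tt , N4-[] b , tt
  where
  N4-[] : ∀ b → N4 b []
  N4-[] (r ∷ [])    = tt
  N4-[] (r ∷ _ ∷ _) = tt
unfold-OKs (b ∷ bs@(_ ∷ _)) ((g ∷ gs) ∷ gss) g₀ good n2 n3 n4 =
  good Fin.zero , unfold-N3 b bs g gs gss (n2 Fin.zero) (n3 Fin.zero) , unfold-N4 b bs g gs gss (n2 Fin.zero) (n4 Fin.zero) ,
  unfold-OKs bs gss (width g gs) (good ∘ Fin.suc) (n2 ∘ Fin.suc) (n3 ∘ Fin.suc) (n4 ∘ Fin.suc)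

normal-form⇒OK : ∀ d → NormalForm d → let b , t = unfold (Division.blocks d) (Division.gaps d) in OK b t
normal-form⇒OK (division (b ∷ [])           [])               nf = fst-final , tt , tt
  where
  fst-final : 0 < lastIndex b → Nontrivial (lst b)
  fst-final k> t = NormalForm.n1-final nf Fin.zero (inj₂ k>) (trivial⇒≣ᴱ⊤ {final b} (subst Trivial (sym (final≡lst b)) t))
normal-form⇒OK (division (b ∷ bs@(_ ∷ _)) ((g ∷ gs) ∷ gss)) nf =
  (λ k> t → n1-final Fin.zero (inj₂ k>) (trivial⇒≣ᴱ⊤ {final b} (subst Trivial (sym (final≡lst b)) t))) ,
  unfold-N3 b bs g gs gss (n2 Fin.zero) (n3 Fin.zero) ,
  unfold-OKs bs gss (width g gs)
    (λ i → (λ t → n1-first (Fin.suc i) (s≤s z≤n) (trivial⇒≣ᴱ⊤ {first (Vec.lookup bs i)} t)) ,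
           (λ t → n1-final (Fin.suc i) (inj₁ (s≤s z≤n))
              (trivial⇒≣ᴱ⊤ {final (Vec.lookup bs i)} (subst Trivial (sym (final≡lst (Vec.lookup bs i))) t))))
    (n2 ∘ Fin.suc) (n3 ∘ Fin.suc) (λ i → n4 (Fin.suc i) (s≤s z≤n))
  where open NormalForm nf

gapsOf-le : ∀ g → IsLe (gapsOf g) → g ≡ 0
gapsOf-le zero e = refl

gapsOf-n2 : ∀ g → IsLe (gapsOf g) ⊎ All (_≡ lt) (toList (gapsOf g))
gapsOf-n2 zero    = inj₁ refl
gapsOf-n2 (suc g) = inj₂ (refl ∷ All.replicate⁺ g refl)

OK⇒normal-form : ∀ b t → OK b t → NormalForm (divide b t)
OK⇒normal-form b t (n , n3 , ok) = record
  { n1-first = λ { (Fin.suc i) _ e → proj₁ (goods t ok i) (≣ᴱ⊤⇒trivial {first (Vec.lookup (blocksOf t) i)} e) }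
  ; n1-final = λ { Fin.zero (inj₂ k>) e → n k> (subst Trivial (final≡lst b) (≣ᴱ⊤⇒trivial {final b} e))
                 ; (Fin.suc i) _ e → let c = Vec.lookup (blocksOf t) i in
                     proj₂ (goods t ok i) (subst Trivial (final≡lst c) (≣ᴱ⊤⇒trivial {final c} e)) }
  ; n2       = n2s t
  ; n3       = n3s b t n3 ok
  ; n4       = n4s t ok
  }
  where
  goods : ∀ t → OKs t → ∀ i → Good (Vec.lookup (blocksOf t) i)
  goods (_ ∷ t) (g , _)           Fin.zero    = g
  goods (_ ∷ t) (_ , _ , _ , ok) (Fin.suc i) = goods t ok i
  n2s : ∀ t i → IsLe (Vec.lookup (gapssOf t) i) ⊎ All (_≡ lt) (toList (Vec.lookup (gapssOf t) i))
  n2s ((g , _) ∷ t) Fin.zero    = gapsOf-n2 g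
  n2s (_ ∷ t)       (Fin.suc i) = n2s t i
  n3s : ∀ b t → N3 (lst b) t → OKs t → ∀ i → Primitive (Vec.lookup (blocksOf t) i) → IsLe (Vec.lookup (gapssOf t) i) →
        ¬ (final (Vec.lookup (b ∷ blocksOf t) (inject₁ i)) ⊨ᴱ first (Vec.lookup (blocksOf t) i))
  n3s b ((g , c) ∷ t) n3 ok Fin.zero p e =
    subst (λ x → ¬ (x ⊨ᴱ first c)) (sym (final≡lst b)) (N3⁻ g c t n3 (gapsOf-le g e) p)
  n3s b ((g , c) ∷ t) n3 (_ , n3′ , _ , ok) (Fin.suc i) = n3s c t n3′ ok i
  n4s′ : ∀ b t → N4 b t → OKs t → ∀ i → Primitive (Vec.lookup (b ∷ blocksOf t) (inject₁ i)) →
         IsLe (Vec.lookup (gapssOf t) i) →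
         ¬ (first (Vec.lookup (blocksOf t) i) ⊨ᴱ final (Vec.lookup (b ∷ blocksOf t) (inject₁ i)))
  n4s′ b ((g , c) ∷ t) n4 ok Fin.zero p e =
    subst (λ x → ¬ (first c ⊨ᴱ x)) (sym (final≡lst b)) (N4⁻ b g c t n4 (gapsOf-le g e) p)
  n4s′ b ((g , c) ∷ t) n4 (_ , _ , n4″ , ok) (Fin.suc i) = n4s′ c t n4″ ok i
  n4s : ∀ t → OKs t → ∀ i → 0 < toℕ i → Primitive (Vec.lookup (b ∷ blocksOf t) (inject₁ i)) →
        IsLe (Vec.lookup (gapssOf t) i) →
        ¬ (first (Vec.lookup (blocksOf t) i) ⊨ᴱ final (Vec.lookup (b ∷ blocksOf t) (inject₁ i)))
  n4s ((_ , c) ∷ t) (_ , _ , n4 , ok) (Fin.suc i) _ = n4s′ c t n4 ok i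

-- Lone conjuncts

AllHomogeneous : List Segment → Set
AllHomogeneous = All λ (_ , b) → ∀ {r} → b ≡ r ∷ [] → Homogeneous r

no-lone-conjuncts⇒homogeneous : ∀ d → (∀ i → ¬ LoneConjunct d i) →
                                AllHomogeneous (proj₂ (unfold (Division.blocks d) (Division.gaps d)))
no-lone-conjuncts⇒homogeneous (division (b ∷ [])           [])               no-lone = []
no-lone-conjuncts⇒homogeneous (division (b ∷ bs@(_ ∷ _)) ((g ∷ gs) ∷ gss)) no-lone =
  All-lookup⁺ bs gss (width g gs) λ i {r} e → case homogeneous⊎decomposable r of λ
    { (inj₁ h) → h
    ; (inj₂ x) → contradiction
        (s≤s z≤n , cong lastIndex e , subst (λ c → Decomposable (first c)) (sym e) x) (no-lone (Fin.suc i)) }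

homogeneous⇒no-lone-conjuncts : ∀ b t → AllHomogeneous t → ∀ i → ¬ LoneConjunct (divide b t) i
homogeneous⇒no-lone-conjuncts b t hs Fin.zero    (() , _)
homogeneous⇒no-lone-conjuncts b t hs (Fin.suc i) (_ , p , x) with Vec.lookup (blocksOf t) i | All-lookup⁻ t hs i
... | r ∷ [] | h = homogeneous⇒indecomposable {r} (h refl) x

homogeneous? : ∀ t → AllHomogeneous t ⊎
               ∃[ t₁ ] ∃[ g ] ∃[ r ] ∃[ t₂ ] t ≡ t₁ ++ (g , r ∷ []) ∷ t₂ × Decomposable r
homogeneous? []      = inj₁ []
homogeneous? ((g , b) ∷ t) with homogeneous? t
... | inj₂ (t₁ , g′ , r , t₂ , e , x) = inj₂ ((g , b) ∷ t₁ , g′ , r , t₂ , cong ((g , b) ∷_) e , x)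
homogeneous? ((g , r ∷ _ ∷ _) ∷ t) | inj₁ hs = inj₁ ((λ ()) ∷ hs)
homogeneous? ((g , r ∷ []) ∷ t)    | inj₁ hs with homogeneous⊎decomposable r
... | inj₁ h = inj₁ ((λ { refl → h }) ∷ hs)
... | inj₂ x = inj₂ ([] , g , r , t , refl , x)

-- The example set of a normal form

-- A fresh unary symbol at the end of each example makes 0 one of its individuals.

junk : UnarySymbol → Letter
junk A = unary A 0 ∷ []

-- The least number above all unary symbols of the query, so that `symbols r ≤ A` means that neither
-- `A` nor a larger symbol occurs in `r`.
symbols : ELI → ℕ
symbols ⊤ᵉ       = 0
symbols (atom A) = suc A
symbols (r ∧ᵉ s) = symbols r ⊔ symbols s
symbols (∃ᵉ S r) = symbols r

fact-symbol : Fact → ℕ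
fact-symbol (unary A _)    = suc A
fact-symbol (binary _ _ _) = 0

letter-symbols : Letter → ℕ
letter-symbols l = maximum (map fact-symbol l)

word-symbols : Word → ℕ
word-symbols w = maximum (map letter-symbols w)

sat-symbols : ∀ {l a} r → l , a ⊨ᵉ r → symbols r ≤ letter-symbols l
sat-symbols ⊤ᵉ       _               = z≤n
sat-symbols (atom A) u               = ∈⇒≤maximum (∈-map⁺ fact-symbol u)
sat-symbols (r ∧ᵉ s) (p , q)         = ⊔-lub (sat-symbols r p) (sat-symbols s q)
sat-symbols (∃ᵉ S r) (_ , _ , _ , p) = sat-symbols r p

junk-unsat : ∀ {A} r {a} → symbols r ≤ A → junk A , a ⊨ᵉ r → [] , a ⊨ᵉ r
junk-unsat ⊤ᵉ       leq _             = tt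
junk-unsat (atom A) leq (here refl)   = contradiction leq 1+n≰n
junk-unsat (r ∧ᵉ s) leq (p , q)       =
  junk-unsat r (≤-trans (m≤m⊔n _ (symbols s)) leq) p , junk-unsat s (≤-trans (m≤n⊔m (symbols r) _) leq) q
junk-unsat (∃ᵉ (fwd P) r) leq (_ , _ , here () , _)
junk-unsat (∃ᵉ (inv P) r) leq (_ , _ , here () , _)

pad : Word → Letter → TemporalInstance
pad []      j = j ∷ []
pad (l ∷ w) j = l ∷ (w ++ j ∷ [])

toList-pad : ∀ w j → toList (pad w j) ≡ w ++ j ∷ []
toList-pad []      j = refl
toList-pad (l ∷ w) j = refl

at≡! : ∀ 𝒟 ℓ → 𝒟 at ℓ ≡ toList 𝒟 ! ℓ
at≡! 𝒟 = go (toList 𝒟)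
  where
  go : ∀ w ℓ → fromMaybe [] (head (drop ℓ w)) ≡ w ! ℓ
  go []      zero    = refl
  go []      (suc ℓ) = refl
  go (l ∷ w) zero    = refl
  go (l ∷ w) (suc ℓ) = go w ℓ

pad-at : ∀ w j ℓ → pad w j at ℓ ≡ (w ++ j ∷ []) ! ℓ
pad-at w j ℓ = trans (at≡! (pad w j) ℓ) (cong (_! ℓ) (toList-pad w j))

example : Word → UnarySymbol → PointedInstance
example w A = pointed (pad w (junk A)) 0
  (subst (λ 𝒟 → 0 ∈ concatMap ind 𝒟) (sym (toList-pad w (junk A)))
    (∈-concatMap⁺ ind (lose {xs = w ++ junk A ∷ []} (∈-++⁺ʳ w (here refl)) (here refl))))

snoc-! : ∀ w {j} p → (w ++ j ∷ []) ! p ≡ w ! p ⊎ ((w ++ j ∷ []) ! p ≡ j × w ! p ≡ [])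
snoc-! []      zero    = inj₂ (refl , refl)
snoc-! []      (suc p) = inj₁ refl
snoc-! (l ∷ w) zero    = inj₁ refl
snoc-! (l ∷ w) (suc p) = snoc-! w p

Labels : (ELI → Set) → Block → List Segment → Set
Labels Q b t = All Q (toList b) × All (λ (_ , c) → All Q (toList c)) t

module _ {Q : ELI → Set} {V V′ : Valuation} (f : ∀ p r → Q r → V p r → V′ p r) where

  Row-labels : ∀ {rs p} → All Q rs → Row V p rs → Row V′ p rs
  Row-labels []       _        = tt
  Row-labels (q ∷ qs) (v , vs) = f _ _ q v , Row-labels qs vs

  Tail-labels : ∀ {t p} → All (λ (_ , c) → All Q (toList c)) t → Tail V p t → Tail V′ p t
  Tail-labels []       _                  = tt
  Tail-labels (q ∷ qs) (p , leq , a , ts) = p , leq , Row-labels q a , Tail-labels qs ts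

  Holds-labels : ∀ {b t p} → Labels Q b t → Holds V p b t → Holds V′ p b t
  Holds-labels (q , qs) (a , ts) = Row-labels q a , Tail-labels qs ts

module _ {Q : ELI → Set} {V : Valuation} (f : ∀ p r → V p r → Q r) where

  labels-Row : ∀ rs {p} → Row V p rs → All Q rs
  labels-Row []       _        = []
  labels-Row (r ∷ rs) (v , vs) = f _ r v ∷ labels-Row rs vs

  labels-Tail : ∀ t {p} → Tail V p t → All (λ (_ , c) → All Q (toList c)) t
  labels-Tail []            _                = []
  labels-Tail ((g , b) ∷ t) (p , _ , a , ts) = labels-Row (toList b) a ∷ labels-Tail t ts

  labels-Holds : ∀ b t {p} → Holds V p b t → Labels Q b t
  labels-Holds b t (a , ts) = labels-Row (toList b) a , labels-Tail t ts

any-label : ∀ b t → Labels (λ _ → ⊤) b t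
any-label b t = All.universal (λ _ → tt) (toList b) , All.universal (λ (_ , c) → All.universal (λ _ → tt) (toList c)) t

Holds-map : ∀ {V V′ : Valuation} b t {p} → (∀ p r → V p r → V′ p r) → Holds V p b t → Holds V′ p b t
Holds-map b t f = Holds-labels (λ p r _ → f p r) (any-label b t)

module _ {w : Word} {A : UnarySymbol} {b : Block} {t : List Segment} where

  private
    V = Val (pad w (junk A)) 0

  example⁺ : Holds (val w) 0 b t → Holds V 0 b t
  example⁺ = Holds-map b t λ p r v → subst (_⊩ᴸ r) (sym (pad-at w (junk A) p)) (case snoc-! w {junk A} p of λ
    { (inj₁ e)       → subst (_⊩ᴸ r) (sym e) v
    ; (inj₂ (_ , e)) → []-sat r (subst (_⊩ᴸ r) e v) })

  example-symbols : ∀ {B} → word-symbols w ≤ B → A < B → Holds V 0 b t → Labels (λ r → symbols r ≤ B) b t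
  example-symbols {B} w≤ A< = labels-Holds (λ p r v → bound p r (subst (_⊩ᴸ r) (pad-at w (junk A) p) v)) b t
    where
    letter-bounded : ∀ w p → letter-symbols (w ! p) ≤ word-symbols w
    letter-bounded []      p       = z≤n
    letter-bounded (l ∷ w) zero    = m≤m⊔n _ _
    letter-bounded (l ∷ w) (suc p) = ≤-trans (letter-bounded w p) (m≤n⊔m (letter-symbols l) _)
    bound : ∀ p r → (w ++ junk A ∷ []) ! p ⊩ᴸ r → symbols r ≤ B
    bound p r v with snoc-! w {junk A} p
    ... | inj₁ e       = ≤-trans (sat-symbols r (subst (_⊩ᴸ r) e v)) (≤-trans (letter-bounded w p) w≤)
    ... | inj₂ (e , _) = ≤-trans (sat-symbols r (subst (_⊩ᴸ r) e v)) (≤-trans (⊔-lub ≤-refl z≤n) A<)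

  example⁻ : Labels (λ r → symbols r ≤ A) b t → Holds V 0 b t → Holds (val w) 0 b t
  example⁻ = Holds-labels λ p r leq v → without p r leq (subst (_⊩ᴸ r) (pad-at w (junk A) p) v)
    where
    without : ∀ p r → symbols r ≤ A → (w ++ junk A ∷ []) ! p ⊩ᴸ r → w ! p ⊩ᴸ r
    without p r leq v with snoc-! w {junk A} p
    ... | inj₁ e       = subst (_⊩ᴸ r) e v
    ... | inj₂ (e , e′) = subst (_⊩ᴸ r) (sym e′) (junk-unsat r leq (subst (_⊩ᴸ r) e v))

total : Block → List Segment → ℕ
total b []            = lastIndex b
total b ((g , c) ∷ t) = lastIndex b + g + total c t

total-Short : ∀ {n} b t → total b t < n → lastIndex b < n × All (Gapped.Short n) t
total-Short b []            n> = n> , []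
total-Short b ((g , c) ∷ t) n> =
  let tot = ≤-trans (s≤s (m≤n+m (total c t) (lastIndex b + g))) n>
      c<  = total-Short c t tot
  in ≤-trans (s≤s (≤-trans (m≤m+n (lastIndex b) g) (m≤m+n _ (total c t)))) n> ,
     (<⇒≤ (≤-trans (s≤s (≤-trans (m≤n+m g (lastIndex b)) (m≤m+n _ (total c t)))) n>) , proj₁ c<) ∷ proj₂ c<

-- Nontrivial labels hold only within the word, so by (n1) every later block and every first block
-- of several points ends inside it.
Models-Short : ∀ {w b t} → 0 < length w → OK b t → Holds (val w) 0 b t →
               lastIndex b < length w × All (Gapped.Short (length w)) t
Models-Short {w} {b} {t} w> (n , _ , ok) (a , ts) = first-short b n a , later-short t ok ts
  where
  first-short : ∀ b → (0 < lastIndex b → Nontrivial (lst b)) → At (val w) 0 b → lastIndex b < length w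
  first-short (r ∷ [])     n a = w>
  first-short (r ∷ s ∷ rs) n a = !-nontrivial w (n (s≤s z≤n)) (At-lst {val w} {0} (r ∷ s ∷ rs) a)
  later-short : ∀ t {p} → OKs t → Tail (val w) p t → All (Gapped.Short (length w)) t
  later-short []            _                    _                  = []
  later-short ((g , b) ∷ t) {p} (good , _ , _ , ok) (q , leq , a , ts) =
    let end< = !-nontrivial w {q + lastIndex b} (proj₂ good) (At-lst {val w} {q} b a) in
    (≤-trans (m≤n+m g p) (≤-trans leq (≤-trans (m≤m+n q _) (<⇒≤ end<))) , ≤-trans (s≤s (m≤n+m _ q)) end<) ∷
    later-short t ok ts

val-coherent : ∀ {w} → Coherent (val w)
val-coherent {w} r s p e = ⊨ᴱ⇒⊨ᵉ {r} {s} e {w ! p} {0}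

module Characterise (M : ℕ) (b : Block) (t : List Segment) (ok : OK b t) where

  -- `N₀` makes the blocks and gaps of the given query short, and `N` those of every candidate as
  -- well, since all of them are true in `small`.
  N₀ N : ℕ
  N₀ = suc (total b t)
  small : Word
  small = Gapped._⊕_ N₀ (Gapped.word N₀ b) (Gapped.spread N₀ t)
  N = length small

  open Gapped N
  open Negative N M
  open Analysis N M
  open Shape N M
  open Tight N M

  spreadout : Word
  spreadout = word b ⊕ spread t

  positive negative : List Word
  positive = small ∷ spreadout ∷ exact b t
  negative = negatives₀ b t ++ narrow b t

  label-symbols : List ELI → ℕ
  label-symbols rs = maximum (map symbols rs)

  fresh : UnarySymbol
  fresh = maximum (map word-symbols positive) ⊔
          (label-symbols (toList b) ⊔ maximum (map (λ (_ , c) → label-symbols (toList c)) t))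

  E : ExampleSet
  -- Truth in a first copy bounds the symbols of an unknown query by `fresh`. The last letter of the
  -- second copy, with symbol `suc fresh`, then contributes nothing, and the query is true in the
  -- word itself.
  E = examples (map (λ w → example w fresh) positive ++ map (λ w → example w (suc fresh)) positive)
               (map (λ w → example w fresh) negative)

  own-labels : Labels (λ r → symbols r ≤ fresh) b t
  own-labels =
    All.tabulate (λ m → ≤-trans (∈⇒≤maximum (∈-map⁺ symbols m)) (≤-trans (m≤m⊔n _ _) (m≤n⊔m (maximum (map word-symbols positive)) _))) ,
    All.tabulate λ {(g , c)} m → All.tabulate λ m′ → ≤-trans (∈⇒≤maximum (∈-map⁺ symbols m′))
      (≤-trans (∈⇒≤maximum (∈-map⁺ (λ (_ , c) → label-symbols (toList c)) m))
        (≤-trans (m≤n⊔m (label-symbols (toList b)) _) (m≤n⊔m (maximum (map word-symbols positive)) _)))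

  sh₀ = total-Short {N₀} b t ≤-refl

  small-sat : Models (val small) b t
  small-sat = Tight.Models-⊕ N₀ M {b} {t} {Gapped.spread N₀ t} (proj₂ sh₀) (Tight.spread-sat N₀ M t (proj₂ sh₀))

  sh : lastIndex b < N × All Short t
  sh = Models-Short {small} {b} {t} (s≤s z≤n) ok small-sat

  positive-sat : ∀ {w} → w ∈ positive → Models (val w) b t
  positive-sat (here refl)         = small-sat
  positive-sat (there (here refl)) = Models-⊕ {b} {t} {spread t} (proj₂ sh) (spread-sat t (proj₂ sh))
  positive-sat (there (there m))   = exact-sat b t (proj₂ sh) m

  negative-unsat : ∀ {w} → w ∈ negative → ¬ Models (val w) b t
  negative-unsat {w} m h with ∈-++⁻ (negatives₀ b t) m
  ... | inj₁ m′ = negatives₀-unsat b t ok (proj₁ sh) (proj₂ sh) m′ h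
  ... | inj₂ m′ = narrow-unsat b t ok (proj₁ sh) (proj₂ sh) m′ (0 , inj₁ refl , h)

  module _ {q : Query} (q⁺ : ∀ {𝒟 a ℓ} → 𝒟 , a , ℓ ⊨ q → Holds (Val 𝒟 a) ℓ b t)
           (q⁻ : ∀ {𝒟 a ℓ} → Holds (Val 𝒟 a) ℓ b t → 𝒟 , a , ℓ ⊨ q) where

    fits : Fits q E
    fits = All.++⁺ (All.map⁺ (All.tabulate λ {w} m → q⁻ (example⁺ {w} {fresh} {b} {t} (positive-sat m))))
                   (All.map⁺ (All.tabulate λ {w} m → q⁻ (example⁺ {w} {suc fresh} {b} {t} (positive-sat m)))) ,
           All.map⁺ (All.tabulate λ {w} m h → negative-unsat m (example⁻ {w} {fresh} {b} {t} own-labels (q⁺ h)))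

    unique : ∀ q′ → (AllHomogeneous t × 1 ≤ M ⊎ Bounded M (proj₂ (normalise q′))) → Fits q′ E → q ≣ q′
    unique q′ tame (fits⁺ , fits⁻) =
      (λ 𝒟 a ℓ h → normalise⁻ q′ (from (q⁺ h))) , (λ 𝒟 a ℓ h → q⁻ (to (normalise⁺ q′ h)))
      where
      c = proj₁ (normalise q′)
      s = proj₂ (normalise q′)
      okc : OK c s
      okc = normalise-OK q′
      sat : ∀ {w} → w ∈ positive → Models (val w) c s
      sat {w} m = example⁻ {w} {suc fresh} {c} {s}
        (example-symbols {w} {fresh} {c} {s} {suc fresh}
          (≤-trans (≤-trans (∈⇒≤maximum (∈-map⁺ word-symbols m)) (m≤m⊔n _ _)) (n≤1+n _)) ≤-refl
          (normalise⁺ q′ (All.lookup (All.map⁻ (All.++⁻ˡ (map (λ w → example w fresh) positive) fits⁺)) m)))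
        (normalise⁺ q′ (All.lookup (All.map⁻ (All.++⁻ʳ (map (λ w → example w fresh) positive) fits⁺)) m))
      unsat : ∀ {w} → w ∈ negative → ¬ Models (val w) c s
      unsat {w} m h = All.lookup (All.map⁻ fits⁻) m (normalise⁻ q′ (example⁺ {w} {fresh} {c} {s} h))
      shc : lastIndex c < N × All Short s
      shc = Models-Short {small} {c} {s} (s≤s z≤n) okc (sat (here refl))
      blocks : c ≈ b × Matches s t
      blocks = all-blocks b t c s okc (proj₁ shc) (proj₂ shc) tame (sat (there (here refl))) (λ m → unsat (∈-++⁺ˡ m))
      c≈b = proj₁ blocks
      m = proj₂ blocks
      Models-regap : ∀ {w} → Models (val w) c s → Models (val w) b (regap m)
      Models-regap {w} (a , ts) = ≈-Row (val-coherent {w}) c≈b a ,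
        subst (λ k → Tail (val w) k (regap m)) (≈-last {c} {b} c≈b) (regap⁺ (val-coherent {w}) m ts)
      Models-ungap : ∀ {w} → Models (val w) b (regap m) → Models (val w) c s
      Models-ungap {w} (a , ts) = ≈-Row (val-coherent {w}) (≈-sym {c} {b} c≈b) a ,
        subst (λ k → Tail (val w) k s) (sym (≈-last {c} {b} c≈b)) (regap⁻ (val-coherent {w}) m ts)
      shr : All Short (regap m)
      shr = go m (proj₂ shc)
        where
        go : ∀ {ts S} (m : Matches ts S) → All Short ts → All Short (regap m)
        go []      [] = []
        go {(_ , c) ∷ _} {(_ , b) ∷ _} (e ∷ m) ((g≤ , c<) ∷ sh) = (g≤ , subst (_< N) (≈-last {c} {b} e) c<) ∷ go m sh
      gaps : regap m ≡ t
      gaps = same-gaps b t (regap m) (regap-same m) (regap-OK {c} {b} c≈b m okc) (proj₁ sh) shr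
        (λ {w} w∈ → 0 , inj₁ refl , Models-regap {w} (sat (there (there w∈))))
        (λ {w} w∈ h → unsat (∈-++⁺ʳ (negatives₀ b t) w∈) (Models-ungap {w} h))
      to : ∀ {𝒟 a ℓ} → Holds (Val 𝒟 a) ℓ c s → Holds (Val 𝒟 a) ℓ b t
      to {𝒟} {a} {ℓ} (x , ts) = ≈-Row (Val-coherent {𝒟} {a}) c≈b x ,
        subst₂ (λ k S → Tail (Val 𝒟 a) (ℓ + k) S) (≈-last {c} {b} c≈b) gaps (regap⁺ (Val-coherent {𝒟} {a}) m ts)
      from : ∀ {𝒟 a ℓ} → Holds (Val 𝒟 a) ℓ b t → Holds (Val 𝒟 a) ℓ c s
      from {𝒟} {a} {ℓ} (x , ts) = ≈-Row (Val-coherent {𝒟} {a}) (≈-sym {c} {b} c≈b) x ,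
        regap⁻ (Val-coherent {𝒟} {a}) m
          (subst₂ (λ k S → Tail (Val 𝒟 a) (ℓ + k) S) (sym (≈-last {c} {b} c≈b)) (sym gaps) ts)

-- Sizes of example sets

word-size : Word → ℕ
word-size w = sum (map ∣_∣ᴬ w)

word-size-++ : ∀ u v → word-size (u ++ v) ≡ word-size u + word-size v
word-size-++ u v = trans (cong sum (map-++ ∣_∣ᴬ u v)) (sum-++ (map ∣_∣ᴬ u) (map ∣_∣ᴬ v))

word-size-replicate : ∀ n → word-size (replicate n []) ≡ 0
word-size-replicate zero    = refl
word-size-replicate (suc n) = word-size-replicate n

example-size : ∀ w A → ∣ example w A ∣ᴾ ≡ word-size w + 1
example-size w A = trans (cong (λ w → sum (map ∣_∣ᴬ w)) (toList-pad w (junk A))) (word-size-++ w (junk A ∷ []))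

examples-size : ∀ {m} A ws → (∀ {w} → w ∈ ws → word-size w ≤ m) →
                sum (map ∣_∣ᴾ (map (λ w → example w A) ws)) ≤ length ws * (m + 1)
examples-size A []       f = z≤n
examples-size A (w ∷ ws) f = +-mono-≤
  (≤-trans (≤-reflexive (example-size w A)) (+-monoˡ-≤ 1 (f (here refl)))) (examples-size A ws (f ∘ there))

length-concatMap : ∀ {X Y : Set} {k} (f : X → List Y) xs → (∀ {x} → x ∈ xs → length (f x) ≤ k) →
                   length (concatMap f xs) ≤ length xs * k
length-concatMap f []       h = z≤n
length-concatMap f (x ∷ xs) h = ≤-trans (≤-reflexive (length-++ (f x)))
  (+-mono-≤ (h (here refl)) (length-concatMap f xs (h ∘ there)))

length-splits : ∀ {X : Set} (xs : List X) → length (splits xs) ≡ length xs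
length-splits []       = refl
length-splits (x ∷ xs) = cong suc (trans (length-map _ (splits xs)) (length-splits xs))

points : Block → ℕ
points b = suc (lastIndex b)

all-points : List Segment → ℕ
all-points t = sum (map (λ (_ , b) → points b) t)

all-points≤size : ∀ t → all-points t ≤ tail-size t
all-points≤size []            = z≤n
all-points≤size ((g , b) ∷ t) = +-mono-≤ (length≤rows-size (toList b)) (all-points≤size t)

length≤all-points : ∀ t → length t ≤ all-points t
length≤all-points []            = z≤n
length≤all-points ((g , b) ∷ t) = +-mono-≤ {1} {points b} (s≤s z≤n) (length≤all-points t)

module Sizes (N M n : ℕ) where
  open Gapped N
  open Negative N M
  open Tight N M

  -- The largest letters are trees of conjunctions of two labels, of size at most n + 1 + n, from
  -- gaps of length 0.
  L : ℕ
  L = letter-bound (suc (n + n))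

  Fits≤ : List ELI → Set
  Fits≤ rs = All (λ r → ∣ r ∣ᴱ ≤ n) rs

  rows-Fits≤ : ∀ rs → rows-size rs ≤ n → Fits≤ rs
  rows-Fits≤ []       leq = []
  rows-Fits≤ (r ∷ rs) leq = ≤-trans (m≤m+n _ _) leq ∷ rows-Fits≤ rs (≤-trans (m≤n+m _ _) leq)

  tail-Fits≤ : ∀ t → tail-size t ≤ n → All (λ (_ , b) → Fits≤ (toList b)) t
  tail-Fits≤ []            leq = []
  tail-Fits≤ ((g , b) ∷ t) leq =
    rows-Fits≤ (toList b) (≤-trans (m≤m+n _ _) leq) ∷ tail-Fits≤ t (≤-trans (m≤n+m _ (block-size b)) leq)

  -- `k` bounds the number of nonempty letters, so that the estimates do not depend on `N`.
  Small : ℕ → Word → Set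
  Small k w = word-size w ≤ k * L

  Small-++ : ∀ {j k} u {v} → Small j u → Small k v → Small (j + k) (u ++ v)
  Small-++ {j} {k} u {v} su sv = ≤-trans (≤-reflexive (word-size-++ u v))
    (≤-trans (+-mono-≤ su sv) (≤-reflexive (sym (*-distribʳ-+ L j k))))

  Small-mono : ∀ {j k w} → j ≤ k → Small j w → Small k w
  Small-mono leq s = ≤-trans s (*-monoˡ-≤ L leq)

  Small-∷ : ∀ {k l w} → ∣ l ∣ᴬ ≤ L → Small k w → Small (suc k) (l ∷ w)
  Small-∷ = +-mono-≤

  Small-⊕ : ∀ {j k} u {w} → Small j u → Small k w → Small (j + k) (u ⊕ w)
  Small-⊕ {j} {k} u {w} su sw = Small-++ {j} {k} u su
    (Small-++ {0} {k} (replicate N []) (≤-reflexive (word-size-replicate N)) sw)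

  tree≤ : ∀ r → ∣ r ∣ᴱ ≤ suc (n + n) → ∣ tree r ∣ᴬ ≤ L
  tree≤ r leq = ≤-trans (tree-bound r) (letter-bound-mono leq)

  n≤ : n ≤ suc (n + n)
  n≤ = m≤n⇒m≤1+n (m≤m+n n n)

  frontier≤ : ∀ {r l} → ∣ r ∣ᴱ ≤ n → l ∈ frontier r → ∣ l ∣ᴬ ≤ L
  frontier≤ {r} leq m = ≤-trans (frontier-bound {r} m) (letter-bound-mono (≤-trans leq n≤))

  trees-Small : ∀ {rs} → Fits≤ rs → Small (length rs) (trees rs)
  trees-Small []                 = z≤n
  trees-Small {r ∷ rs} (r≤ ∷ f) = Small-∷ {length rs} {tree r} {trees rs} (tree≤ r (≤-trans r≤ n≤)) (trees-Small f)

  spread-Small : ∀ {t} → All (λ (_ , b) → Fits≤ (toList b)) t → Small (all-points t) (spread t)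
  spread-Small []                        = z≤n
  spread-Small {(_ , b) ∷ t} (f ∷ fs) = Small-⊕ {points b} {all-points t} (word b) (trees-Small f) (spread-Small fs)

  Small-replicate : ∀ {k} g {w} → Small k w → Small k (replicate g [] ++ w)
  Small-replicate {k} g s = Small-++ {0} {k} (replicate g []) (≤-reflexive (word-size-replicate g)) s

  tight-Small : ∀ g {b b′} → Fits≤ (toList b) → Fits≤ (toList b′) → Small (points b + points b′) (tight g b b′)
  tight-Small g {r ∷ rs} {b′} f f′ = go g r rs b′ f f′
    where
    go : ∀ g r rs b′ → Fits≤ (r ∷ rs) → Fits≤ (toList b′) → Small (suc (length rs) + points b′) (tight-from g r rs b′)
    go zero    r []       (r′ ∷ rs′) (r≤ ∷ []) (r≤′ ∷ fs) = Small-mono {suc (length rs′)} {suc (suc (length rs′))} {tree (r ∧ᵉ r′) ∷ trees rs′} (n≤1+n _)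
      (Small-∷ {length rs′} {tree (r ∧ᵉ r′)} {trees rs′}
        (tree≤ (r ∧ᵉ r′) (≤-trans (+-mono-≤ (+-monoˡ-≤ 1 r≤) r≤′) (≤-reflexive (cong (_+ n) (+-comm n 1))))) (trees-Small fs))
    go (suc g) r []       b′ (r≤ ∷ []) f′ = Small-∷ {points b′} {tree r} {replicate g [] ++ trees (toList b′)} (tree≤ r (≤-trans r≤ n≤))
      (Small-replicate {points b′} g {trees (toList b′)} (trees-Small f′))
    go zero    r (s ∷ rs) b′ (r≤ ∷ f) f′ = Small-∷ {suc (length rs) + points b′} {tree r} {tight-from zero s rs b′} (tree≤ r (≤-trans r≤ n≤)) (go zero s rs b′ f f′)
    go (suc g) r (s ∷ rs) b′ (r≤ ∷ f) f′ = Small-∷ {suc (length rs) + points b′} {tree r} {tight-from (suc g) s rs b′} (tree≤ r (≤-trans r≤ n≤)) (go (suc g) s rs b′ f f′)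

  exact-Small : ∀ {b t} → Fits≤ (toList b) → All (λ (_ , b) → Fits≤ (toList b)) t → ∀ {w} → w ∈ exact b t →
                Small (points b + all-points t) w
  exact-Small {b} {(g , b′) ∷ t} f (f′ ∷ fs) {w} (here refl) = subst (λ k → Small k w) (+-assoc (points b) (points b′) (all-points t))
    (Small-⊕ {points b + points b′} {all-points t} (tight g b b′) (tight-Small g {b} {b′} f f′) (spread-Small fs))
  exact-Small {b} {(g , b′) ∷ t} f (f′ ∷ fs) (there m) with ∈-map⁻ (word b ⊕_) m
  ... | w , w∈ , refl = Small-⊕ {points b} {points b′ + all-points t} (word b) {w} (trees-Small f) (exact-Small {b′} {t} f′ fs w∈)

  narrow-Small : ∀ {b t} → Fits≤ (toList b) → All (λ (_ , b) → Fits≤ (toList b)) t → ∀ {w} → w ∈ narrow b t →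
                 Small (points b + all-points t) w
  narrow-Small {b} {(suc g , b′) ∷ t} f (f′ ∷ fs) {w} (here refl) = subst (λ k → Small k w) (+-assoc (points b) (points b′) (all-points t))
    (Small-⊕ {points b + points b′} {all-points t} (tight g b b′) (tight-Small g {b} {b′} f f′) (spread-Small fs))
  narrow-Small {b} {(suc g , b′) ∷ t} f (f′ ∷ fs) (there m) with ∈-map⁻ (word b ⊕_) m
  ... | w , w∈ , refl = Small-⊕ {points b} {points b′ + all-points t} (word b) {w} (trees-Small f) (narrow-Small {b′} {t} f′ fs w∈)
  narrow-Small {b} {(zero , b′) ∷ t} f (f′ ∷ fs) m with ∈-map⁻ (word b ⊕_) m
  ... | w , w∈ , refl = Small-⊕ {points b} {points b′ + all-points t} (word b) {w} (trees-Small f) (narrow-Small {b′} {t} f′ fs w∈)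

  foldr-Small : ∀ {j k} us {w} → Small j (concat us) → Small k w → Small (j + k) (foldr _⊕_ w us)
  foldr-Small {j} {k} us {w} su sw = ≤-trans (≤-reflexive (go us))
    (≤-trans (+-mono-≤ su sw) (≤-reflexive (sym (*-distribʳ-+ L j k))))
    where
    go : ∀ us → word-size (foldr _⊕_ w us) ≡ word-size (concat us) + word-size w
    go []       = refl
    go (u ∷ us) = trans (word-size-++ u _) (trans (cong (word-size u +_)
      (trans (word-size-++ (replicate N []) _) (trans (cong (_+ word-size (foldr _⊕_ w us)) (word-size-replicate N)) (go us))))
      (trans (sym (+-assoc (word-size u) _ _)) (cong (_+ word-size w) (sym (word-size-++ u (concat us))))))

  module _ {u r v} (fu : Fits≤ u) (fr : ∣ r ∣ᴱ ≤ n) (fv : Fits≤ v) where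

    private
      k = suc (length u + suc (length v))

      tr = tree≤ r (≤-trans fr n≤)

      one : ∀ {l} → ∣ l ∣ᴬ ≤ L → Small k (trees u ++ l ∷ trees v)
      one {l} l≤ = Small-mono {length u + suc (length v)} {k} {trees u ++ l ∷ trees v} (n≤1+n _)
        (Small-++ {length u} {suc (length v)} (trees u) (trees-Small fu) (Small-∷ {length v} {l} {trees v} l≤ (trees-Small fv)))

      two : ∀ {l} → ∣ l ∣ᴬ ≤ L → Small k ((trees u ++ l ∷ []) ++ (tree r ∷ trees v) ++ [])
      two {l} l≤ = subst₂ Small (+-suc (length u) (suc (length v)))
        (trans (sym (++-assoc (trees u) (l ∷ []) (tree r ∷ trees v)))
          (cong ((trees u ++ l ∷ []) ++_) (sym (List.++-identityʳ (tree r ∷ trees v)))))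
        (Small-++ {length u} {suc (suc (length v))} (trees u) (trees-Small fu)
          (Small-∷ {suc (length v)} {l} {tree r ∷ trees v} l≤ (Small-∷ {length v} {tree r} {trees v} tr (trees-Small fv))))

    first-cut-Small : ∀ {us} → us ∈ first-cut (u , r , v) → Small k (concat us)
    first-cut-Small m with ∈-++⁻ (weakened (u , r , v)) m
    first-cut-Small m | inj₁ m′ with ∈-map⁻ _ m′
    ... | l , l∈ , refl = subst (Small k) (sym (List.++-identityʳ (trees u ++ l ∷ trees v))) (one (frontier≤ {r} fr l∈))
    first-cut-Small m | inj₂ m′ with ∈-++⁻ (broken (u , r , v)) m′
    ... | inj₁ m″ with ∈-map⁻ _ m″
    ...   | l , l∈ , refl = two (frontier≤ {r} fr l∈)
    first-cut-Small m | inj₂ m′ | inj₂ m″ = go v refl m″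
      where
      go : ∀ v′ → v′ ≡ v → ∀ {us} → us ∈ doubled (u , r , v′) → Small k (concat us)
      go (s ∷ v′) refl (here refl) = two tr

    beheaded-Small : ∀ {us} → us ∈ beheaded (u , r , v) → Small (2 + length v) (concat us)
    beheaded-Small (here refl) = Small-mono {length v} {2 + length v} {trees v ++ []} (m≤n+m _ 2)
      (subst (Small (length v)) (sym (List.++-identityʳ (trees v))) (trees-Small fv))
    beheaded-Small (there (here refl)) = Small-mono {1 + length v} {2 + length v} {tree r ∷ (trees v ++ [])} (n≤1+n _)
      (subst (Small (1 + length v)) (cong (tree r ∷_) (sym (List.++-identityʳ (trees v))))
        (Small-∷ {length v} {tree r} {trees v} tr (trees-Small fv)))
    beheaded-Small (there (there m)) with ∈-map⁻ _ m
    ... | l , l∈ , refl = subst (Small (2 + length v)) (cong (λ w → tree r ∷ l ∷ w) (sym (List.++-identityʳ (trees v))))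
      (Small-∷ {1 + length v} {tree r} {l ∷ trees v} tr (Small-∷ {length v} {l} {trees v} (frontier≤ {r} fr l∈) (trees-Small fv)))

  split-Fits≤ : ∀ {xs u r v} → xs ≡ u ++ r ∷ v → Fits≤ xs → Fits≤ u × ∣ r ∣ᴱ ≤ n × Fits≤ v
  split-Fits≤ {u = u} refl f = All.++⁻ˡ u f , All.head (All.++⁻ʳ u f) , All.tail (All.++⁻ʳ u f)

  split-points : ∀ {b : Block} {u r v} → toList b ≡ u ++ r ∷ v → length u + suc (length v) ≡ points b
  split-points {b} {u} e = trans (sym (length-++ u)) (sym (cong length e))

  first-pieces-Small : ∀ {b us} → Fits≤ (toList b) → us ∈ first-pieces b → Small (suc (points b)) (concat us)
  first-pieces-Small {b} {us} f m with find (∈-concatMap⁻ first-cut {xs = splits (toList b)} m)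
  ... | (u , r , v) , s∈ , m′ with split-Fits≤ {u = u} (splits-sound s∈) f
  ...   | fu , fr , fv = subst (λ k → Small (suc k) (concat us)) (split-points {b} {u} (splits-sound s∈)) (first-cut-Small fu fr fv m′)

  later-pieces-Small : ∀ {b us} → Fits≤ (toList b) → us ∈ later-pieces M b → Small (suc (points b) + M * n) (concat us)
  later-pieces-Small {r ∷ []} f        (here refl)         = z≤n
  later-pieces-Small {r ∷ []} (fr ∷ _) (there (here refl)) =
    Small-mono {M * n} {2 + M * n} {concat (concat (replicate M (singletons r)))} (m≤n+m _ 2) (go M)
    where
    letters : ∀ ls → (∀ {l} → l ∈ ls → l ∈ frontier r) → Small (length ls) (concat (map (_∷ []) ls))
    letters []       f = z≤n
    letters (l ∷ ls) f = Small-∷ {length ls} {l} {concat (map (_∷ []) ls)} (frontier≤ {r} fr (f (here refl))) (letters ls (f ∘ there))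
    go : ∀ m → Small (m * n) (concat (concat (replicate m (singletons r))))
    go zero    = z≤n
    go (suc m) = subst (Small (n + m * n)) (List.concat-++ (singletons r) (concat (replicate m (singletons r))))
      (Small-++ {n} {m * n} (concat (singletons r))
        (Small-mono {length (frontier r)} {n} {concat (singletons r)} (≤-trans (length-frontier r) fr) (letters (frontier r) id)) (go m))
  later-pieces-Small {b@(_ ∷ _ ∷ _)} {us} f m with find (∈-concatMap⁻ later-cut {xs = splits (toList b)} m)
  ... | (u , r , v) , s∈ , m′ with split-Fits≤ {u = u} (splits-sound s∈) f
  ...   | fu , fr , fv = Small-mono {suc (points b)} {suc (points b) + M * n} {concat us} (m≤m+n _ _)
          (subst (λ k → Small (suc k) (concat us)) (split-points {b} {u} (splits-sound s∈)) (go u fu m′))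
    where
    go : ∀ u → Fits≤ u → us ∈ later-cut (u , r , v) → Small (suc (length u + suc (length v))) (concat us)
    go (x ∷ u) fu m = first-cut-Small fu fr fv m
    go []      fu m with ∈-++⁻ (weakened ([] , r , v)) m
    ... | inj₁ m′ = first-cut-Small fu fr fv (weakened⊆first ([] , r , v) m′)
    ... | inj₂ m′ = beheaded-Small fu fr fv m′

  negatives-Small : ∀ {t} → All (λ (_ , b) → Fits≤ (toList b)) t → ∀ {w} → w ∈ negatives t → Small (all-points t + suc (M * n)) w
  negatives-Small {(g , b) ∷ t} (f ∷ fs) m with ∈-++⁻ (map (foldr _⊕_ (spread t)) (later-pieces M b)) m
  ... | inj₁ m′ with ∈-map⁻ (foldr _⊕_ (spread t)) m′
  ...   | us , us∈ , refl = subst (λ k → Small k (foldr _⊕_ (spread t) us)) (shuffle (lastIndex b) (M * n) (all-points t))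
          (foldr-Small {suc (points b) + M * n} {all-points t} us (later-pieces-Small {b} f us∈) (spread-Small fs))
    where
    shuffle : ∀ a c d → suc (suc a) + c + d ≡ suc a + d + suc c
    shuffle = solve-∀
  negatives-Small {(g , b) ∷ t} (f ∷ fs) m | inj₂ m′ with ∈-map⁻ (word b ⊕_) m′
  ...   | w , w∈ , refl = subst (λ k → Small k (word b ⊕ w)) (sym (+-assoc (points b) (all-points t) (suc (M * n))))
          (Small-⊕ {points b} {all-points t + suc (M * n)} (word b) {w} (trees-Small f) (negatives-Small fs w∈))

  negatives₀-Small : ∀ {b t} → Fits≤ (toList b) → All (λ (_ , b) → Fits≤ (toList b)) t → ∀ {w} → w ∈ negatives₀ b t →
                     Small (points b + (all-points t + suc (M * n))) w
  negatives₀-Small {b} {t} f fs m with ∈-++⁻ (map (foldr _⊕_ (spread t)) (first-pieces b)) m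
  ... | inj₁ m′ with ∈-map⁻ (foldr _⊕_ (spread t)) m′
  ...   | us , us∈ , refl = Small-mono {suc (points b) + all-points t} {points b + (all-points t + suc (M * n))} {foldr _⊕_ (spread t) us}
          (≤-trans (m≤m+n _ (M * n)) (≤-reflexive (shuffle (lastIndex b) (M * n) (all-points t))))
          (foldr-Small {suc (points b)} {all-points t} us (first-pieces-Small {b} f us∈) (spread-Small fs))
    where
    shuffle : ∀ a c d → suc (suc a) + d + c ≡ suc a + (d + suc c)
    shuffle = solve-∀
  negatives₀-Small {b} {t} f fs m | inj₂ m′ with ∈-map⁻ (word b ⊕_) m′
  ...   | w , w∈ , refl = Small-⊕ {points b} {all-points t + suc (M * n)} (word b) {w} (trees-Small f) (negatives-Small fs w∈)

  -- Negative words per point of a block: at most n from `weakened`, n from frontier letters in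
  -- `broken` or `beheaded`, and two more.
  C : ℕ
  C = 2 + (n + n)

  first-cut-length : ∀ s → ∣ proj₁ (proj₂ s) ∣ᴱ ≤ n → length (first-cut s) ≤ C
  first-cut-length s@(u , r , v) fr = begin
    length (first-cut s)                                          ≡⟨ length-++ (weakened s) ⟩
    length (weakened s) + length (broken s ++ doubled s)          ≡⟨ cong (length (weakened s) +_) (length-++ (broken s)) ⟩
    length (weakened s) + (length (broken s) + length (doubled s))
      ≤⟨ +-mono-≤ (F≤ _) (+-mono-≤ (F≤ _) (D≤ v)) ⟩
    n + (n + 2)                                                   ≡⟨ shuffle n ⟩
    C                                                             ∎
    where
    open ≤-Reasoning
    shuffle : ∀ n → n + (n + 2) ≡ 2 + (n + n)
    shuffle = solve-∀
    F≤ : ∀ (f : Letter → List Word) → length (map f (frontier r)) ≤ n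
    F≤ f = ≤-trans (≤-reflexive (length-map f (frontier r))) (≤-trans (length-frontier r) fr)
    D≤ : ∀ v → length (doubled (u , r , v)) ≤ 2
    D≤ []      = z≤n
    D≤ (_ ∷ _) = s≤s z≤n

  later-cut-length : ∀ s → ∣ proj₁ (proj₂ s) ∣ᴱ ≤ n → length (later-cut s) ≤ C
  later-cut-length s@(_ ∷ _ , _ , _) fr = first-cut-length s fr
  later-cut-length s@([] , r , v)    fr = begin
    length (weakened s ++ beheaded s)           ≡⟨ length-++ (weakened s) ⟩
    length (weakened s) + length (beheaded s)   ≤⟨ +-mono-≤ (F≤ _) (s≤s (s≤s (F≤ _))) ⟩
    n + (2 + n)                                 ≡⟨ shuffle n ⟩
    C                                           ∎
    where
    open ≤-Reasoning
    shuffle : ∀ n → n + (2 + n) ≡ 2 + (n + n)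
    shuffle = solve-∀
    F≤ : ∀ (f : Letter → List Word) → length (map f (frontier r)) ≤ n
    F≤ f = ≤-trans (≤-reflexive (length-map f (frontier r))) (≤-trans (length-frontier r) fr)

  cuts-length : ∀ (cut : Split → List (List Word)) → (∀ s → ∣ proj₁ (proj₂ s) ∣ᴱ ≤ n → length (cut s) ≤ C) →
                ∀ {xs} → Fits≤ xs → length (concatMap cut (splits xs)) ≤ length xs * C
  cuts-length cut h {xs} f = ≤-trans
    (length-concatMap cut (splits xs) λ {s} m → h s (proj₁ (proj₂ (split-Fits≤ {u = proj₁ s} (splits-sound m) f))))
    (≤-reflexive (cong (_* C) (length-splits xs)))

  later-pieces-length : ∀ {b} → Fits≤ (toList b) → length (later-pieces M b) ≤ points b * C
  later-pieces-length {r ∷ []}     f = s≤s (s≤s z≤n)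
  later-pieces-length {_ ∷ _ ∷ _} f = cuts-length later-cut later-cut-length f

  negatives-length : ∀ {t} → All (λ (_ , b) → Fits≤ (toList b)) t → length (negatives t) ≤ all-points t * C
  negatives-length []                       = z≤n
  negatives-length {(g , b) ∷ t} (f ∷ fs) = begin
    length (map (foldr _⊕_ (spread t)) (later-pieces M b) ++ map (word b ⊕_) (negatives t))
      ≡⟨ length-++ (map (foldr _⊕_ (spread t)) (later-pieces M b)) ⟩
    length (map (foldr _⊕_ (spread t)) (later-pieces M b)) + length (map (word b ⊕_) (negatives t))
      ≡⟨ cong₂ _+_ (length-map _ (later-pieces M b)) (length-map _ (negatives t)) ⟩
    length (later-pieces M b) + length (negatives t)
      ≤⟨ +-mono-≤ (later-pieces-length {b} f) (negatives-length fs) ⟩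
    points b * C + all-points t * C   ≡⟨ *-distribʳ-+ C (points b) (all-points t) ⟨
    (points b + all-points t) * C     ∎
    where open ≤-Reasoning

  negatives₀-length : ∀ {b t} → Fits≤ (toList b) → All (λ (_ , b) → Fits≤ (toList b)) t →
                      length (negatives₀ b t) ≤ (points b + all-points t) * C
  negatives₀-length {b} {t} f fs = begin
    length (map (foldr _⊕_ (spread t)) (first-pieces b) ++ map (word b ⊕_) (negatives t))
      ≡⟨ length-++ (map (foldr _⊕_ (spread t)) (first-pieces b)) ⟩
    length (map (foldr _⊕_ (spread t)) (first-pieces b)) + length (map (word b ⊕_) (negatives t))
      ≡⟨ cong₂ _+_ (length-map _ (first-pieces b)) (length-map _ (negatives t)) ⟩
    length (first-pieces b) + length (negatives t)
      ≤⟨ +-mono-≤ (cuts-length first-cut first-cut-length f) (negatives-length fs) ⟩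
    points b * C + all-points t * C   ≡⟨ *-distribʳ-+ C (points b) (all-points t) ⟨
    (points b + all-points t) * C     ∎
    where open ≤-Reasoning

  exact-length : ∀ b t → length (exact b t) ≤ length t
  exact-length b []             = z≤n
  exact-length b ((g , b′) ∷ t) = s≤s (≤-trans (≤-reflexive (length-map _ (exact b′ t))) (exact-length b′ t))

  narrow-length : ∀ b t → length (narrow b t) ≤ length t
  narrow-length b []                 = z≤n
  narrow-length b ((zero  , b′) ∷ t) = m≤n⇒m≤1+n (≤-trans (≤-reflexive (length-map _ (narrow b′ t))) (narrow-length b′ t))
  narrow-length b ((suc g , b′) ∷ t) = s≤s (≤-trans (≤-reflexive (length-map _ (narrow b′ t))) (narrow-length b′ t))

-- A word has at most n letters for the blocks, one for a doubled point and `M` times n for frontier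
-- copies, where `M` is at most `suc n`. There are 2 + n positive words, used twice, and at most `C`
-- negative ones per point and one per gap; the summand 1 is the fact in the final letter.
width-bound size-bound : ℕ → ℕ
width-bound n = (n + suc (suc n * n)) * letter-bound (suc (n + n))
size-bound n = (2 + n) * (width-bound n + 1) + (2 + n) * (width-bound n + 1) + (n * (2 + (n + n)) + n) * (width-bound n + 1)

module _ (M : ℕ) (b : Block) (t : List Segment) (ok : OK b t) {n} (size≤ : size (b , t) ≤ n) (M≤ : M ≤ suc n) where
  open Characterise M b t ok
  open Gapped N
  open Sizes N M n
  open Negative N M
  open Tight N M

  private
    f : Fits≤ (toList b)
    f = rows-Fits≤ (toList b) (≤-trans (m≤m+n _ _) size≤)
    fs : All (λ (_ , b) → Fits≤ (toList b)) t
    fs = tail-Fits≤ t (≤-trans (m≤n+m _ (block-size b)) size≤)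
    points≤ : points b + all-points t ≤ n
    points≤ = ≤-trans (+-mono-≤ (length≤rows-size (toList b)) (all-points≤size t)) size≤
    length≤ : length t ≤ n
    length≤ = ≤-trans (length≤all-points t) (≤-trans (m≤n+m _ (points b)) points≤)

    K≤ : ∀ w → Small (points b + all-points t) w → word-size w ≤ width-bound n
    K≤ w s = Small-mono {points b + all-points t} {n + suc (suc n * n)} {w} (≤-trans points≤ (m≤m+n n _)) s

    positive-small : ∀ {w} → w ∈ positive → word-size w ≤ width-bound n
    positive-small (here refl) = K≤ small
      (Sizes.Small-⊕ N₀ M n {points b} {all-points t} (word b) (trees-Small f) (Sizes.spread-Small N₀ M n fs))
    positive-small (there (here refl)) = K≤ spreadout
      (Small-⊕ {points b} {all-points t} (word b) {Gapped.spread N t} (trees-Small f) (spread-Small fs))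
    positive-small {w} (there (there m)) = K≤ w (exact-Small {b} {t} f fs m)

    negative-small : ∀ {w} → w ∈ negative → word-size w ≤ width-bound n
    negative-small {w} m with ∈-++⁻ (negatives₀ b t) m
    ... | inj₂ m′ = K≤ w (narrow-Small {b} {t} f fs m′)
    ... | inj₁ m′ = Small-mono {points b + (all-points t + suc (M * n))} {n + suc (suc n * n)} {w}
      (≤-trans (≤-reflexive (sym (+-assoc (points b) (all-points t) _))) (+-mono-≤ points≤ (s≤s (*-monoˡ-≤ n M≤))))
      (negatives₀-Small {b} {t} f fs m′)

  E-size : ∣ E ∣ˢ ≤ size-bound n
  E-size = +-mono-≤
    (≤-trans (≤-reflexive (trans (cong sum (map-++ ∣_∣ᴾ (map (λ w → example w fresh) positive) _))
        (sum-++ (map ∣_∣ᴾ (map (λ w → example w fresh) positive)) _)))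
      (+-mono-≤ (positives fresh) (positives (suc fresh))))
    (≤-trans (examples-size fresh negative negative-small) (*-monoˡ-≤ (width-bound n + 1) count))
    where
    positives : ∀ A → sum (map ∣_∣ᴾ (map (λ w → example w A) positive)) ≤ (2 + n) * (width-bound n + 1)
    positives A = ≤-trans (examples-size A positive positive-small)
      (*-monoˡ-≤ (width-bound n + 1) (s≤s (s≤s (≤-trans (exact-length b t) length≤))))
    count : length negative ≤ n * C + n
    count = ≤-trans (≤-reflexive (length-++ (negatives₀ b t)))
      (+-mono-≤ (≤-trans (negatives₀-length {b} {t} f fs) (*-monoˡ-≤ C points≤)) (≤-trans (narrow-length b t) length≤))

-- Polynomials

infixl 6 _+ᴾ_
infixl 7 _*ᴾ_

_+ᴾ_ _*ᴾ_ : Polynomial → Polynomial → Polynomial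
[]       +ᴾ g       = g
(a ∷ f) +ᴾ []       = a ∷ f
(a ∷ f) +ᴾ (b ∷ g) = a + b ∷ f +ᴾ g
[]       *ᴾ g = []
(a ∷ f) *ᴾ g = map (a *_) g +ᴾ (0 ∷ f *ᴾ g)

eval-+ : ∀ f g x → eval (f +ᴾ g) x ≡ eval f x + eval g x
eval-+ []      g       x = refl
eval-+ (a ∷ f) []      x = sym (+-identityʳ _)
eval-+ (a ∷ f) (b ∷ g) x = trans (cong (λ v → a + b + x * v) (eval-+ f g x)) (shuffle a b x (eval f x) (eval g x))
  where
  shuffle : ∀ a b x u v → a + b + x * (u + v) ≡ a + x * u + (b + x * v)
  shuffle = solve-∀

eval-scale : ∀ a g x → eval (map (a *_) g) x ≡ a * eval g x
eval-scale a []      x = sym (*-zeroʳ a)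
eval-scale a (b ∷ g) x = trans (cong (λ v → a * b + x * v) (eval-scale a g x)) (shuffle a b x (eval g x))
  where
  shuffle : ∀ a b x v → a * b + x * (a * v) ≡ a * (b + x * v)
  shuffle = solve-∀

eval-* : ∀ f g x → eval (f *ᴾ g) x ≡ eval f x * eval g x
eval-* []      g x = refl
eval-* (a ∷ f) g x = trans (eval-+ (map (a *_) g) (0 ∷ f *ᴾ g) x)
  (trans (cong₂ (λ u v → u + x * v) (eval-scale a g x) (eval-* f g x)) (shuffle a x (eval f x) (eval g x)))
  where
  shuffle : ∀ a x u v → a * v + x * (u * v) ≡ (a + x * u) * v
  shuffle = solve-∀

IsPolynomial : (ℕ → ℕ) → Set
IsPolynomial h = ∃[ f ] ∀ x → eval f x ≡ h x

infixl 6 _⊞_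
infixl 7 _⊠_

_⊞_ : ∀ {h k} → IsPolynomial h → IsPolynomial k → IsPolynomial (λ x → h x + k x)
(f , e) ⊞ (g , e′) = f +ᴾ g , λ x → trans (eval-+ f g x) (cong₂ _+_ (e x) (e′ x))

_⊠_ : ∀ {h k} → IsPolynomial h → IsPolynomial k → IsPolynomial (λ x → h x * k x)
(f , e) ⊠ (g , e′) = f *ᴾ g , λ x → trans (eval-* f g x) (cong₂ _*_ (e x) (e′ x))

const-polynomial : ∀ c → IsPolynomial (λ _ → c)
const-polynomial c = c ∷ [] , λ x → trans (cong (c +_) (*-zeroʳ x)) (+-identityʳ c)

variable-polynomial : IsPolynomial (λ x → x)
variable-polynomial = 0 ∷ 1 ∷ [] , λ x → trans (cong (λ v → x * (1 + v)) (*-zeroʳ x)) (*-identityʳ x)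

size-polynomial : IsPolynomial size-bound
size-polynomial = (two ⊞ x) ⊠ (w ⊞ one) ⊞ (two ⊞ x) ⊠ (w ⊞ one) ⊞ (x ⊠ (two ⊞ (x ⊞ x)) ⊞ x) ⊠ (w ⊞ one)
  where
  x = variable-polynomial
  one = const-polynomial 1
  two = const-polynomial 2
  y = one ⊞ (x ⊞ x)
  w : IsPolynomial width-bound
  w = (x ⊞ (one ⊞ (one ⊞ x) ⊠ x)) ⊠ (y ⊠ ((one ⊞ y) ⊠ (one ⊞ y)))

-- A lone conjunct equivalent to p₁ ∧ p₂ can be replaced by p₁ ≤ p₂ ≤ p₁ ≤ p₂ ≤ …
-- without affecting the truth of a query in instances shorter than that sequence.

alternate : ELI → ELI → ℕ → List Segment → List Segment
alternate p₁ p₂ zero    t = t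
alternate p₁ p₂ (suc m) t = (0 , p₁ ∷ []) ∷ (0 , p₂ ∷ []) ∷ alternate p₁ p₂ m t

Tail-context : ∀ {V : Valuation} {A B} t → (∀ {p} → Tail V p A → Tail V p B) → ∀ {p} → Tail V p (t ++ A) → Tail V p (t ++ B)
Tail-context []            f ts                 = f ts
Tail-context ((g , b) ∷ t) f (q , leq , a , ts) = q , leq , a , Tail-context t f ts

module _ {V : Valuation} {p₁ p₂ r : ELI} (t : List Segment) where

  drop-alternate : ∀ m {y} → Tail V y (alternate p₁ p₂ m t) → Tail V y t
  drop-alternate zero    ts = ts
  drop-alternate (suc m) (x , y≤x , _ , x′ , x≤x′ , _ , ts) =
    Tail-early t (≤-trans (m≤m+n _ 0) (≤-trans y≤x (≤-trans (m≤m+n x 0) (≤-trans (m≤m+n (x + 0) 0) (≤-trans x≤x′ (m≤m+n x′ 0))))))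
      (drop-alternate m ts)

  insert-alternate : ∀ m {y} → V y p₁ → V y p₂ → Tail V y t → Tail V y (alternate p₁ p₂ m t)
  insert-alternate zero    {y} v₁ v₂ ts = ts
  insert-alternate (suc m) {y} v₁ v₂ ts = y , y+0 , (v₁ , tt) , y , ≤-trans (≤-reflexive (+-identityʳ (y + 0))) y+0 , (v₂ , tt) ,
    Tail-early (alternate p₁ p₂ m t) y+0 (insert-alternate m v₁ v₂ ts)
    where
    y+0 : y + 0 ≤ y
    y+0 = ≤-reflexive (+-identityʳ y)

  module _ (n : ℕ) (v∧ : ∀ {p} → V p p₁ → V p p₂ → V p r) (before : ∀ {p} → V p p₂ → p < n) where

    -- If no `p₁` shared its point with the `p₂` that follows, the position would increase in each
    -- round and finally leave the instance.
    collapse : ∀ m {y} → n ≤ y + m → y < n → Tail V y (alternate p₁ p₂ m t) → ∃[ x ] y ≤ x × V x r × Tail V x t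
    collapse zero    {y} n≤ y< ts = contradiction (≤-trans n≤ (≤-reflexive (+-identityʳ y))) (<⇒≱ y<)
    collapse (suc m) {y} n≤ y< (x , y≤x , (v₁ , _) , x′ , x≤x′ , (v₂ , _) , ts)
      with m≤n⇒m<n∨m≡n (≤-trans (m≤m+n x 0) (≤-trans (m≤m+n (x + 0) 0) x≤x′))
    ... | inj₂ refl = x , ≤-trans (m≤m+n y 0) y≤x , v∧ v₁ v₂ , Tail-early t (m≤m+n x 0) (drop-alternate m ts)
    ... | inj₁ x<x′ =
      let z , x′≤z , rest = collapse m
            (≤-trans n≤ (≤-trans (≤-reflexive (+-suc y m)) (+-monoˡ-≤ m (≤-trans (s≤s (≤-trans (m≤m+n y 0) y≤x)) x<x′))))
            (before v₂) (Tail-early (alternate p₁ p₂ m t) (m≤m+n x′ 0) ts)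
      in z , ≤-trans (≤-trans (m≤m+n y 0) y≤x) (≤-trans (<⇒≤ x<x′) x′≤z) , rest

    collapse-segment : ∀ m {g p} → n ≤ m → Tail V p ((g , p₁ ∷ []) ∷ (0 , p₂ ∷ []) ∷ alternate p₁ p₂ m t) →
                       Tail V p ((g , r ∷ []) ∷ t)
    collapse-segment m n≤ (x , leq , (v₁ , _) , x′ , x≤x′ , (v₂ , _) , ts)
      with m≤n⇒m<n∨m≡n (≤-trans (m≤m+n x 0) (≤-trans (m≤m+n (x + 0) 0) x≤x′))
    ... | inj₂ refl = x , leq , (v∧ v₁ v₂ , tt) , drop-alternate m ts
    ... | inj₁ x<x′ =
      let z , x′≤z , v , ts′ = collapse m (≤-trans n≤ (m≤n+m m x′)) (before v₂) (Tail-early (alternate p₁ p₂ m t) (m≤m+n x′ 0) ts)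
      in z , ≤-trans leq (≤-trans (<⇒≤ x<x′) x′≤z) , (v , tt) , subst (λ z → Tail V z t) (sym (+-identityʳ z)) ts′

Val-bounded : ∀ {𝒟 a p r} → Nontrivial r → Val 𝒟 a p r → p < length (toList 𝒟)
Val-bounded {𝒟} {a} {p} {r} n v with p <? length (toList 𝒟)
... | yes p< = p<
... | no p≮  = contradiction ([]-sat r (subst (_, a ⊨ᵉ r) (trans (at≡! 𝒟 p) (!-beyond (toList 𝒟) (≮⇒≥ p≮))) v)) n

module Lone (b : Block) (t₁ : List Segment) (g : ℕ) (r : ELI) (t₂ : List Segment)
            (ok : OK b (t₁ ++ (g , r ∷ []) ∷ t₂)) (dec : Decomposable r) where

  p₁ p₂ : ELI
  p₁ = proj₁ dec
  p₂ = proj₁ (proj₂ dec)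
  r≣ = proj₁ (proj₂ (proj₂ dec))
  p₁⊭ = proj₁ (proj₂ (proj₂ (proj₂ dec)))
  p₂⊭ = proj₂ (proj₂ (proj₂ (proj₂ dec)))

  t : List Segment
  t = t₁ ++ (g , r ∷ []) ∷ t₂

  blown blown-up : ℕ → List Segment
  blown m = (g , p₁ ∷ []) ∷ (0 , p₂ ∷ []) ∷ alternate p₁ p₂ m t₂
  blown-up m = t₁ ++ blown m

  p₂-nontrivial : Nontrivial p₂
  p₂-nontrivial tr = p₁⊭ (⊨ᵉ⇒⊨ᴱ {p₁} {r} λ v → ⊨ᴱ⇒⊨ᵉ {p₁ ∧ᵉ p₂} {r} (proj₂ r≣) (v , []-sat p₂ tr))

  blow-up : ∀ m {𝒟 a ℓ} → Holds (Val 𝒟 a) ℓ b t → Holds (Val 𝒟 a) ℓ b (blown-up m)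
  blow-up m {𝒟} {a} (x , ts) = x , Tail-context {Val 𝒟 a} {(g , r ∷ []) ∷ t₂} {blown m} t₁ (λ { (q , leq , (v , _) , ts) →
    let v₁ , v₂ = proj₁ r≣ 𝒟 a q v in
    q , leq , (v₁ , tt) , q , ≤-reflexive (trans (+-identityʳ (q + 0)) (+-identityʳ q)) , (v₂ , tt) ,
    Tail-early (alternate p₁ p₂ m t₂) (≤-reflexive (+-identityʳ q))
      (insert-alternate {Val 𝒟 a} {p₁} {p₂} {r} t₂ m v₁ v₂ (subst (λ q → Tail (Val 𝒟 a) q t₂) (+-identityʳ q) ts)) }) ts

  shrink : ∀ m {𝒟 a ℓ} → length (toList 𝒟) ≤ m → Holds (Val 𝒟 a) ℓ b (blown-up m) → Holds (Val 𝒟 a) ℓ b t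
  shrink m {𝒟} {a} len≤ (x , ts) = x , Tail-context {Val 𝒟 a} {blown m} {(g , r ∷ []) ∷ t₂} t₁
    (λ {p} → collapse-segment {Val 𝒟 a} {p₁} {p₂} {r} t₂ (length (toList 𝒟)) (λ {p} v₁ v₂ → proj₂ r≣ 𝒟 a p (v₁ , v₂)) (Val-bounded {𝒟} {a} {r = p₂} p₂-nontrivial) m {g} {p} len≤) ts

  N : ℕ
  N = suc (total b t)

  open Gapped N
  open Tight N 0 using (Models-⊕; spread-sat)
  open Negative N 0 using (Models)

  sh : lastIndex b < N × All Short t
  sh = total-Short {N} b t ≤-refl

  pieces : ℕ → List Word
  pieces zero    = (tree p₁ ∷ []) ∷ (tree p₂ ∷ []) ∷ []
  pieces (suc m) = (tree p₁ ∷ []) ∷ (tree p₂ ∷ []) ∷ pieces m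

  context : List Segment → Word → Word
  context []            w = w
  context ((_ , c) ∷ s) w = word c ⊕ context s w

  core : ℕ → Word
  core m = foldr _⊕_ (spread t₂) (pieces m)

  -- The alternation is spread over points that satisfy only what follows from `p₁` alone or from
  -- `p₂` alone, so that the lone conjunct holds at none of them.
  counterexample : ℕ → Word
  counterexample m = word b ⊕ context t₁ (core m)

  alternate-Short : ∀ m → All Short t₂ → All Short (alternate p₁ p₂ m t₂)
  alternate-Short zero    s = s
  alternate-Short (suc m) s = (z≤n , s≤s z≤n) ∷ (z≤n , s≤s z≤n) ∷ alternate-Short m s

  core-sat : ∀ m {g} → All Short t₂ → Some (val (core m)) ((g , p₁ ∷ []) ∷ (0 , p₂ ∷ []) ∷ alternate p₁ p₂ m t₂)
  core-sat zero s =
    0 , Models-⊕ {p₁ ∷ []} {(0 , p₂ ∷ []) ∷ t₂} {(tree p₂ ∷ []) ⊕ spread t₂} ((z≤n , s≤s z≤n) ∷ s)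
      (0 , Models-⊕ {p₂ ∷ []} {t₂} {spread t₂} s (spread-sat t₂ s))
  core-sat (suc m) s =
    0 , Models-⊕ {p₁ ∷ []} {(0 , p₂ ∷ []) ∷ t′} {(tree p₂ ∷ []) ⊕ core m} ((z≤n , s≤s z≤n) ∷ s′)
      (0 , Models-⊕ {p₂ ∷ []} {t′} {core m} s′ (core-sat m {0} s))
    where
    t′ = alternate p₁ p₂ (suc m) t₂
    s′ = alternate-Short (suc m) s

  blown-Short : ∀ m s → All Short (s ++ (g , r ∷ []) ∷ t₂) → All Short (s ++ blown m)
  blown-Short m []      ((g≤ , _) ∷ sh) = (g≤ , s≤s z≤n) ∷ (z≤n , s≤s z≤n) ∷ alternate-Short m sh
  blown-Short m (_ ∷ s) (x ∷ sh)        = x ∷ blown-Short m s sh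

  context-sat : ∀ m s → All Short (s ++ (g , r ∷ []) ∷ t₂) → Some (val (context s (core m))) (s ++ blown m)
  context-sat m []            (_ ∷ sh) = core-sat m {g} sh
  context-sat m ((h , c) ∷ s) (_ ∷ sh) =
    0 , Models-⊕ {c} {s ++ blown m} {context s (core m)} (blown-Short m s sh) (context-sat m s sh)

  counterexample-sat : ∀ m → Models (val (counterexample m)) b (blown-up m)
  counterexample-sat m = Models-⊕ {b} {blown-up m} {context t₁ (core m)} (blown-Short m t₁ (proj₂ sh)) (context-sat m t₁ (proj₂ sh))

  context-unsat : ∀ m s → OKs (s ++ (g , r ∷ []) ∷ t₂) → All Short (s ++ (g , r ∷ []) ∷ t₂) →
                  ¬ Some (val (context s (core m))) (s ++ (g , r ∷ []) ∷ t₂)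
  context-unsat m []            ok sh x = avoid-pieces {g} {r ∷ []} {t₂} ok sh (pieces m) (avoid m) x
    where
    not-at : ∀ {p x} → ¬ (p ⊨ᴱ r) → x + 0 < 1 → ¬ At (val (tree p ∷ [])) x (r ∷ [])
    not-at {p} {zero}  n _        (v , _) = n (tree⁻ {p} {r} v)
    not-at {p} {suc x} n (s≤s ())
    avoid : ∀ m {u} → u ∈ pieces m → ∀ {x} → x + 0 < length u → ¬ At (val u) x (r ∷ [])
    avoid zero    (here refl)         {x} = not-at {p₁} {x} p₁⊭
    avoid zero    (there (here refl)) {x} = not-at {p₂} {x} p₂⊭
    avoid (suc m) (here refl)         {x} = not-at {p₁} {x} p₁⊭
    avoid (suc m) (there (here refl)) {x} = not-at {p₂} {x} p₂⊭
    avoid (suc m) (there (there k))       = avoid m k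
  context-unsat m ((h , c) ∷ s) (good , n3 , _ , ok) ((_ , c<) ∷ sh) x =
    context-unsat m s ok sh (forward {c} {s ++ (g , r ∷ []) ∷ t₂} {context s (core m)}
      (weak {c} {s ++ (g , r ∷ []) ∷ t₂} good n3 ok) c< sh (Some⇒From {g = h} {c} {s ++ (g , r ∷ []) ∷ t₂} good x))

  counterexample-unsat : ∀ m → ¬ Models (val (counterexample m)) b t
  counterexample-unsat m (a , ts) = context-unsat m t₁ (proj₂ (proj₂ ok)) (proj₂ sh)
    (forward {b} {t} {context t₁ (core m)} ok (proj₁ sh) (proj₂ sh) (0 , inj₁ refl , a , ts))

  empty-end : ∀ w p → (w ++ [] ∷ []) ! p ≡ w ! p
  empty-end w p with snoc-! w {[]} p
  ... | inj₁ e        = e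
  ... | inj₂ (e , e′) = trans e (sym e′)

  not-characterisable : ∀ {q} → (∀ {𝒟 a ℓ} → 𝒟 , a , ℓ ⊨ q → Holds (Val 𝒟 a) ℓ b t) →
                        (∀ {𝒟 a ℓ} → Holds (Val 𝒟 a) ℓ b t → 𝒟 , a , ℓ ⊨ q) →
                        ¬ UniquelyCharacterisable q 𝒬ₚ[ ｛ ○ ｝ ∪ ｛ ◇ᵣ ｝ ]
  not-characterisable {q} q⁺ q⁻ (E , (fits⁺ , fits⁻) , unique) =
    counterexample-unsat m (Holds-map b t (λ p x → subst (_⊩ᴸ x) (e p)) (q⁺ (proj₂ q≣q′ 𝒟 0 0
      (query⁺ (first b) (List⁺.tail b) (blown-up m)
        (Holds-map b (blown-up m) (λ p x → subst (_⊩ᴸ x) (sym (e p))) (counterexample-sat m))))))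
    where
    -- With so many rounds `q′` entails `q` in each negative example; positive examples are kept
    -- because `q` entails `q′`.
    m = maximum (map (λ e → length (toList (instᵀ e))) (neg E))
    q′ = query (first b) (List⁺.tail b) (blown-up m)
    q≣q′ = unique q′ (query∈ (first b) (List⁺.tail b) (blown-up m))
      ( All.map (λ h → query⁺ (first b) (List⁺.tail b) (blown-up m) (blow-up m (q⁺ h))) fits⁺
      , All.tabulate (λ {e} e∈ h → All.lookup fits⁻ e∈ (q⁻ (shrink m (∈⇒≤maximum (∈-map⁺ (λ e → length (toList (instᵀ e))) e∈))
          (query⁻ (first b) (List⁺.tail b) (blown-up m) h)))) )
    𝒟 : TemporalInstance
    𝒟 = pad (counterexample m) []
    e : ∀ p → 𝒟 at p ≡ counterexample m ! p
    e p = trans (pad-at (counterexample m) [] p) (empty-end (counterexample m) p)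

lone⇒not-characterisable : ∀ {q b t} → OK b t → (∀ {𝒟 a ℓ} → 𝒟 , a , ℓ ⊨ q → Holds (Val 𝒟 a) ℓ b t) →
  (∀ {𝒟 a ℓ} → Holds (Val 𝒟 a) ℓ b t → 𝒟 , a , ℓ ⊨ q) →
  ∀ t₁ {g r t₂} → t ≡ t₁ ++ (g , r ∷ []) ∷ t₂ → Decomposable r → ¬ UniquelyCharacterisable q 𝒬ₚ[ ｛ ○ ｝ ∪ ｛ ◇ᵣ ｝ ]
lone⇒not-characterisable {q} {b} ok q⁺ q⁻ t₁ {g} {r} {t₂} refl dec = Lone.not-characterisable b t₁ g r t₂ ok dec {q} q⁺ q⁻

-- Characterisability, safety and polynomial bounds

characterisable⇒homogeneous : ∀ q → UniquelyCharacterisable q 𝒬ₚ[ ｛ ○ ｝ ∪ ｛ ◇ᵣ ｝ ] → AllHomogeneous (proj₂ (normalise q))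
characterisable⇒homogeneous q uc with homogeneous? (proj₂ (normalise q))
... | inj₁ hs = hs
... | inj₂ (t₁ , g , r , t₂ , e , dec) = contradiction uc
  (lone⇒not-characterisable {q} {proj₁ (normalise q)} {proj₂ (normalise q)} (normalise-OK q) (normalise⁺ q) (normalise⁻ q) t₁ e dec)

characterisable⇒safe : ∀ q → UniquelyCharacterisable q 𝒬ₚ[ ｛ ○ ｝ ∪ ｛ ◇ᵣ ｝ ] → Safe q
characterisable⇒safe q uc =
  divide b t , OK⇒normal-form b t (normalise-OK q) , homogeneous⇒no-lone-conjuncts b t (characterisable⇒homogeneous q uc) ,
  (λ 𝒟 a ℓ h → unfold⁺ (b ∷ blocksOf t) (gapssOf t)
    (subst (λ (b , t) → Holds (Val 𝒟 a) ℓ b t) (sym (unfold-divide b t)) (normalise⁺ q h))) ,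
  (λ 𝒟 a ℓ h → normalise⁻ q
    (subst (λ (b , t) → Holds (Val 𝒟 a) ℓ b t) (unfold-divide b t) (unfold⁻ (b ∷ blocksOf t) (gapssOf t) h)))
  where
  b = proj₁ (normalise q)
  t = proj₂ (normalise q)

safe⇒characterisable : ∀ {𝒬} q → Safe q → UniquelyCharacterisable q 𝒬
safe⇒characterisable q (d , nf , no-lone , q⊨d , d⊨q) =
  E , fits {q} q⁺ q⁻ , λ q′ _ → unique {q} q⁺ q⁻ q′ (inj₁ (no-lone-conjuncts⇒homogeneous d no-lone , ≤-refl))
  where
  b = proj₁ (unfold (Division.blocks d) (Division.gaps d))
  t = proj₂ (unfold (Division.blocks d) (Division.gaps d))
  open Characterise 1 b t (normal-form⇒OK d nf)
  q⁺ : ∀ {𝒟 a ℓ} → 𝒟 , a , ℓ ⊨ q → Holds (Val 𝒟 a) ℓ b t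
  q⁺ {𝒟} {a} {ℓ} h = unfold⁻ (Division.blocks d) (Division.gaps d) (q⊨d 𝒟 a ℓ h)
  q⁻ : ∀ {𝒟 a ℓ} → Holds (Val 𝒟 a) ℓ b t → 𝒟 , a , ℓ ⊨ q
  q⁻ {𝒟} {a} {ℓ} h = d⊨q 𝒟 a ℓ (unfold⁺ (Division.blocks d) (Division.gaps d) h)

characterise : ∀ {𝒬} M q {n} → ∣ q ∣ ≤ n → M ≤ suc n →
  (∀ q′ → 𝒬 q′ → AllHomogeneous (proj₂ (normalise q)) × 1 ≤ M ⊎ Bounded M (proj₂ (normalise q′))) →
  CharacterisableWithin q 𝒬 (eval (proj₁ size-polynomial) n)
characterise M q {n} q≤ M≤ tame =
  E , (fits {q} (normalise⁺ q) (normalise⁻ q) , λ q′ q′∈ → unique {q} (normalise⁺ q) (normalise⁻ q) q′ (tame q′ q′∈)) ,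
  ≤-trans (E-size M b t (normalise-OK q) (≤-trans (normalise-size q) q≤) M≤) (≤-reflexive (sym (proj₂ size-polynomial n)))
  where
  b = proj₁ (normalise q)
  t = proj₂ (normalise q)
  open Characterise M b t (normalise-OK q)

theorem27 : (∀ q → 𝒬ₚ[ ｛ ○ ｝ ∪ ｛ ◇ᵣ ｝ ] q →
    UniquelyCharacterisable q 𝒬ₚ[ ｛ ○ ｝ ∪ ｛ ◇ᵣ ｝ ] ⇔ Safe q)
    × (∃[ f ] ∀ q → 𝒬ₚ[ ｛ ○ ｝ ∪ ｛ ◇ᵣ ｝ ] q →
    UniquelyCharacterisable q 𝒬ₚ[ ｛ ○ ｝ ∪ ｛ ◇ᵣ ｝ ] →
    CharacterisableWithin q 𝒬ₚ[ ｛ ○ ｝ ∪ ｛ ◇ᵣ ｝ ] (eval f ∣ q ∣))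
    × PolynomiallyCharacterisableForBoundedSize 𝒬ₚ[ ｛ ○ ｝ ∪ ｛ ◇ᵣ ｝ ]
    × PolynomiallyCharacterisable 𝒬ₚ[ ｛ ○ ｝ ∪ ｛ ◇ ｝ ]
theorem27 =
    (λ q _ → mk⇔ (characterisable⇒safe q) (safe⇒characterisable q))
  -- Characterisability makes the computed normal form homogeneous, so that one frontier copy
  -- suffices; its size is at most that of `q`.
  , (proj₁ size-polynomial , λ q _ uc → characterise 1 q ≤-refl (s≤s z≤n)
      (λ _ _ → inj₁ (characterisable⇒homogeneous q uc , ≤-refl)))
  -- A competitor of size at most n has at most n later blocks, hence n copies serve all its runs.
  , (proj₁ size-polynomial , λ n q (_ , q≤) → characterise n q q≤ (n≤1+n n)
      (λ q′ (_ , q′≤) → inj₂ (length≤⇒Bounded (proj₂ (normalise q′))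
        (≤-trans (length≤tail-size (proj₂ (normalise q′)))
          (≤-trans (m≤n+m _ (block-size (proj₁ (normalise q′)))) (≤-trans (normalise-size q′) q′≤))))))
  -- Normal forms of competitors have only positive gaps, so no run goes beyond its first label.
  , (proj₁ size-polynomial , λ q _ → characterise 1 q ≤-refl (s≤s z≤n)
      (λ q′ q′∈ → inj₂ (Strict⇒Bounded (normalise-Strict q′ q′∈))))
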